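{- Let $V$ be a scanning function computable in polynomial space that is $g$-filling for some polynomial $g$. If $Z\subseteq\mathbb{N}$ is polynomial space random, then so is $Z \circ V$.
   Context: Subsets of $\mathbb{N}$ are identified with languages over the unary alphabet $\{0\}$. A scanning function is a function $V\colon \{0,1\}^* \to \{0\}^*$ (values identified with natural numbers) such that $V(\alpha) \neq V(\alpha\upharpoonright i)$ for every $\alpha\in\{0,1\}^*$ and every $i<|\alpha|$; $V(\alpha\upharpoonright i)$ is called the $i$-th query in the run of $V$ on $\alpha$. For $Z\subseteq\mathbb{N}$, $Z\circ V$ is the set $Y\subseteq\mathbb{N}$ defined recursively by $Y(i)=Z(V(Y\upharpoonright i))$ for each $i$. For $g\colon\mathbb{N}\to\mathbb{N}$, $V$ is $g$-filling if for every $n$ and every $\alpha\in\{0,1\}^{g(n)}$, for every $r<n$ there is $i$ with $V(\alpha\upharpoonright i)=r$. A martingale is a function $M$ from $\{0,1\}^*$ to the positive rationals with $M(x)=(M(x0)+M(x1))/2$ for all $x$; it succeeds on $Z$ if $\limsup_n M(Z\upharpoonright n)=\infty$. A martingale is computable in polynomial space if $M(x)$ (as a rational in lowest terms, numerator and denominator in binary) can be computed in space polynomial in $|x|$, including the space for writing the output. $Z$ is polynomial space random if no martingale computable in polynomial space succeeds on $Z$. -}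

module Defs where

open import Data.Nat using (ℕ; zero; suc; _+_; _*_; _<_; _≤_; _≡ᵇ_)
open import Data.Nat.DivMod using (_/_; _%_)
open import Data.Bool using (Bool; true; false; if_then_else_)
open import Data.List using (List; []; _∷_; _++_; length; take; map; upTo; reverse; replicate; [_])
open import Data.Fin using (Fin)
open import Data.Fin.Properties using () renaming (_≟_ to _≟ᶠ_)
open import Data.Product using (Σ; ∃; _×_; _,_)
open import Data.Integer using (∣_∣)
open import Data.Rational using (ℚ; ½; 0ℚ) renaming (_<_ to _<ℚ_; _+_ to _+ℚ_; _*_ to _*ℚ_)
open import Relation.Binary.PropositionalEquality using (_≡_; _≢_)
open import Relation.Nullary using (¬_; yes; no)

Subset : Set
Subset = ℕ → Bool

_↾_ : Subset → ℕ → List Bool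
Z ↾ n = map Z (upTo n)

Poly : Set
Poly = List ℕ

evalPoly : Poly → ℕ → ℕ
evalPoly []       n = 0
evalPoly (c ∷ cs) n = c + n * evalPoly cs n

data Sym : Set where
  blank o0 o1 hash : Sym

data Dir : Set where
  L R : Dir

record TM : Set where
  field
    nstates : ℕ
    start   : Fin nstates
    halt    : Fin nstates
    δ       : Fin nstates → Sym → Fin nstates × Sym × Dir

-- Configuration: state, cells left of head (nearest first), scanned
-- symbol, cells right of head.  The cells represented are exactly the
-- cells visited so far (plus the input).
record Config (M : TM) : Set where
  constructor cfg
  field
    state : Fin (TM.nstates M)
    left  : List Sym
    cur   : Sym
    right : List Sym

module _ (M : TM) where
  open TM M

  initial : List Sym → Config M
  initial []       = cfg start [] blank []
  initial (s ∷ ss) = cfg start [] s ss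

  halted : Config M → Set
  halted c = Config.state c ≡ halt

  step : Config M → Config M
  step (cfg q l c r) with q ≟ᶠ halt
  ... | yes _ = cfg q l c r
  ... | no  _ with δ q c
  ...   | (q' , s , L) with l
  ...     | []      = cfg q' [] s r
  ...     | (x ∷ l') = cfg q' l' x (s ∷ r)
  step (cfg q l c r) | no _ | (q' , s , R) with r
  ...     | []      = cfg q' (s ∷ l) blank []
  ...     | (x ∷ r') = cfg q' (s ∷ l) x r'

  run : ℕ → Config M → Config M
  run zero    c = c
  run (suc t) c = run t (step c)

  space : Config M → ℕ
  space (cfg _ l _ r) = length l + suc (length r)

  tape : Config M → List Sym
  tape (cfg _ l c r) = reverse l ++ c ∷ r

takeNonBlank : List Sym → List Sym
takeNonBlank []           = []
takeNonBlank (blank ∷ _)  = []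
takeNonBlank (o0 ∷ xs)    = o0 ∷ takeNonBlank xs
takeNonBlank (o1 ∷ xs)    = o1 ∷ takeNonBlank xs
takeNonBlank (hash ∷ xs)  = hash ∷ takeNonBlank xs

output : (M : TM) → Config M → List Sym
output M c = takeNonBlank (tape M c)

-- M, started on input (encoding of) x, halts with output (encoding of) f x,
-- and along the whole run never uses more than p(|x|) tape cells
-- (this includes input and output space).
record PSpaceComputes {A B : Set} (encA : A → List Sym) (size : A → ℕ)
                      (encB : B → List Sym) (f : A → B)
                      (M : TM) (p : Poly) : Set where
  field
    halts  : ∀ x → ∃ λ t → halted M (run M t (initial M (encA x)))
                          × output M (run M t (initial M (encA x))) ≡ encB (f x)
    bound  : ∀ x t → space M (run M t (initial M (encA x))) ≤ evalPoly p (size x)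

PSpaceComputable : {A B : Set} (encA : A → List Sym) (size : A → ℕ)
                   (encB : B → List Sym) (f : A → B) → Set
PSpaceComputable encA size encB f =
  Σ TM λ M → Σ Poly λ p → PSpaceComputes encA size encB f M p

encBit : Bool → Sym
encBit false = o0
encBit true  = o1

encBits : List Bool → List Sym
encBits = map encBit

encUnary : ℕ → List Sym
encUnary n = replicate n o0

-- binary notation of a natural number, least significant bit first
-- (first argument is fuel; n itself is enough); 0 ↦ empty string
binLSB : ℕ → ℕ → List Bool
binLSB zero       n = []
binLSB (suc fuel) zero = []
binLSB (suc fuel) (suc n) = (if (suc n % 2 ≡ᵇ 1) then true else false)
                            ∷ binLSB fuel (suc n / 2)

bin : ℕ → List Bool
bin n = reverse (binLSB n n)

-- a rational in lowest terms (ℚ is normalised in the library):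
-- |numerator| in binary, then #, then denominator in binary.
-- (Only positive rationals are ever encoded here.)
encℚ : ℚ → List Sym
encℚ q = encBits (bin ∣ ℚ.numerator q ∣) ++ hash ∷ encBits (bin (ℚ.denominatorℕ q))

IsScanning : (List Bool → ℕ) → Set
IsScanning V = ∀ (α : List Bool) (i : ℕ) → i < length α → V α ≢ V (take i α)

-- Z ∘ V : Y(i) = Z (V (Y ↾ i)).  prefixY i is Y ↾ i.
prefixY : Subset → (List Bool → ℕ) → ℕ → List Bool
prefixY Z V zero    = []
prefixY Z V (suc i) = prefixY Z V i ++ [ Z (V (prefixY Z V i)) ]

_∘ˢ_ : Subset → (List Bool → ℕ) → Subset
(Z ∘ˢ V) i = Z (V (prefixY Z V i))

Filling : (ℕ → ℕ) → (List Bool → ℕ) → Set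
Filling g V = ∀ (n : ℕ) (α : List Bool) → length α ≡ g n →
              ∀ r → r < n → ∃ λ i → i < length α × V (take i α) ≡ r

IsMartingale : (List Bool → ℚ) → Set
IsMartingale M = (∀ x → 0ℚ <ℚ M x)
               × (∀ x → M x ≡ (M (x ++ [ false ]) +ℚ M (x ++ [ true ])) *ℚ ½)

-- limsup_n M (Z ↾ n) = ∞, i.e. the values are unbounded.
Succeeds : (List Bool → ℚ) → Subset → Set
Succeeds M Z = ∀ (c : ℚ) → ∃ λ n → c <ℚ M (Z ↾ n)

PSpaceMartingale : (List Bool → ℚ) → Set
PSpaceMartingale M = IsMartingale M × PSpaceComputable encBits length encℚ M

PSpaceRandom : Subset → Set
PSpaceRandom Z = ∀ (M : List Bool → ℚ) → PSpaceMartingale M → ¬ Succeeds M Z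

{-# OPTIONS --safe #-}
module Submission where

-- Let N be a martingale that succeeds on Z ∘ V.  A first modification makes it save: whenever the
-- capital doubles, half of it is put aside, so that it never falls far below a level once reached.
-- All values are rounded to dyadic rationals of short denominator; otherwise the sums below would
-- not fit in polynomial space.  Then D(x), for |x| = n, is the average of the modified martingale
-- over the strings α of length g(n) that agree with x on all queries r < n made along α.  As V is
-- g-filling and never repeats a query, all r < n have been asked after g(n) steps, exactly once.
-- Hence longer α give the same average, and each α that agrees with x agrees with exactly one of
-- x0 and x1; this makes D a martingale.  If n exceeds the queries made along (Z ∘ V) ↾ i, then every
-- long α that agrees with Z ↾ n extends (Z ∘ V) ↾ i, so D(Z ↾ n) is at least the amount saved there.
--
-- For the complexity bound, numbers are kept on the tape as a stack of numerals in bijective base 2.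
-- The functions computable this way, with values of polynomially bounded length, are closed under
-- composition and bounded primitive recursion; since only space is counted, loops of exponential
-- length and exhaustive search below a given number are free, and the machines for V and N can be
-- simulated step by step on coded configurations until they must have halted.

open import Defs
open import Data.Bool using (Bool; true; false; if_then_else_; not; _∧_) renaming (T to IsTrue)
open import Data.Fin using (Fin; zero; suc; toℕ; fromℕ<; splitAt; _↑ˡ_; _↑ʳ_)
open import Data.Fin.Patterns using (0F; 1F; 2F; 3F; 4F)
open import Data.Fin.Properties using (splitAt-↑ˡ; splitAt-↑ʳ; pigeonhole; toℕ<n; fromℕ<-injective; toℕ-injective) renaming (_≟_ to _≟ᶠ_)
open import Data.List using (List; []; _∷_; _++_; _ʳ++_; length; take; drop; map; upTo; reverse; applyUpTo)
open import Data.List.Properties using (length-++; length-map; length-reverse; length-replicate; ʳ++-defn; ++-ʳ++; ++-identityʳ; reverse-involutive; unfold-reverse; map-++; length-ʳ++; reverse-++; map-upTo; length-upTo; upTo-∷ʳ; take-all; take-take; length-take; drop-drop; drop-all)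
open import Data.List.Relation.Unary.All using (All; []; _∷_)
import Data.List.Relation.Unary.All as All
import Data.List.Relation.Unary.All.Properties as AllP
open import Data.Nat
open import Data.Nat.Properties
open import Data.Nat.DivMod
open import Data.Nat.Tactic.RingSolver using (solve-∀)
open import Data.Product using (Σ; ∃; ∃₂; _×_; _,_; proj₁; proj₂)
open import Data.Sum using (_⊎_; inj₁; inj₂)
open import Data.Unit using (⊤; tt)
open import Data.Vec using (Vec; []; _∷_; lookup; _[_]≔_)
import Data.Vec as Vec
import Data.Vec.Properties as VecP
open import Function using (_∘_; id; case_of_)
open import Relation.Binary.PropositionalEquality
open import Relation.Nullary using (¬_; yes; no; contradiction)
open import Data.Integer using (∣_∣)
open import Data.Rational using (ℚ)
import Data.Integer as ℤ
import Data.Integer.Properties as ℤP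
import Data.Rational as ℚ′
import Data.Rational.Properties as ℚP
import Data.Rational.Unnormalised as ℚᵘ
import Data.Rational.Unnormalised.Properties as ℚᵘP
open import Data.Nat.Coprimality using (Coprime; coprime-divisor) renaming (recompute to recompute-coprime; sym to coprime-sym)
open import Data.Nat.Divisibility using (_∣_; divides; ∣⇒≤)

-- Turing machine fragments

-- Savings are forced by the averaging. The strings over which `D` averages extend a prefix of Z ∘
-- V, but their remaining queries below n are again answered by Z, and on those answers `N` may lose
-- whatever it had won. An amount put aside is never staked again, so it is present on every such
-- string. Rounding is in conflict with fairness: the values of `N` on exponentially many strings
-- have unrelated denominators, while their floors satisfy the averaging equation only up to one
-- unit. Therefore the new capital is not the floor of anything. It is accumulated from the
-- differences between the floors at the two successors of a string; these differences are opposite,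
-- so fairness is exact, and a reserve of two units pays for all rounding errors. Histories are
-- coded with the most recent bit first, so that one more step of a run is one more cons and
-- functions of a history are defined by recursion on its code. The machines for `V` and `N`
-- therefore receive reversed codes.

data Move : Set where
  ←m →m stay : Move

-- A tape is the list of cells left of the head (nearest first) together
-- with the cells from the head on; the latter never end in a blank.
Tape : Set
Tape = List Sym × List Sym

infixr 5 _∷ₙ_
_∷ₙ_ : Sym → List Sym → List Sym
blank ∷ₙ []      = []
blank ∷ₙ (x ∷ v) = blank ∷ x ∷ v
o0    ∷ₙ v       = o0 ∷ v
o1    ∷ₙ v       = o1 ∷ v
hash  ∷ₙ v       = hash ∷ v

read : List Sym → Sym
read []      = blank
read (c ∷ _) = c

rest : List Sym → List Sym
rest []      = []
rest (_ ∷ v) = v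

act : Sym → Move → Tape → Tape
act s stay (u , v)     = u , s ∷ₙ rest v
act s →m   (u , v)     = s ∷ u , rest v
act s ←m   ([] , v)    = [] , s ∷ₙ rest v
act s ←m   (x ∷ u , v) = u , x ∷ₙ s ∷ₙ rest v

record Finite (S : Set) : Set where
  field
    size    : ℕ
    to      : S → Fin size
    from    : Fin size → S
    from∘to : ∀ s → from (to s) ≡ s

open Finite

⊤-finite : Finite ⊤
⊤-finite = record { size = 1 ; to = λ _ → zero ; from = λ _ → tt ; from∘to = λ _ → refl }

digit : Sym → Fin 5
digit blank = 1F
digit o0    = 2F
digit o1    = 3F
digit hash  = 4F

symbol : Fin 5 → Sym
symbol 0F = blank
symbol 1F = blank
symbol 2F = o0
symbol 3F = o1
symbol 4F = hash

symbol-digit : ∀ c → symbol (digit c) ≡ c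
symbol-digit blank = refl
symbol-digit o0    = refl
symbol-digit o1    = refl
symbol-digit hash  = refl

Sym-finite : Finite Sym
Sym-finite = record { size = 5 ; to = digit ; from = symbol ; from∘to = symbol-digit }

⊎-finite : ∀ {S T} → Finite S → Finite T → Finite (S ⊎ T)
⊎-finite {S} {T} A B = record { size = size A + size B ; to = to′ ; from = from′ ∘ splitAt (size A) ; from∘to = from∘to′ }
  where
  to′ : S ⊎ T → Fin (size A + size B)
  to′ (inj₁ s) = to A s ↑ˡ size B
  to′ (inj₂ t) = size A ↑ʳ to B t
  from′ : Fin (size A) ⊎ Fin (size B) → S ⊎ T
  from′ (inj₁ i) = inj₁ (from A i)
  from′ (inj₂ j) = inj₂ (from B j)
  from∘to′ : ∀ s → from′ (splitAt (size A) (to′ s)) ≡ s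
  from∘to′ (inj₁ s) rewrite splitAt-↑ˡ (size A) (to A s) (size B) = cong inj₁ (from∘to A s)
  from∘to′ (inj₂ t) rewrite splitAt-↑ʳ (size A) (size B) (to B t) = cong inj₂ (from∘to B t)

-- inj₂ tt stands for "left the fragment".
record Frag : Set₁ where
  no-eta-equality
  field
    State  : Set
    finite : Finite State
    entry  : State ⊎ ⊤
    δF     : State → Sym → (State ⊎ ⊤) × Sym × Move

open Frag

stepF : (F : Frag) → State F → Tape → (State F ⊎ ⊤) × Tape
stepF F s t = let (m , x , d) = δF F s (read (proj₂ t)) in m , act x d t

-- A machine acquires a new cell only when its head moves right past the last one, so a bound on the
-- head position bounds the space. The 2 counts the scanned cell and the cell that a step to the
-- right may add.
data Reach (F : Frag) (B : ℕ) : (State F ⊎ ⊤) × Tape → (State F ⊎ ⊤) × Tape → Set where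
  stop : ∀ {x} → Reach F B x x
  next : ∀ {s t y} → 2 + length (proj₁ t) ≤ B → Reach F B (stepF F s t) y → Reach F B (inj₁ s , t) y

Reach-trans : ∀ {F B x y z} → Reach F B x y → Reach F B y z → Reach F B x z
Reach-trans stop       q = q
Reach-trans (next b p) q = next b (Reach-trans p q)

record Runs (F : Frag) (B : ℕ) (t t′ : Tape) : Set where
  constructor runs
  field reach : Reach F B (entry F , t) (inj₂ tt , t′)

open Runs

-- `k` may send the exit of `F` to a state of `G`; this is how control passes on in `⨾`, `branch`
-- and `while`.
record Embedding (F G : Frag) (k : State F ⊎ ⊤ → State G ⊎ ⊤) : Set where
  field
    inner : State F → State G
    k-in  : ∀ s → k (inj₁ s) ≡ inj₁ (inner s)
    k-out : ∀ s c → δF G (inner s) c ≡ (let (m , x , d) = δF F s c in k m , x , d)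

embed : ∀ {F G k B} → Embedding F G k → ∀ {m t m′ t′} → Reach F B (m , t) (m′ , t′) → Reach G B (k m , t) (k m′ , t′)
embed e stop = stop
embed {F} {G} {k} {B} e {inj₁ s} {t} (next b p) rewrite Embedding.k-in e s =
  next b (subst (λ x → Reach G B (proj₁ x , act (proj₁ (proj₂ x)) (proj₂ (proj₂ x)) t) _) (sym (Embedding.k-out e s (read (proj₂ t)))) (embed e p))

infixr 4 _⨾_
opaque
  _⨾_ : Frag → Frag → Frag
  F ⨾ G = record { State = State F ⊎ State G ; finite = ⊎-finite (finite F) (finite G) ; entry = left (entry F) ; δF = trans′ }
    module Seq where
    right : State G ⊎ ⊤ → (State F ⊎ State G) ⊎ ⊤
    right (inj₁ s)  = inj₁ (inj₂ s)
    right (inj₂ tt) = inj₂ tt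
    left : State F ⊎ ⊤ → (State F ⊎ State G) ⊎ ⊤
    left (inj₁ s)  = inj₁ (inj₁ s)
    left (inj₂ tt) = right (entry G)
    trans′ : State F ⊎ State G → Sym → ((State F ⊎ State G) ⊎ ⊤) × Sym × Move
    trans′ (inj₁ s) c = let (m , x , d) = δF F s c in left m , x , d
    trans′ (inj₂ s) c = let (m , x , d) = δF G s c in right m , x , d

opaque
  unfolding _⨾_
  _⨾ʳ_ : ∀ {F G B t t′ t″} → Runs F B t t′ → Runs G B t′ t″ → Runs (F ⨾ G) B t t″
  _⨾ʳ_ {F} {G} p q = runs (Reach-trans
    (embed {k = Seq.left F G} (record { inner = inj₁ ; k-in = λ _ → refl ; k-out = λ _ _ → refl }) (reach p))
    (embed {k = Seq.right F G} (record { inner = inj₂ ; k-in = λ _ → refl ; k-out = λ _ _ → refl }) (reach q)))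
infixr 4 _⨾ʳ_

opaque
  doing : (Sym → Sym) → Move → Frag
  doing f d = record { State = ⊤ ; finite = ⊤-finite ; entry = inj₁ tt ; δF = λ _ c → inj₂ tt , f c , d }

  doing-runs : ∀ {f d B u v} → 2 + length u ≤ B → Runs (doing f d) B (u , v) (act (f (read v)) d (u , v))
  doing-runs b = runs (next b stop)

opaque
  branch : (Sym → Bool) → Frag → Frag → Frag
  branch p F G = record { State = ⊤ ⊎ (State F ⊎ State G) ; finite = ⊎-finite ⊤-finite (⊎-finite (finite F) (finite G))
                        ; entry = inj₁ (inj₁ tt) ; δF = trans′ }
    module Branch where
    inF : State F ⊎ ⊤ → (⊤ ⊎ (State F ⊎ State G)) ⊎ ⊤
    inF (inj₁ s)  = inj₁ (inj₂ (inj₁ s))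
    inF (inj₂ tt) = inj₂ tt
    inG : State G ⊎ ⊤ → (⊤ ⊎ (State F ⊎ State G)) ⊎ ⊤
    inG (inj₁ s)  = inj₁ (inj₂ (inj₂ s))
    inG (inj₂ tt) = inj₂ tt
    trans′ : ⊤ ⊎ (State F ⊎ State G) → Sym → ((⊤ ⊎ (State F ⊎ State G)) ⊎ ⊤) × Sym × Move
    trans′ (inj₁ tt) c        = (if p c then inF (entry F) else inG (entry G)) , c , stay
    trans′ (inj₂ (inj₁ s)) c = let (m , x , d) = δF F s c in inF m , x , d
    trans′ (inj₂ (inj₂ s)) c = let (m , x , d) = δF G s c in inG m , x , d

-- A test writes back the symbol that it has read; under this condition that leaves the tape
-- unchanged.
Normal : List Sym → Set
Normal v = read v ∷ₙ rest v ≡ v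

opaque
  unfolding branch
  branch-true : ∀ {p F G B u v t′} → p (read v) ≡ true → Normal v → 2 + length u ≤ B →
                Runs F B (u , v) t′ → Runs (branch p F G) B (u , v) t′
  branch-true {p} {F} {G} {B} {u} {v} {t′} e nv b q = runs (next b lemma)
    where
    lemma : Reach (branch p F G) B (stepF (branch p F G) (inj₁ tt) (u , v)) (inj₂ tt , t′)
    lemma rewrite e | nv = embed {k = Branch.inF p F G} (record { inner = inj₂ ∘ inj₁ ; k-in = λ _ → refl ; k-out = λ _ _ → refl }) (reach q)

  branch-false : ∀ {p F G B u v t′} → p (read v) ≡ false → Normal v → 2 + length u ≤ B →
                 Runs G B (u , v) t′ → Runs (branch p F G) B (u , v) t′
  branch-false {p} {F} {G} {B} {u} {v} {t′} e nv b q = runs (next b lemma)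
    where
    lemma : Reach (branch p F G) B (stepF (branch p F G) (inj₁ tt) (u , v)) (inj₂ tt , t′)
    lemma rewrite e | nv = embed {k = Branch.inG p F G} (record { inner = inj₂ ∘ inj₂ ; k-in = λ _ → refl ; k-out = λ _ _ → refl }) (reach q)

opaque
  while : (Sym → Bool) → Frag → Frag
  while p F = record { State = ⊤ ⊎ State F ; finite = ⊎-finite ⊤-finite (finite F) ; entry = inj₁ (inj₁ tt) ; δF = trans′ }
    module While where
    inF : State F ⊎ ⊤ → (⊤ ⊎ State F) ⊎ ⊤
    inF (inj₁ s)  = inj₁ (inj₂ s)
    inF (inj₂ tt) = inj₁ (inj₁ tt)
    trans′ : ⊤ ⊎ State F → Sym → ((⊤ ⊎ State F) ⊎ ⊤) × Sym × Move
    trans′ (inj₁ tt) c = (if p c then inF (entry F) else inj₂ tt) , c , stay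
    trans′ (inj₂ s) c  = let (m , x , d) = δF F s c in inF m , x , d

  while-true : ∀ {p F B u v t′ t″} → p (read v) ≡ true → Normal v → 2 + length u ≤ B →
               Runs F B (u , v) t′ → Runs (while p F) B t′ t″ → Runs (while p F) B (u , v) t″
  while-true {p} {F} {B} {u} {v} {t′} {t″} e nv b q r = runs (next b lemma)
    where
    lemma : Reach (while p F) B (stepF (while p F) (inj₁ tt) (u , v)) (inj₂ tt , t″)
    lemma rewrite e | nv = Reach-trans
      (embed {k = While.inF p F} (record { inner = inj₂ ; k-in = λ _ → refl ; k-out = λ _ _ → refl }) (reach q)) (reach r)

  while-false : ∀ {p F B u v} → p (read v) ≡ false → Normal v → 2 + length u ≤ B → Runs (while p F) B (u , v) (u , v)
  while-false {p} {F} {B} {u} {v} e nv b = runs (next b lemma)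
    where
    lemma : Reach (while p F) B (stepF (while p F) (inj₁ tt) (u , v)) (inj₂ tt , (u , v))
    lemma rewrite e | nv = stop

-- Shifts a string by one cell, remembering the last symbol read.
carryFrag : Move → Move → Sym → Frag
carryFrag d e x = record { State = Sym ; finite = Sym-finite ; entry = inj₁ x ; δF = trans′ }
  module Carry where
  trans′ : Sym → Sym → (Sym ⊎ ⊤) × Sym × Move
  trans′ x blank = inj₂ tt , x , e
  trans′ x c     = inj₁ c , x , d

isBlank : Sym → Bool
isBlank blank = true
isBlank _     = false

isHash : Sym → Bool
isHash hash = true
isHash _    = false

NonBlank : Sym → Set
NonBlank c = isBlank c ≡ false

∷ₙ-nonblank : ∀ {c} v → NonBlank c → c ∷ₙ v ≡ c ∷ v
∷ₙ-nonblank {o0}   v _ = refl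
∷ₙ-nonblank {o1}   v _ = refl
∷ₙ-nonblank {hash} v _ = refl

read-∷ₙ : ∀ c v → read (c ∷ₙ v) ≡ c
read-∷ₙ blank []      = refl
read-∷ₙ blank (x ∷ v) = refl
read-∷ₙ o0    v       = refl
read-∷ₙ o1    v       = refl
read-∷ₙ hash  v       = refl

rest-∷ₙ : ∀ c v → rest (c ∷ₙ v) ≡ v
rest-∷ₙ blank []      = refl
rest-∷ₙ blank (x ∷ v) = refl
rest-∷ₙ o0    v       = refl
rest-∷ₙ o1    v       = refl
rest-∷ₙ hash  v       = refl

carry-step : ∀ d e {B x c u v y} → NonBlank c → 2 + length u ≤ B →
             Reach (carryFrag d e x) B (inj₁ c , act x d (u , c ∷ v)) y → Reach (carryFrag d e x) B (inj₁ x , (u , c ∷ v)) y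
carry-step d e {c = o0}   _ b p = next b p
carry-step d e {c = o1}   _ b p = next b p
carry-step d e {c = hash} _ b p = next b p

-- The entry state plays no role once a fragment runs.
recarry : ∀ d e {B x x′ y z} → Reach (carryFrag d e x) B y z → Reach (carryFrag d e x′) B y z
recarry d e stop       = stop
recarry d e (next b p) = next b (recarry d e p)

room : ∀ {B} (u v : List Sym) → 3 + length u + length v ≤ B → 2 + length u ≤ B
room u v b = ≤-trans (n≤1+n _) (≤-trans (m≤m+n (3 + length u) (length v)) b)

room-→ : ∀ {B} (u v : List Sym) → 3 + length u + suc (length v) ≤ B → 4 + length u + length v ≤ B
room-→ {B} u v b = subst (_≤ B) (+-suc (3 + length u) (length v)) b

carryFrag-right : ∀ {B x} u v → All NonBlank v → 3 + length u + length v ≤ B →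
              Runs (carryFrag →m →m x) B (u , v) ((x ∷ v) ʳ++ u , [])
carryFrag-right u v nb b = runs (go u v nb b)
  where
  go : ∀ {B x} u v → All NonBlank v → 3 + length u + length v ≤ B →
       Reach (carryFrag →m →m x) B (inj₁ x , (u , v)) (inj₂ tt , ((x ∷ v) ʳ++ u , []))
  go u []      []        b = next (room u [] b) stop
  go {x = x} u (c ∷ v) (n ∷ nb) b = carry-step →m →m n (room u (c ∷ v) b) (recarry →m →m (go (x ∷ u) v nb (room-→ u v b)))

carryFrag-left : ∀ {B x} q u c v → All NonBlank (c ∷ q) → 4 + length q + length u ≤ B →
             Runs (carryFrag ←m stay x) B (q ++ blank ∷ u , c ∷ v) (u , q ʳ++ (c ∷ (x ∷ₙ v)))
carryFrag-left q u c v nb b = runs (go q u c v nb b)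
  where
  go : ∀ {B x} q u c v → All NonBlank (c ∷ q) → 4 + length q + length u ≤ B →
       Reach (carryFrag ←m stay x) B (inj₁ x , (q ++ blank ∷ u , c ∷ v)) (inj₂ tt , (u , q ʳ++ (c ∷ (x ∷ₙ v))))
  go {B} {x} [] u c v (n ∷ _) b = carry-step ←m stay n (≤-trans (n≤1+n _) b)
    (next (≤-trans (m≤n+m _ 2) b) lemma)
    where
    lemma : Reach (carryFrag ←m stay x) B (stepF (carryFrag ←m stay x) c (u , blank ∷ₙ x ∷ₙ v)) (inj₂ tt , (u , c ∷ (x ∷ₙ v)))
    lemma rewrite read-∷ₙ blank (x ∷ₙ v) | rest-∷ₙ blank (x ∷ₙ v) | ∷ₙ-nonblank {c} (x ∷ₙ v) n = stop
  go {B} {x} (y ∷ q) u c v (n ∷ ny ∷ nq) b = carry-step ←m stay n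
    (≤-trans (s≤s (s≤s (s≤s (≤-reflexive (trans (length-++ q) (+-suc (length q) (length u))))))) (≤-trans (n≤1+n _) b)) lemma
    where
    lemma : Reach (carryFrag ←m stay x) B (inj₁ c , (q ++ blank ∷ u , y ∷ₙ x ∷ₙ v)) (inj₂ tt , (u , q ʳ++ (y ∷ c ∷ (x ∷ₙ v))))
    lemma rewrite ∷ₙ-nonblank {y} (x ∷ₙ v) ny | sym (∷ₙ-nonblank {c} (x ∷ₙ v) n) =
      recarry ←m stay (go q u y (x ∷ₙ v) (ny ∷ nq) (≤-trans (n≤1+n _) b))

opaque
  carry : Move → Move → Sym → Frag
  carry = carryFrag

  carry-right : ∀ {B x} u v → All NonBlank v → 3 + length u + length v ≤ B →
                Runs (carry →m →m x) B (u , v) ((x ∷ v) ʳ++ u , [])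
  carry-right = carryFrag-right

  carry-left : ∀ {B x} q u c v → All NonBlank (c ∷ q) → 4 + length q + length u ≤ B →
               Runs (carry ←m stay x) B (q ++ blank ∷ u , c ∷ v) (u , q ʳ++ (c ∷ (x ∷ₙ v)))
  carry-left = carryFrag-left

normal : ∀ {c v} → NonBlank c → Normal (c ∷ v)
normal {c} {v} n = ∷ₙ-nonblank {c} v n

-- A fragment as a Turing machine: stay is simulated by a step to the right and one back.

-- Equality up to trailing blanks: a machine keeps every visited cell, a `Tape` drops the blanks at
-- its right end.
data _≈_ : List Sym → List Sym → Set where
  nil : [] ≈ []
  pad : ∀ {r} → r ≈ [] → (blank ∷ r) ≈ []
  _∷_ : ∀ c {r v} → r ≈ v → (c ∷ r) ≈ (c ∷ v)

≈-∷ₙ : ∀ c {r v} → r ≈ v → (c ∷ r) ≈ (c ∷ₙ v)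
≈-∷ₙ blank {v = []}    p = pad p
≈-∷ₙ blank {v = _ ∷ _} p = blank ∷ p
≈-∷ₙ o0    p = o0 ∷ p
≈-∷ₙ o1    p = o1 ∷ p
≈-∷ₙ hash  p = hash ∷ p

≈-read : ∀ {c r v} → (c ∷ r) ≈ v → c ≡ read v
≈-read (pad p) = refl
≈-read (c ∷ p) = refl

≈-rest : ∀ {c r v} → (c ∷ r) ≈ v → r ≈ rest v
≈-rest (pad p) = p
≈-rest (c ∷ p) = p

≈-blank : ∀ {v} → [] ≈ v → (blank ∷ []) ≈ v
≈-blank nil = pad nil

≈-refl : ∀ v → v ≈ v
≈-refl []      = nil
≈-refl (c ∷ v) = c ∷ ≈-refl v

takeNonBlank-≈ : ∀ l {r v} → r ≈ v → takeNonBlank (l ++ r) ≡ takeNonBlank (l ++ v)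
takeNonBlank-≈ []          nil         = refl
takeNonBlank-≈ []          (pad p)     = refl
takeNonBlank-≈ []          (blank ∷ p) = refl
takeNonBlank-≈ []          (o0 ∷ p)    = cong (o0 ∷_) (takeNonBlank-≈ [] p)
takeNonBlank-≈ []          (o1 ∷ p)    = cong (o1 ∷_) (takeNonBlank-≈ [] p)
takeNonBlank-≈ []          (hash ∷ p)  = cong (hash ∷_) (takeNonBlank-≈ [] p)
takeNonBlank-≈ (blank ∷ l) p           = refl
takeNonBlank-≈ (o0 ∷ l)    p           = cong (o0 ∷_) (takeNonBlank-≈ l p)
takeNonBlank-≈ (o1 ∷ l)    p           = cong (o1 ∷_) (takeNonBlank-≈ l p)
takeNonBlank-≈ (hash ∷ l)  p           = cong (hash ∷_) (takeNonBlank-≈ l p)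

moveR : ∀ M → Fin (TM.nstates M) → List Sym → Sym → List Sym → Config M
moveR M q l s []      = cfg q (s ∷ l) blank []
moveR M q l s (x ∷ r) = cfg q (s ∷ l) x r

moveL : ∀ M → Fin (TM.nstates M) → List Sym → Sym → List Sym → Config M
moveL M q []      s r = cfg q [] s r
moveL M q (x ∷ l) s r = cfg q l x (s ∷ r)

step-R : ∀ M {q l c r q′ s} → q ≢ TM.halt M → TM.δ M q c ≡ (q′ , s , R) → step M (cfg q l c r) ≡ moveR M q′ l s r
step-R M {q} {l} {c} {r} nh e with q ≟ᶠ TM.halt M
... | yes h = contradiction h nh
step-R M {q} {l} {c} {r} nh e | no _ with TM.δ M q c
step-R M {q} {l} {c} {[]} nh refl    | no _ | (q′ , s , R) = refl
step-R M {q} {l} {c} {x ∷ r} nh refl | no _ | (q′ , s , R) = refl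

step-L : ∀ M {q l c r q′ s} → q ≢ TM.halt M → TM.δ M q c ≡ (q′ , s , L) → step M (cfg q l c r) ≡ moveL M q′ l s r
step-L M {q} {l} {c} {r} nh e with q ≟ᶠ TM.halt M
... | yes h = contradiction h nh
step-L M {q} {l} {c} {r} nh e | no _ with TM.δ M q c
step-L M {q} {[]} {c} {r} nh refl    | no _ | (q′ , s , L) = refl
step-L M {q} {x ∷ l} {c} {r} nh refl | no _ | (q′ , s , L) = refl

step-halted : ∀ M {c} → halted M c → step M c ≡ c
step-halted M {cfg q l c r} h with q ≟ᶠ TM.halt M
... | yes _ = refl
... | no nh = contradiction h nh

run-halted : ∀ M t {c} → halted M c → run M t c ≡ c
run-halted M zero    h = refl
run-halted M (suc t) h = trans (cong (run M t) (step-halted M h)) (run-halted M t h)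

record Good (M : TM) (B : ℕ) (o : List Sym) (c : Config M) : Set where
  field
    halts : ∃ λ t → halted M (run M t c) × output M (run M t c) ≡ o
    bound : ∀ t → space M (run M t c) ≤ B

Good-step : ∀ {M B o c c′} → step M c ≡ c′ → space M c ≤ B → Good M B o c′ → Good M B o c
Good-step {M} {B} refl b g = record
  { halts = let (t , h) = Good.halts g in suc t , h
  ; bound = λ { zero → b ; (suc t) → Good.bound g t } }

Good-halted : ∀ {M B o c} → halted M c → output M c ≡ o → space M c ≤ B → Good M B o c
Good-halted {M} {B} h e b = record
  { halts = 0 , h , e
  ; bound = λ t → subst (λ c → space M c ≤ B) (sym (run-halted M t h)) b }

module Machine (F : Frag) where

  -- inj₂ m: one step to the right has been made in place of stay, then m.
  Control : Set
  Control = (State F ⊎ ⊤) ⊎ (State F ⊎ ⊤)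

  control-finite : Finite Control
  control-finite = ⊎-finite (⊎-finite (finite F) ⊤-finite) (⊎-finite (finite F) ⊤-finite)

  code : Control → Fin (size control-finite)
  code = to control-finite

  δC : Control → Sym → Control × Sym × Dir
  δC (inj₁ (inj₁ s)) c with δF F s c
  ... | m , x , ←m   = inj₁ m , x , L
  ... | m , x , →m   = inj₁ m , x , R
  ... | m , x , stay = inj₂ m , x , R
  δC (inj₁ (inj₂ tt)) c = inj₁ (inj₂ tt) , c , R
  δC (inj₂ m) c = inj₁ m , c , L

  machine : TM
  machine = record
    { nstates = size control-finite
    ; start   = code (inj₁ (entry F))
    ; halt    = code (inj₁ (inj₂ tt))
    ; δ       = λ q c → let (m , x , d) = δC (from control-finite q) c in code m , x , d }

  δ-code : ∀ m c → TM.δ machine (code m) c ≡ (let (m′ , x , d) = δC m c in code m′ , x , d)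
  δ-code m c rewrite from∘to control-finite m = refl

  code-injective : ∀ m m′ → code m ≡ code m′ → m ≡ m′
  code-injective m m′ e = trans (sym (from∘to control-finite m)) (trans (cong (from control-finite) e) (from∘to control-finite m′))

  conf : Control → List Sym → List Sym → Config machine
  conf m l []      = cfg (code m) l blank []
  conf m l (c ∷ r) = cfg (code m) l c r

  moveR-conf : ∀ m l s r → moveR machine (code m) l s r ≡ conf m (s ∷ l) r
  moveR-conf m l s []      = refl
  moveR-conf m l s (x ∷ r) = refl

  running : ∀ s → code (inj₁ (inj₁ s)) ≢ code (inj₁ (inj₂ tt))
  running s h = case code-injective (inj₁ (inj₁ s)) (inj₁ (inj₂ tt)) h of λ ()

  returning : ∀ m → code (inj₂ m) ≢ code (inj₁ (inj₂ tt))
  returning m h = case code-injective (inj₂ m) (inj₁ (inj₂ tt)) h of λ ()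

  -- Induction on the run of the fragment. The detour to the right that replaces `stay` visits at
  -- most one new cell, for which the 2 in `Reach` leaves room.
  good : ∀ {B m t u v} → Reach F B (m , t) (inj₂ tt , (u , v)) → ∀ c r → (c ∷ r) ≈ proj₂ t →
         length (proj₁ t) + suc (length r) ≤ B → Good machine B (takeNonBlank (reverse u ++ v)) (cfg (code (inj₁ m)) (proj₁ t) c r)
  good {u = u} stop c r p b = Good-halted refl (takeNonBlank-≈ (reverse u) p) b
  good {B} {inj₁ s} {u , v} (next b′ p) c r q b with δF F s (read v) in eq
  ... | m , x , →m = Good-step (trans (step-R machine (running s) δeq) (moveR-conf (inj₁ m) u x r)) b (lemma r (≈-rest q) b)
    where
    δeq : TM.δ machine (code (inj₁ (inj₁ s))) c ≡ (code (inj₁ m) , x , R)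
    δeq rewrite δ-code (inj₁ (inj₁ s)) c | ≈-read q | eq = refl
    lemma : ∀ r → r ≈ rest v → length u + suc (length r) ≤ B → Good machine B _ (conf (inj₁ m) (x ∷ u) r)
    lemma []      q b = good p blank [] (≈-blank q) (subst (_≤ B) (sym (+-comm (suc (length u)) 1)) b′)
    lemma (y ∷ r) q b = good p y r q (subst (_≤ B) (+-suc (length u) (suc (length r))) b)
  good {B} {inj₁ s} {[] , v} (next b′ p) c r q b | m , x , ←m =
    Good-step (step-L machine (running s) δeq) b (good p x r (≈-∷ₙ x (≈-rest q)) b)
    where
    δeq : TM.δ machine (code (inj₁ (inj₁ s))) c ≡ (code (inj₁ m) , x , L)
    δeq rewrite δ-code (inj₁ (inj₁ s)) c | ≈-read q | eq = refl
  good {B} {inj₁ s} {y ∷ u , v} (next b′ p) c r q b | m , x , ←m =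
    Good-step (step-L machine (running s) δeq) b
      (good p y (x ∷ r) (≈-∷ₙ y (≈-∷ₙ x (≈-rest q))) (subst (_≤ B) (sym (+-suc (length u) (suc (length r)))) b))
    where
    δeq : TM.δ machine (code (inj₁ (inj₁ s))) c ≡ (code (inj₁ m) , x , L)
    δeq rewrite δ-code (inj₁ (inj₁ s)) c | ≈-read q | eq = refl
  good {B} {inj₁ s} {u , v} (next b′ p) c r q b | m , x , stay =
    Good-step (trans (step-R machine (running s) δeq) (moveR-conf (inj₂ m) u x r)) b (lemma r (≈-rest q) b)
    where
    δeq : TM.δ machine (code (inj₁ (inj₁ s))) c ≡ (code (inj₂ m) , x , R)
    δeq rewrite δ-code (inj₁ (inj₁ s)) c | ≈-read q | eq = refl
    back : ∀ y r → step machine (cfg (code (inj₂ m)) (x ∷ u) y r) ≡ cfg (code (inj₁ m)) u x (y ∷ r)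
    back y r = step-L machine (returning m) (δ-code (inj₂ m) y)
    lemma : ∀ r → r ≈ rest v → length u + suc (length r) ≤ B → Good machine B _ (conf (inj₂ m) (x ∷ u) r)
    lemma []      q b = Good-step (back blank []) fits
      (good p x (blank ∷ []) (≈-∷ₙ x (≈-blank q)) (subst (_≤ B) (sym (+-suc (length u) 1)) fits))
      where
      fits : suc (length u) + 1 ≤ B
      fits = subst (_≤ B) (sym (+-comm (suc (length u)) 1)) b′
    lemma (y ∷ r) q b = Good-step (back y r) (subst (_≤ B) (+-suc (length u) (suc (length r))) b)
      (good p x (y ∷ r) (≈-∷ₙ x q) b)

  good-initial : ∀ {B v u′ v′} → 1 ≤ B → length v ≤ B → Runs F B ([] , v) (u′ , v′) →
                 Good machine B (takeNonBlank (reverse u′ ++ v′)) (initial machine v)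
  good-initial {v = []}    b b′ p = good (reach p) blank [] (pad nil) b
  good-initial {v = c ∷ v} b b′ p = good (reach p) c v (≈-refl (c ∷ v)) b′

-- Bijective base 2

-- The digits false and true have values 1 and 2, least significant digit first;
-- unlike in ordinary binary, every string is the numeral of exactly one number.
incS : List Bool → List Bool
incS []          = false ∷ []
incS (false ∷ w) = true ∷ w
incS (true ∷ w)  = false ∷ incS w

str : ℕ → List Bool
str zero    = []
str (suc n) = incS (str n)

bit : Bool → ℕ
bit false = 0
bit true  = 1

val : List Bool → ℕ
val []      = 0
val (b ∷ w) = suc (bit b + 2 * val w)

val-incS : ∀ w → val (incS w) ≡ suc (val w)
val-incS []          = refl
val-incS (false ∷ w) = refl
val-incS (true ∷ w)  rewrite val-incS w = cong suc (lemma (val w))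
  where
  lemma : ∀ x → 2 * suc x ≡ 2 + 2 * x
  lemma = solve-∀

val-str : ∀ n → val (str n) ≡ n
val-str zero    = refl
val-str (suc n) = trans (val-incS (str n)) (cong suc (val-str n))

str-double : ∀ n → str (2 * n) ≡ str (n + n)
str-double n = cong str (cong (n +_) (+-identityʳ n))

str-odd : ∀ n → str (suc (n + n)) ≡ false ∷ str n
str-odd zero    = refl
str-odd (suc n) rewrite +-suc n n | str-odd n = refl

str-val : ∀ w → str (val w) ≡ w
str-val []          = refl
str-val (false ∷ w) = trans (cong incS (str-double (val w))) (trans (str-odd (val w)) (cong (false ∷_) (str-val w)))
str-val (true ∷ w)  = trans (cong (incS ∘ incS) (str-double (val w))) (trans (cong incS (str-odd (val w))) (cong (true ∷_) (str-val w)))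

length-incS : ∀ w → length w ≤ length (incS w)
length-incS []          = z≤n
length-incS (false ∷ w) = ≤-refl
length-incS (true ∷ w)  = s≤s (length-incS w)

∣_∣₂ : ℕ → ℕ
∣ n ∣₂ = length (str n)

∣∣₂-mono : ∀ {m n} → m ≤ n → ∣ m ∣₂ ≤ ∣ n ∣₂
∣∣₂-mono = go ∘ ≤⇒≤′
  where
  go : ∀ {m n} → m ≤′ n → ∣ m ∣₂ ≤ ∣ n ∣₂
  go (≤′-reflexive refl) = ≤-refl
  go {n = suc n} (≤′-step p) = ≤-trans (go p) (length-incS (str n))

2^length : ∀ w → 2 ^ length w ≤ suc (val w)
2^length []      = ≤-refl
2^length (b ∷ w) = ≤-trans (*-monoʳ-≤ 2 (2^length w)) (≤-trans (≤-reflexive (lemma (val w))) (s≤s (s≤s (m≤n+m _ (bit b)))))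
  where
  lemma : ∀ x → 2 * suc x ≡ 2 + 2 * x
  lemma = solve-∀

-- A numeral of length l has value at least 2 ^ l - 1, since its digits are at least 1.
∣∣₂-≤ : ∀ {n b} → n < 2 ^ b → ∣ n ∣₂ ≤ b
∣∣₂-≤ {n} {b} p with ∣ n ∣₂ ≤? b
... | yes q = q
... | no ¬q = contradiction (<-≤-trans (^-monoʳ-< 2 (s≤s (s≤s z≤n)) (≰⇒> ¬q))
                (≤-trans (2^length (str n)) (≤-trans (≤-reflexive (cong suc (val-str n))) p))) (<-irrefl refl)

-- A stack of numbers on the tape

IsBit : Sym → Set
IsBit c = isBlank c ≡ false × isHash c ≡ false

bits-isBit : ∀ w → All IsBit (encBits w)
bits-isBit []          = []
bits-isBit (false ∷ w) = (refl , refl) ∷ bits-isBit w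
bits-isBit (true ∷ w)  = (refl , refl) ∷ bits-isBit w

body : ∀ {m} → Vec ℕ m → List Sym
body []      = []
body (x ∷ σ) = encBits (str x) ++ hash ∷ body σ

body-nonBlank : ∀ {m} (σ : Vec ℕ m) → All NonBlank (body σ)
body-nonBlank []      = []
body-nonBlank (x ∷ σ) = AllP.++⁺ (All.map proj₁ (bits-isBit (str x))) (refl ∷ body-nonBlank σ)

width : ∀ {m} → Vec ℕ m → ℕ
width σ = length (body σ)

width-∷ : ∀ {m} x (σ : Vec ℕ m) → width (x ∷ σ) ≡ suc (∣ x ∣₂ + width σ)
width-∷ x σ = trans (length-++ (encBits (str x))) (trans (cong (_+ suc (width σ)) (length-map encBit (str x))) (+-suc ∣ x ∣₂ (width σ)))

All-ʳ++ : ∀ {A : Set} {P : A → Set} {xs ys} → All P xs → All P ys → All P (xs ʳ++ ys)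
All-ʳ++ []       qs = qs
All-ʳ++ (p ∷ ps) qs = All-ʳ++ ps (p ∷ qs)

All-reverse : ∀ {A : Set} {P : A → Set} {xs} → All P xs → All P (reverse xs)
All-reverse ps = All-ʳ++ ps []

scanR : (Sym → Bool) → Frag
scanR p = while (not ∘ p) (doing id →m)

scanR-runs : ∀ p {B} u w v → All (λ c → isBlank c ≡ false × p c ≡ false) w → p (read v) ≡ true → Normal v →
             3 + length u + length w ≤ B → Runs (scanR p) B (u , w ++ v) (w ʳ++ u , v)
scanR-runs p u []      v []             e nv b = while-false (cong not e) nv (room u [] b)
scanR-runs p u (c ∷ w) v ((nb , nh) ∷ a) e nv b =
  while-true (cong not nh) (normal {c} nb) (room u (c ∷ w) b) (doing-runs (room u (c ∷ w) b))
    (scanR-runs p (c ∷ u) w v a e nv (room-→ u w b))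

back : Frag
back = doing id ←m ⨾ while (not ∘ isHash) (doing id ←m)

back-runs : ∀ {B} r u v → All IsBit r → Normal v → 3 + length r + length u ≤ B →
            Runs back B (r ++ hash ∷ u , v) (u , hash ∷ (r ʳ++ v))
back-runs {B} r u v a nv b = moved r a b ⨾ʳ scanned r v a b
  where
  room′ : ∀ r → 3 + length r + length u ≤ B → 2 + length (r ++ hash ∷ u) ≤ B
  room′ r b = ≤-trans (≤-reflexive (cong (2 +_) (trans (length-++ r) (+-suc (length r) (length u))))) b
  first : List Sym → List Sym × List Sym
  first []      = u , hash ∷ []
  first (x ∷ r) = r ++ hash ∷ u , x ∷ []
  after : List Sym → List Sym → Tape
  after r v = proj₁ (first r) , proj₂ (first r) ++ v
  moved′ : ∀ r v → All IsBit r → Normal v → act (read v) ←m (r ++ hash ∷ u , v) ≡ after r v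
  moved′ []      v []      nv = cong (λ z → u , hash ∷ₙ z) nv
  moved′ (x ∷ r) v (a ∷ _) nv = cong (r ++ hash ∷ u ,_) (trans (cong (x ∷ₙ_) nv) (∷ₙ-nonblank {x} v (proj₁ a)))
  moved : ∀ r → All IsBit r → 3 + length r + length u ≤ B → Runs (doing id ←m) B (r ++ hash ∷ u , v) (after r v)
  moved r a b = subst (Runs (doing id ←m) B (r ++ hash ∷ u , v)) (moved′ r v a nv) (doing-runs (room′ r b))
  scanned : ∀ r v → All IsBit r → 3 + length r + length u ≤ B → Runs (while (not ∘ isHash) (doing id ←m)) B (after r v) (u , hash ∷ (r ʳ++ v))
  scanned []      v []             b = while-false refl refl (≤-trans (n≤1+n _) b)
  scanned (x ∷ r) v ((nb , nh) ∷ a) b = while-true (cong not nh) (normal {x} nb) (room′ r (≤-trans (n≤1+n _) b))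
    (subst (Runs (doing id ←m) B (r ++ hash ∷ u , x ∷ v)) (moved′ r (x ∷ v) a (normal {x} nb)) (doing-runs (room′ r (≤-trans (n≤1+n _) b))))
    (scanned r (x ∷ v) a (≤-trans (n≤1+n _) b))

past : List Sym → ℕ → List Sym
past u x = encBits (str x) ʳ++ (hash ∷ u)

length-past : ∀ u x {m} (σ : Vec ℕ m) → length (past u x) + width σ ≡ length u + width (x ∷ σ)
length-past u x σ rewrite length-ʳ++ (encBits (str x)) {hash ∷ u} | length-++ (encBits (str x)) {hash ∷ body σ} = lemma (length (encBits (str x))) (length u) (width σ)
  where
  lemma : ∀ a b c → a + suc b + c ≡ b + (a + suc c)
  lemma = solve-∀

back-past : ∀ {B m} u x (σ : Vec ℕ m) → 3 + length u + width (x ∷ σ) ≤ B →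
            Runs back B (past u x , hash ∷ body σ) (u , hash ∷ body (x ∷ σ))
back-past {B} u x σ b = subst₂ (λ l r → Runs back B (l , hash ∷ body σ) (u , hash ∷ r)) (sym (ʳ++-defn w)) back-eq
  (back-runs (reverse w) u (hash ∷ body σ) (All-reverse (bits-isBit (str x))) refl fits)
  where
  w = encBits (str x)
  fits : 3 + length (reverse w) + length u ≤ B
  fits rewrite length-reverse w | +-comm (length w) (length u) =
    ≤-trans (+-monoʳ-≤ (3 + length u) (≤-trans (m≤m+n _ _) (≤-reflexive (sym (length-++ w))))) b
  back-eq : reverse w ʳ++ (hash ∷ body σ) ≡ body (x ∷ σ)
  back-eq = trans (ʳ++-defn (reverse w)) (cong (_++ hash ∷ body σ) (reverse-involutive w))

-- Starts just behind the right end of the stack. The number of registers is known when the program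
-- is generated, so the bottom is found by counting separators, without an end marker.
rewind : ℕ → Frag
rewind zero    = doing id ←m
rewind (suc m) = rewind m ⨾ back

rewind-runs : ∀ {B m} (σ : Vec ℕ m) u → 3 + length u + width σ ≤ B →
              Runs (rewind m) B ((hash ∷ body σ) ʳ++ u , []) (u , hash ∷ body σ)
rewind-runs {B} []      u b = doing-runs (subst (λ z → 3 + z ≤ B) (+-identityʳ (length u)) b)
rewind-runs {B} {suc m} (x ∷ σ) u b =
  subst (λ l → Runs (rewind m) B (l , []) (past u x , hash ∷ body σ)) (sym (++-ʳ++ (encBits (str x))))
    (rewind-runs σ (past u x) (≤-trans (≤-reflexive (cong (3 +_) (length-past u x σ))) b))
  ⨾ʳ back-past u x σ b

-- The blank written first tells the leftward `carry`, which starts at the right end, where to stop.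
-- The string to the right of the removed cell thereby moves one cell to the left.
delete : Frag
delete = doing (λ _ → blank) →m ⨾ scanR isBlank ⨾ doing id ←m ⨾ carry ←m stay blank

delete-runs : ∀ {B} u y c s → All NonBlank (c ∷ s) → 5 + length u + length s ≤ B →
              Runs delete B (u , y ∷ c ∷ s) (u , c ∷ s)
delete-runs {B} u y c s nb b = doing-runs (≤-trans (m≤m+n _ _) (≤-trans (+-monoˡ-≤ (length s) (m≤n+m (2 + length u) 3)) b)) ⨾ʳ
  subst₂ (λ w l → Runs (scanR isBlank) B (blank ∷ u , w) (l , [])) (++-identityʳ (c ∷ s)) (ʳ++-defn (c ∷ s))
    (scanR-runs isBlank (blank ∷ u) (c ∷ s) [] (All.map (λ n → n , n) nb) refl refl
      (≤-trans (≤-reflexive (cong (4 +_) (+-suc (length u) (length s)))) b)) ⨾ʳ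
  subst (λ w → Runs (doing id ←m ⨾ carry ←m stay blank) B (reverse (c ∷ s) ++ blank ∷ u , []) (u , w)) (reverse-involutive (c ∷ s))
    (go (reverse (c ∷ s)) (All-reverse nb) (length-reverse (c ∷ s)))
  where
  go : ∀ q → All NonBlank q → length q ≡ suc (length s) → Runs (doing id ←m ⨾ carry ←m stay blank) B (q ++ blank ∷ u , []) (u , reverse q)
  go (x ∷ q) (nx ∷ nq) e = doing-runs
      (≤-trans (≤-reflexive (cong (3 +_) (trans (length-++ q) (trans (+-suc (length q) (length u)) (cong suc (trans (+-comm (length q) (length u)) (cong (length u +_) (suc-injective e)))))))) (≤-trans (n≤1+n _) b))
    ⨾ʳ subst (λ v → Runs (carry ←m stay blank) B (q ++ blank ∷ u , v) (u , q ʳ++ (x ∷ []))) (sym (∷ₙ-nonblank {x} [] nx))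
         (carry-left q u x [] (nx ∷ nq)
           (≤-trans (+-monoʳ-≤ 4 (≤-reflexive (trans (cong (_+ length u) (suc-injective e)) (+-comm (length s) (length u))))) (≤-trans (n≤1+n _) b)))

-- Counting up and down

isO0 isO1 : Sym → Bool
isO0 o0 = true
isO0 _  = false
isO1 o1 = true
isO1 _  = false

-- With the least significant digit first, a carry turns digits 2 into 1 and a borrow turns digits 1
-- into 2, moving right until a digit absorbs it. If none does, the numeral changes its length: a
-- digit 1 is inserted in front of the separator, or the last digit is removed, and the rest of the
-- stack is shifted.
inc₀ dec₀ : ℕ → Frag
inc₀ m = doing id →m ⨾ while isO1 (doing (λ _ → o0) →m) ⨾
         branch isO0 (doing (λ _ → o1) stay) (carry →m →m o0 ⨾ rewind m) ⨾ back
dec₀ m = doing id →m ⨾ while isO0 (doing (λ _ → o1) →m) ⨾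
         branch isO1 (doing (λ _ → o0) stay) (doing id ←m ⨾ delete) ⨾ back

-- The head rests on the separator in front of the top register; `u` holds what lies to its left and
-- is preserved.
At : Frag → ℕ → List Sym → ∀ {m m′} → Vec ℕ m → Vec ℕ m′ → Set
At F B u σ τ = Runs F B (u , hash ∷ body σ) (u , hash ∷ body τ)

module _ {B m : ℕ} (u : List Sym) (σ : Vec ℕ m) where

  fits-right : ∀ (r w : List Sym) → 4 + length r + length u + length (w ++ hash ∷ body σ) ≤ B → 4 + length r + length u ≤ B
  fits-right r w = m+n≤o⇒m≤o (4 + length r + length u)

  fits-pos : ∀ (r w : List Sym) → 4 + length r + length u + length (w ++ hash ∷ body σ) ≤ B → 2 + length (r ++ hash ∷ u) ≤ B
  fits-pos r w b = ≤-trans (≤-reflexive (cong (2 +_) (trans (length-++ r) (+-suc (length r) (length u)))))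
                     (≤-trans (n≤1+n _) (fits-right r w b))

  -- The run is cut at the end of the loop. The digits that the carry has already rewritten are kept
  -- in `r`.
  inc-runs′ : ∀ w r → All IsBit r → 4 + length r + length u + length (encBits w ++ hash ∷ body σ) ≤ B →
    ∃ λ t → Runs (while isO1 (doing (λ _ → o0) →m)) B (r ++ hash ∷ u , encBits w ++ hash ∷ body σ) t ×
            Runs (branch isO0 (doing (λ _ → o1) stay) (carry →m →m o0 ⨾ rewind m) ⨾ back) B t
                 (u , hash ∷ (r ʳ++ (encBits (incS w) ++ hash ∷ body σ)))
  inc-runs′ []          r a b = _ , while-false refl refl p ,
    (branch-false refl refl p
      (carry-right (r ++ hash ∷ u) (hash ∷ body σ) (refl ∷ body-nonBlank σ) fits ⨾ʳ rewind-runs σ (o0 ∷ r ++ hash ∷ u) fits′)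
    ⨾ʳ back-runs (o0 ∷ r) u (hash ∷ body σ) ((refl , refl) ∷ a) refl (fits-right r [] b))
    where
    p = fits-pos r [] b
    fits : 3 + length (r ++ hash ∷ u) + suc (width σ) ≤ B
    fits = ≤-trans (≤-reflexive (cong (λ z → 3 + z + suc (width σ)) (trans (length-++ r) (+-suc (length r) (length u))))) b
    fits′ : 4 + length (r ++ hash ∷ u) + width σ ≤ B
    fits′ = ≤-trans (≤-reflexive (sym (+-suc (3 + length (r ++ hash ∷ u)) (width σ)))) fits
  inc-runs′ (false ∷ w) r a b = _ , while-false refl refl p ,
    (branch-true refl refl p (doing-runs p) ⨾ʳ back-runs r u _ a refl (≤-trans (n≤1+n _) (fits-right r (encBits (false ∷ w)) b)))
    where p = fits-pos r (encBits (false ∷ w)) b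
  inc-runs′ (true ∷ w)  r a b =
    let (t , p , q) = inc-runs′ w (o0 ∷ r) ((refl , refl) ∷ a) (≤-trans (≤-reflexive (sym (+-suc (4 + length r + length u) _))) b)
    in t , while-true refl refl (fits-pos r (encBits (true ∷ w)) b) (doing-runs (fits-pos r (encBits (true ∷ w)) b)) p , q

  dec-runs′ : ∀ w r → All IsBit r → 5 + length r + length u + length (encBits (incS w) ++ hash ∷ body σ) ≤ B →
    ∃ λ t → Runs (while isO0 (doing (λ _ → o1) →m)) B (r ++ hash ∷ u , encBits (incS w) ++ hash ∷ body σ) t ×
            Runs (branch isO1 (doing (λ _ → o0) stay) (doing id ←m ⨾ delete) ⨾ back) B t
                 (u , hash ∷ (r ʳ++ (encBits w ++ hash ∷ body σ)))
  dec-runs′ []          r a b = _ , while-true refl refl p (doing-runs p) (while-false refl refl p′) ,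
    (branch-false refl refl p′ (doing-runs p′ ⨾ʳ delete-runs (r ++ hash ∷ u) o1 hash (body σ) (refl ∷ body-nonBlank σ) fits)
    ⨾ʳ back-runs r u (hash ∷ body σ) a refl (≤-trans (n≤1+n _) (fits-right r [] b″)))
    where
    b′ : 5 + length r + length u + length (hash ∷ body σ) ≤ B
    b′ = ≤-trans (+-monoʳ-≤ (5 + length r + length u) (n≤1+n _)) b
    b″ : 4 + length r + length u + length (hash ∷ body σ) ≤ B
    b″ = ≤-trans (n≤1+n _) b′
    p = fits-pos r [] b″
    p′ : 3 + length (r ++ hash ∷ u) ≤ B
    p′ = fits-pos (o1 ∷ r) [] b′
    fits : 5 + length (r ++ hash ∷ u) + width σ ≤ B
    fits = ≤-trans (≤-reflexive (trans (cong (λ z → 5 + z + width σ) (trans (length-++ r) (+-suc (length r) (length u)))) (sym (+-suc (5 + length r + length u) (width σ))))) b′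
  dec-runs′ (false ∷ w) r a b = _ , while-false refl refl p ,
    (branch-true refl refl p (doing-runs p) ⨾ʳ back-runs r u _ a refl (≤-trans (n≤1+n _) (fits-right r (encBits (false ∷ w)) b′)))
    where
    b′ = ≤-trans (n≤1+n _) b
    p = fits-pos r (encBits (false ∷ w)) b′
  dec-runs′ (true ∷ w)  r a b =
    let (t , p , q) = dec-runs′ w (o1 ∷ r) ((refl , refl) ∷ a) (≤-trans (≤-reflexive (sym (+-suc (5 + length r + length u) _))) b)
        pos = fits-pos r (encBits (false ∷ incS w)) (≤-trans (n≤1+n _) b)
    in t , while-true refl refl pos (doing-runs pos) p , q

  inc₀-runs : ∀ n → 4 + length u + width (n ∷ σ) ≤ B → At (inc₀ m) B u (n ∷ σ) (suc n ∷ σ)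
  inc₀-runs n b = let (t , p , q) = inc-runs′ (str n) [] [] b in
    doing-runs (≤-trans (m≤n+m _ 2) (m+n≤o⇒m≤o (4 + length u) b)) ⨾ʳ p ⨾ʳ q

  dec₀-runs : ∀ n → 5 + length u + width (suc n ∷ σ) ≤ B → At (dec₀ m) B u (suc n ∷ σ) (n ∷ σ)
  dec₀-runs n b = let (t , p , q) = dec-runs′ (str n) [] [] b in
    doing-runs (≤-trans (m≤n+m _ 3) (m+n≤o⇒m≤o (5 + length u) b)) ⨾ʳ p ⨾ʳ q

over : Frag
over = doing id →m ⨾ scanR isHash

over-runs : ∀ {B m} u x (σ : Vec ℕ m) → 4 + length u + width (x ∷ σ) ≤ B →
            Runs over B (u , hash ∷ body (x ∷ σ)) (past u x , hash ∷ body σ)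
over-runs u x σ b = doing-runs (≤-trans (m≤n+m _ 2) (m+n≤o⇒m≤o (4 + length u) b)) ⨾ʳ
  scanR-runs isHash (hash ∷ u) (encBits (str x)) (hash ∷ body σ) (bits-isBit (str x)) refl refl
    (≤-trans (+-monoʳ-≤ (4 + length u) (≤-trans (m≤m+n _ _) (≤-reflexive (sym (length-++ (encBits (str x))))))) b)

-- A register that has been passed over counts as part of `u`, so that register `suc i` becomes
-- register `i` of the remaining stack.
inc dec : ∀ {m} → Fin m → Frag
inc {suc m} zero    = inc₀ m
inc {suc m} (suc i) = over ⨾ inc i ⨾ back
dec {suc m} zero    = dec₀ m
dec {suc m} (suc i) = over ⨾ dec i ⨾ back

width-suc : ∀ {m} (σ : Vec ℕ m) i n → width (σ [ i ]≔ n) ≤ width (σ [ i ]≔ suc n)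
width-suc (x ∷ σ) zero    n rewrite width-∷ n σ | width-∷ (suc n) σ = s≤s (+-monoˡ-≤ (width σ) (∣∣₂-mono (n≤1+n n)))
width-suc (x ∷ σ) (suc i) n rewrite width-∷ x (σ [ i ]≔ n) | width-∷ x (σ [ i ]≔ suc n) = s≤s (+-monoʳ-≤ ∣ x ∣₂ (width-suc σ i n))

inc-runs : ∀ {B m} (i : Fin m) u (σ : Vec ℕ m) n → 4 + length u + width (σ [ i ]≔ suc n) ≤ B →
           At (inc i) B u (σ [ i ]≔ n) (σ [ i ]≔ suc n)
inc-runs zero    u (x ∷ σ) n b = inc₀-runs u σ n (≤-trans (+-monoʳ-≤ (4 + length u) (width-suc (x ∷ σ) zero n)) b)
inc-runs (suc i) u (x ∷ σ) n b =
  over-runs u x (σ [ i ]≔ n) (≤-trans (+-monoʳ-≤ (4 + length u) (width-suc (x ∷ σ) (suc i) n)) b) ⨾ʳ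
  inc-runs i (past u x) σ n (≤-trans (≤-reflexive (cong (4 +_) (length-past u x (σ [ i ]≔ suc n)))) b) ⨾ʳ
  back-past u x (σ [ i ]≔ suc n) (≤-trans (n≤1+n _) b)

dec-runs : ∀ {B m} (i : Fin m) u (σ : Vec ℕ m) n → 5 + length u + width (σ [ i ]≔ suc n) ≤ B →
           At (dec i) B u (σ [ i ]≔ suc n) (σ [ i ]≔ n)
dec-runs zero    u (x ∷ σ) n b = dec₀-runs u σ n b
dec-runs (suc i) u (x ∷ σ) n b =
  over-runs u x (σ [ i ]≔ suc n) (≤-trans (n≤1+n _) b) ⨾ʳ
  dec-runs i (past u x) σ n (≤-trans (≤-reflexive (cong (5 +_) (length-past u x (σ [ i ]≔ suc n)))) b) ⨾ʳ
  back-past u x (σ [ i ]≔ n) (≤-trans (+-monoʳ-≤ (3 + length u) (width-suc (x ∷ σ) (suc i) n)) (≤-trans (m≤n+m _ 2) b))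

goto goback : ∀ {m} → Fin m → Frag
goto {suc m} zero     = doing id →m
goto {suc m} (suc i)  = over ⨾ goto i
goback {suc m} zero    = back
goback {suc m} (suc i) = goback i ⨾ back

record Reachable (B : ℕ) {m : ℕ} (i : Fin m) (u : List Sym) (σ : Vec ℕ m) : Set where
  field
    {l r}  : List Sym
    go     : Runs (goto i) B (u , hash ∷ body σ) (l , encBits (str (lookup σ i)) ++ hash ∷ r)
    come   : Runs (goback i) B (l , encBits (str (lookup σ i)) ++ hash ∷ r) (u , hash ∷ body σ)
    fits   : 2 + length l ≤ B

reachable : ∀ {B m} (i : Fin m) u (σ : Vec ℕ m) → 4 + length u + width σ ≤ B → Reachable B i u σ
reachable {B} zero u (x ∷ σ) b = record
  { go     = doing-runs (≤-trans (m≤n+m _ 2) (m+n≤o⇒m≤o (4 + length u) b))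
  ; come   = back-runs [] u (body (x ∷ σ)) [] (body-normal (str x)) (≤-trans (n≤1+n _) (m+n≤o⇒m≤o (4 + length u) b))
  ; fits   = ≤-trans (n≤1+n _) (m+n≤o⇒m≤o (4 + length u) b) }
  where
  body-normal : ∀ w → Normal (encBits w ++ hash ∷ body σ)
  body-normal []          = refl
  body-normal (false ∷ w) = refl
  body-normal (true ∷ w)  = refl
reachable (suc i) u (x ∷ σ) b = record
  { go     = over-runs u x σ b ⨾ʳ Reachable.go inner
  ; come   = Reachable.come inner ⨾ʳ back-past u x σ (≤-trans (n≤1+n _) b)
  ; fits   = Reachable.fits inner }
  where inner = reachable i (past u x) σ (≤-trans (≤-reflexive (cong (4 +_) (length-past u x σ))) b)

-- Zero is the empty numeral, so the test for it is whether the register begins with its closing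
-- separator.
loop : ∀ {m} → Fin m → Frag → Frag
loop i F = goto i ⨾ while (not ∘ isHash) (goback i ⨾ F ⨾ goto i) ⨾ goback i

Exec : Frag → ℕ → ∀ {m m′} → Vec ℕ m → Vec ℕ m′ → Set
Exec F B = At F B []

-- The family τ is indexed by the number of iterations to come.
loop-exec : ∀ {B m F} (i : Fin m) (τ : ℕ → Vec ℕ m) N → (∀ n → lookup (τ n) i ≡ n) →
            (∀ n → n ≤ N → 4 + width (τ n) ≤ B) → (∀ n → n < N → Exec F B (τ (suc n)) (τ n)) →
            Exec (loop i F) B (τ N) (τ 0)
loop-exec {B} {m} {F} i τ N e b p = Reachable.go (at N ≤-refl) ⨾ʳ iterate N ≤-refl ⨾ʳ Reachable.come (at 0 z≤n)
  where
  at : ∀ n → n ≤ N → Reachable B i [] (τ n)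
  at n n≤N = reachable i [] (τ n) (b n n≤N)
  here : ∀ n → n ≤ N → Tape
  here n n≤N = Reachable.l (at n n≤N) , encBits (str (lookup (τ n) i)) ++ hash ∷ Reachable.r (at n n≤N)
  nonzero : ∀ w r → (not ∘ isHash) (read (encBits (incS w) ++ hash ∷ r)) ≡ true × Normal (encBits (incS w) ++ hash ∷ r)
  nonzero []          r = refl , refl
  nonzero (false ∷ w) r = refl , refl
  nonzero (true ∷ w)  r = refl , refl
  start-zero : ∀ {x} r → x ≡ 0 → (not ∘ isHash) (read (encBits (str x) ++ hash ∷ r)) ≡ false × Normal (encBits (str x) ++ hash ∷ r)
  start-zero r refl = refl , refl
  start-suc : ∀ {x n} r → x ≡ suc n → (not ∘ isHash) (read (encBits (str x) ++ hash ∷ r)) ≡ true × Normal (encBits (str x) ++ hash ∷ r)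
  start-suc {n = n} r refl = nonzero (str n) r
  iterate : ∀ n (n≤N : n ≤ N) → Runs (while (not ∘ isHash) (goback i ⨾ F ⨾ goto i)) B (here n n≤N) (here 0 z≤n)
  iterate zero    z≤n = let (q , nv) = start-zero (Reachable.r (at 0 z≤n)) (e 0) in while-false q nv (Reachable.fits (at 0 z≤n))
  iterate (suc n) n<N = let (q , nv) = start-suc (Reachable.r (at (suc n) n<N)) (e (suc n)) in
    while-true q nv (Reachable.fits (at (suc n) n<N))
      (Reachable.come (at (suc n) n<N) ⨾ʳ p n n<N ⨾ʳ Reachable.go (at n (<⇒≤ n<N)))
      (iterate n (<⇒≤ n<N))

push : ℕ → Frag
push m = carry →m →m hash ⨾ rewind (suc m)

push-exec : ∀ {B m} (σ : Vec ℕ m) → 4 + width σ ≤ B → Exec (push m) B σ (0 ∷ σ)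
push-exec σ b = carry-right [] (hash ∷ body σ) (refl ∷ body-nonBlank σ) b ⨾ʳ rewind-runs (0 ∷ σ) [] b

free-exec : ∀ {B m} (σ : Vec ℕ m) → 5 + width σ ≤ B → Exec delete B (0 ∷ σ) σ
free-exec σ b = delete-runs [] hash hash (body σ) (refl ∷ body-nonBlank σ) b

-- Polynomial bounds

infixl 6 _⊕_
infixl 7 _⊗_
-- With expressions, the bound for a composition is a substitution; coefficient lists are produced
-- only once, for the finished machine.
data PE : Set where
  con     : ℕ → PE
  X       : PE
  _⊕_ _⊗_ : PE → PE → PE

⟦_⟧ : PE → ℕ → ℕ
⟦ con k ⟧ b = k
⟦ X ⟧ b     = b
⟦ p ⊕ q ⟧ b = ⟦ p ⟧ b + ⟦ q ⟧ b
⟦ p ⊗ q ⟧ b = ⟦ p ⟧ b * ⟦ q ⟧ b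

substP : PE → PE → PE
substP (con k) r = con k
substP X       r = r
substP (p ⊕ q) r = substP p r ⊕ substP q r
substP (p ⊗ q) r = substP p r ⊗ substP q r

substP-⟦⟧ : ∀ p r b → ⟦ substP p r ⟧ b ≡ ⟦ p ⟧ (⟦ r ⟧ b)
substP-⟦⟧ (con k) r b = refl
substP-⟦⟧ X       r b = refl
substP-⟦⟧ (p ⊕ q) r b = cong₂ _+_ (substP-⟦⟧ p r b) (substP-⟦⟧ q r b)
substP-⟦⟧ (p ⊗ q) r b = cong₂ _*_ (substP-⟦⟧ p r b) (substP-⟦⟧ q r b)

addPoly : Poly → Poly → Poly
addPoly []       q        = q
addPoly (c ∷ p)  []       = c ∷ p
addPoly (c ∷ p)  (d ∷ q)  = c + d ∷ addPoly p q

addPoly-eval : ∀ p q n → evalPoly (addPoly p q) n ≡ evalPoly p n + evalPoly q n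
addPoly-eval []      q       n = refl
addPoly-eval (c ∷ p) []      n = sym (+-identityʳ _)
addPoly-eval (c ∷ p) (d ∷ q) n rewrite addPoly-eval p q n = lemma c d n (evalPoly p n) (evalPoly q n)
  where
  lemma : ∀ c d n x y → c + d + n * (x + y) ≡ c + n * x + (d + n * y)
  lemma = solve-∀

scalePoly : ℕ → Poly → Poly
scalePoly k = map (k *_)

scalePoly-eval : ∀ k p n → evalPoly (scalePoly k p) n ≡ k * evalPoly p n
scalePoly-eval k []      n = sym (*-zeroʳ k)
scalePoly-eval k (c ∷ p) n rewrite scalePoly-eval k p n = lemma k c n (evalPoly p n)
  where
  lemma : ∀ k c n x → k * c + n * (k * x) ≡ k * (c + n * x)
  lemma = solve-∀

mulPoly : Poly → Poly → Poly
mulPoly []      q = []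
mulPoly (c ∷ p) q = addPoly (scalePoly c q) (0 ∷ mulPoly p q)

mulPoly-eval : ∀ p q n → evalPoly (mulPoly p q) n ≡ evalPoly p n * evalPoly q n
mulPoly-eval []      q n = refl
mulPoly-eval (c ∷ p) q n rewrite addPoly-eval (scalePoly c q) (0 ∷ mulPoly p q) n | scalePoly-eval c q n | mulPoly-eval p q n =
  lemma c n (evalPoly p n) (evalPoly q n)
  where
  lemma : ∀ c n x y → c * y + n * (x * y) ≡ (c + n * x) * y
  lemma = solve-∀

toPoly : PE → Poly
toPoly (con k) = k ∷ []
toPoly X       = 0 ∷ 1 ∷ []
toPoly (p ⊕ q) = addPoly (toPoly p) (toPoly q)
toPoly (p ⊗ q) = mulPoly (toPoly p) (toPoly q)

toPoly-eval : ∀ p n → evalPoly (toPoly p) n ≡ ⟦ p ⟧ n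
toPoly-eval (con k) n rewrite *-zeroʳ n = +-identityʳ k
toPoly-eval X       n rewrite *-zeroʳ n = *-identityʳ n
toPoly-eval (p ⊕ q) n = trans (addPoly-eval (toPoly p) (toPoly q) n) (cong₂ _+_ (toPoly-eval p n) (toPoly-eval q n))
toPoly-eval (p ⊗ q) n = trans (mulPoly-eval (toPoly p) (toPoly q) n) (cong₂ _*_ (toPoly-eval p n) (toPoly-eval q n))

-- Stack programs

width-set : ∀ {m} (σ : Vec ℕ m) i x → width (σ [ i ]≔ x) ≤ ∣ x ∣₂ + width σ
width-set (y ∷ σ) zero    x rewrite width-∷ x σ | width-∷ y σ =
  ≤-trans (≤-reflexive (sym (+-suc ∣ x ∣₂ (width σ)))) (+-monoʳ-≤ ∣ x ∣₂ (s≤s (m≤n+m _ ∣ y ∣₂)))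
width-set (y ∷ σ) (suc i) x rewrite width-∷ y (σ [ i ]≔ x) | width-∷ y σ =
  ≤-trans (s≤s (+-monoʳ-≤ ∣ y ∣₂ (width-set σ i x))) (≤-reflexive (lemma ∣ x ∣₂ ∣ y ∣₂ (width σ)))
  where
  lemma : ∀ a b c → suc (b + (a + c)) ≡ a + suc (b + c)
  lemma = solve-∀

suc-∸ : ∀ {n t} → n < t → suc (t ∸ suc n) ≡ t ∸ n
suc-∸ n<t = sym (+-∸-assoc 1 n<t)

-- B leaves room for the stack σ, four more registers of width at most c, and U more cells.
module Room {B m : ℕ} (U c : ℕ) (σ : Vec ℕ m) (b : U + 4 * suc c + width σ ≤ B) where

  fit : ∀ {a w} k {_ : IsTrue (k ≤ᵇ 4)} → a ≤ U → w ≤ k * suc c + width σ → a + w ≤ B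
  fit k {k≤4} p q = ≤-trans (+-mono-≤ p (≤-trans q (+-monoˡ-≤ (width σ) (*-monoˡ-≤ (suc c) (≤ᵇ⇒≤ k 4 k≤4)))))
    (≤-trans (≤-reflexive (sym (+-assoc U (4 * suc c) (width σ)))) b)

  grow : ∀ {m′} (τ : Vec ℕ m′) k x → ∣ x ∣₂ ≤ c → width τ ≤ k * suc c + width σ → width (x ∷ τ) ≤ suc k * suc c + width σ
  grow τ k x p q rewrite width-∷ x τ = s≤s (≤-trans (+-mono-≤ p q) (≤-reflexive (sym (+-assoc c (k * suc c) (width σ)))))

  set : ∀ i x → ∣ x ∣₂ ≤ c → width (σ [ i ]≔ x) ≤ 1 * suc c + width σ
  set i x p = ≤-trans (width-set σ i x) (+-monoˡ-≤ (width σ) (≤-trans p (≤-trans (n≤1+n c) (≤-reflexive (sym (*-identityˡ (suc c)))))))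

clear-exec : ∀ {B m} (i : Fin m) (σ : Vec ℕ m) → 5 + ∣ lookup σ i ∣₂ + width σ ≤ B → Exec (loop i (dec i)) B σ (σ [ i ]≔ 0)
clear-exec {B} i σ b = subst (λ τ → Exec (loop i (dec i)) B τ (σ [ i ]≔ 0)) (VecP.[]≔-lookup σ i)
  (loop-exec i (λ n → σ [ i ]≔ n) (lookup σ i) (λ n → VecP.lookup∘updateAt i σ) (λ n p → ≤-trans (n≤1+n _) (fits n p)) (λ n p → dec-runs i [] σ n (fits (suc n) p)))
  where
  fits : ∀ n → n ≤ lookup σ i → 5 + width (σ [ i ]≔ n) ≤ B
  fits n p = ≤-trans (+-monoʳ-≤ 5 (≤-trans (width-set σ i n) (+-monoˡ-≤ (width σ) (∣∣₂-mono p)))) b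

assign : ∀ {m} → Fin m → Frag
assign {m} i = loop (suc i) (dec (suc i)) ⨾ loop {suc m} zero (dec {suc m} zero ⨾ inc (suc i)) ⨾ delete

assign-exec : ∀ {B m} (i : Fin m) (σ : Vec ℕ m) t c → ∣ t ∣₂ ≤ c → ∣ lookup σ i ∣₂ ≤ c →
              5 + c + 4 * suc c + width σ ≤ B → Exec (assign i) B (t ∷ σ) (σ [ i ]≔ t)
assign-exec {B} {m} i σ t c tc ic b =
  clear-exec (suc i) (t ∷ σ) (fit 1 (+-monoʳ-≤ 5 ic) (grow σ 0 t tc ≤-refl)) ⨾ʳ
  subst (λ z → Exec (loop {suc m} zero (dec {suc m} zero ⨾ inc (suc i))) B (t ∷ σ [ i ]≔ z) (0 ∷ σ [ i ]≔ t)) (n∸n≡0 t)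
    (loop-exec zero τ t (λ n → refl) (λ n p → ≤-trans (n≤1+n _) (fits n p))
      (λ n p → dec-runs zero [] (suc n ∷ σ [ i ]≔ (t ∸ suc n)) n (fits (suc n) p) ⨾ʳ
               subst (λ z → Exec (inc (suc i)) B (n ∷ σ [ i ]≔ (t ∸ suc n)) (n ∷ σ [ i ]≔ z)) (suc-∸ p)
                 (inc-runs (suc i) [] (n ∷ σ) (t ∸ suc n)
                   (subst (λ z → 4 + width (n ∷ σ [ i ]≔ z) ≤ B) (sym (suc-∸ p)) (≤-trans (n≤1+n _) (fits n (<⇒≤ p))))))) ⨾ʳ
  free-exec (σ [ i ]≔ t) (fit 1 (m≤m+n 5 c) (set i t tc))
  where
  open Room (5 + c) c σ b
  τ : ℕ → Vec ℕ _
  τ n = n ∷ σ [ i ]≔ (t ∸ n)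
  fits : ∀ n → n ≤ t → 5 + width (τ n) ≤ B
  fits n p = fit 2 (m≤m+n 5 c) (grow (σ [ i ]≔ (t ∸ n)) 1 n (≤-trans (∣∣₂-mono p) tc) (set i (t ∸ n) (≤-trans (∣∣₂-mono (m∸n≤m t n)) tc)))

-- A register is read by counting it down, which destroys it. Hence it is counted into two new
-- registers, one of which then restores it.
copy : ∀ {m} → Fin m → Frag
copy {m} i = push m ⨾ push (suc m) ⨾ loop (suc (suc i)) (dec (suc (suc i)) ⨾ inc {2 + m} zero ⨾ inc {2 + m} (suc zero)) ⨾ assign (suc i)

copySpace : ℕ → ℕ
copySpace c = 15 + 10 * c + 4 * suc c

copy-exec : ∀ {B m} (i : Fin m) (σ : Vec ℕ m) c → ∣ lookup σ i ∣₂ ≤ c → copySpace c + width σ ≤ B →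
            Exec (copy i) B σ (lookup σ i ∷ σ)
copy-exec {B} {m} i σ c ic b =
  push-exec σ (fit 0 (m≤m+n 4 _) ≤-refl) ⨾ʳ
  push-exec (0 ∷ σ) (fit 1 (m≤m+n 4 _) (grow σ 0 0 z≤n ≤-refl)) ⨾ʳ
  subst (λ ρ → Exec (loop (suc (suc i)) (dec (suc (suc i)) ⨾ inc {2 + m} zero ⨾ inc {2 + m} (suc zero))) B ρ (x ∷ x ∷ σ [ i ]≔ 0)) start
    (loop-exec (suc (suc i)) τ x (λ n → VecP.lookup∘updateAt i σ) (λ n p → ≤-trans (n≤1+n _) (fits n (x ∸ n) (x ∸ n) p (m∸n≤m x n) (m∸n≤m x n))) body′) ⨾ʳ
  subst (λ ρ → Exec (assign (suc i)) B (x ∷ x ∷ σ [ i ]≔ 0) (x ∷ ρ)) (trans (VecP.[]≔-idempotent σ i) (VecP.[]≔-lookup σ i))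
    (assign-exec (suc i) (x ∷ σ [ i ]≔ 0) x c ic (≤-trans (≤-reflexive (cong ∣_∣₂ (VecP.lookup∘updateAt i σ))) z≤n)
      (fit 2 (≤-trans (m≤m+n _ (6 + 5 * c)) (≤-reflexive (lemma c))) (grow (σ [ i ]≔ 0) 1 x ic (set i 0 z≤n))))
  where
  x = lookup σ i
  open Room (15 + 10 * c) c σ b
  lemma : ∀ c → 5 + c + 4 * suc c + (6 + 5 * c) ≡ 15 + 10 * c
  lemma = solve-∀
  τ : ℕ → Vec ℕ (suc (suc m))
  τ n = (x ∸ n) ∷ (x ∸ n) ∷ σ [ i ]≔ n
  start : τ x ≡ 0 ∷ 0 ∷ σ
  start rewrite n∸n≡0 x = cong (λ ρ → 0 ∷ 0 ∷ ρ) (VecP.[]≔-lookup σ i)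
  fits : ∀ n a d → n ≤ x → a ≤ x → d ≤ x → 5 + width (a ∷ d ∷ σ [ i ]≔ n) ≤ B
  fits n a d p q r = fit 3 (m≤m+n 5 _)
    (grow (d ∷ σ [ i ]≔ n) 2 a (≤-trans (∣∣₂-mono q) ic) (grow (σ [ i ]≔ n) 1 d (≤-trans (∣∣₂-mono r) ic) (set i n (≤-trans (∣∣₂-mono p) ic))))
  body′ : ∀ n → n < x → Exec (dec (suc (suc i)) ⨾ inc {2 + m} zero ⨾ inc {2 + m} (suc zero)) B (τ (suc n)) (τ n)
  body′ n p = subst (λ z → Exec (dec (suc (suc i)) ⨾ inc {2 + m} zero ⨾ inc {2 + m} (suc zero)) B (k ∷ k ∷ σ [ i ]≔ suc n) (z ∷ z ∷ σ [ i ]≔ n)) (suc-∸ p)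
    (dec-runs (suc (suc i)) [] (k ∷ k ∷ σ) n (fits (suc n) k k p (m∸n≤m x (suc n)) (m∸n≤m x (suc n))) ⨾ʳ
     inc-runs zero [] (k ∷ k ∷ σ [ i ]≔ n) k (≤-trans (n≤1+n _) (fits n (suc k) k (<⇒≤ p) sk (m∸n≤m x (suc n)))) ⨾ʳ
     inc-runs (suc zero) [] (suc k ∷ k ∷ σ [ i ]≔ n) k (≤-trans (n≤1+n _) (fits n (suc k) (suc k) (<⇒≤ p) sk sk)))
    where
    k = x ∸ suc n
    sk : suc k ≤ x
    sk = ≤-trans (≤-reflexive (suc-∸ p)) (m∸n≤m x n)

-- Functions computable in polynomial space

pick : ∀ {m n} → Vec ℕ m → Vec (Fin m) n → Vec ℕ n
pick σ = Vec.map (lookup σ)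

pick-suc : ∀ {m n} x (σ : Vec ℕ m) (args : Vec (Fin m) n) → pick (x ∷ σ) (Vec.map suc args) ≡ pick σ args
pick-suc x σ []         = refl
pick-suc x σ (i ∷ args) = cong (lookup σ i ∷_) (pick-suc x σ args)

Small : ∀ {n} → ℕ → Vec ℕ n → Set
Small b v = ∀ i → lookup v i < 2 ^ b

Small-∷ : ∀ {n b x} {v : Vec ℕ n} → x < 2 ^ b → Small b v → Small b (x ∷ v)
Small-∷ p q zero    = p
Small-∷ p q (suc i) = q i

<2^-mono : ∀ {x b c} → b ≤ c → x < 2 ^ b → x < 2 ^ c
<2^-mono b≤c p = <-≤-trans p (^-monoʳ-≤ 2 b≤c)

-- The program pushes f of the registers named by its argument; sp bounds the extra
-- space and out the bit length of the value, in terms of the bit length of the arguments.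
record PS (n : ℕ) (f : Vec ℕ n → ℕ) : Set₁ where
  field
    out sp  : PE
    gen     : ∀ {m} → Vec (Fin m) n → Frag
    bounded : ∀ b v → Small b v → f v < 2 ^ ⟦ out ⟧ b
    exec    : ∀ {B m} (args : Vec (Fin m) n) (σ : Vec ℕ m) v b → pick σ args ≡ v → Small b v →
              ⟦ sp ⟧ b + width σ ≤ B → Exec (gen args) B σ (f v ∷ σ)

open PS

ext : ∀ {n f g} → (∀ v → f v ≡ g v) → PS n f → PS n g
ext e P = record
  { out = out P ; sp = sp P ; gen = gen P
  ; bounded = λ b v s → subst (_< _) (e v) (bounded P b v s)
  ; exec = λ {B} args σ v b q s r → subst (λ y → Exec (gen P args) B σ (y ∷ σ)) (e v) (exec P args σ v b q s r) }

zeroᵖ : ∀ {n} → PS n (λ _ → 0)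
zeroᵖ = record
  { out = con 0 ; sp = con 4 ; gen = λ {m} _ → push m
  ; bounded = λ b v s → s≤s z≤n
  ; exec = λ args σ v b q s r → push-exec σ r }

sucᵖ : ∀ {n f} → PS n f → PS n (λ v → suc (f v))
sucᵖ {n} {f} P = record
  { out = con 1 ⊕ out P ; sp = sp P ⊕ (con 6 ⊕ out P)
  ; gen = λ {m} args → gen P args ⨾ inc {suc m} zero
  ; bounded = bounded′
  ; exec = λ {B} args σ v b q s r →
      exec P args σ v b q s (≤-trans (+-monoˡ-≤ (width σ) (m≤m+n _ _)) r) ⨾ʳ
      inc-runs zero [] (f v ∷ σ) (f v) (≤-trans (+-monoʳ-≤ 4 (wide σ (suc (f v)) _ (∣∣₂-≤ (bounded′ b v s))))
        (≤-trans (+-monoˡ-≤ (width σ) (m≤n+m _ _)) r)) }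
  where
  bounded′ : ∀ b v → Small b v → suc (f v) < 2 ^ (1 + ⟦ out P ⟧ b)
  bounded′ b v s = <-≤-trans (s≤s (bounded P b v s)) (≤-trans (+-monoˡ-≤ _ (m^n>0 2 (⟦ out P ⟧ b))) (≤-reflexive (cong (2 ^ ⟦ out P ⟧ b +_) (sym (+-identityʳ _)))))
  wide : ∀ {m} (σ : Vec ℕ m) x c → ∣ x ∣₂ ≤ c → width (x ∷ σ) ≤ suc c + width σ
  wide σ x c p rewrite width-∷ x σ = s≤s (+-monoˡ-≤ (width σ) p)

varᵖ : ∀ {n} (i : Fin n) → PS n (λ v → lookup v i)
varᵖ {n} i = record
  { out = X ; sp = con 15 ⊕ con 10 ⊗ X ⊕ con 4 ⊗ (con 1 ⊕ X)
  ; gen = λ args → copy (lookup args i)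
  ; bounded = λ b v s → s i
  ; exec = λ {B} args σ v b q s r →
      let e = trans (sym (VecP.lookup-map i (lookup σ) args)) (cong (λ w → lookup w i) q) in
      subst (λ y → Exec (copy (lookup args i)) B σ (y ∷ σ)) e
        (copy-exec (lookup args i) σ b (≤-trans (≤-reflexive (cong ∣_∣₂ e)) (∣∣₂-≤ (s i))) r) }

renᵖ : ∀ {k n f} (τ : Vec (Fin n) k) → PS k f → PS n (λ v → f (pick v τ))
renᵖ {k} {n} {f} τ P = record
  { out = out P ; sp = sp P ; gen = λ args → gen P (Vec.map (lookup args) τ)
  ; bounded = λ b v s → bounded P b (pick v τ) (small b v s)
  ; exec = λ args σ v b q s r → exec P (Vec.map (lookup args) τ) σ (pick v τ) b (pick-ren σ args v q τ) (small b v s) r }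
  where
  small : ∀ b v → Small b v → Small b (pick v τ)
  small b v s i = subst (_< 2 ^ b) (sym (VecP.lookup-map i (lookup v) τ)) (s (lookup τ i))
  pick-ren : ∀ {m j} (σ : Vec ℕ m) (args : Vec (Fin m) n) v → pick σ args ≡ v → (τ : Vec (Fin n) j) → pick σ (Vec.map (lookup args) τ) ≡ pick v τ
  pick-ren σ args v q []      = refl
  pick-ren σ args v q (t ∷ τ) = cong₂ _∷_ (trans (sym (VecP.lookup-map t (lookup σ) args)) (cong (λ w → lookup w t) q)) (pick-ren σ args v q τ)

-- Composition: the value of `g` is pushed as an additional argument of `f`, and `assign` finally
-- overwrites it by the result, so that nothing is left below the latter.
letᵖ : ∀ {n g f} → PS n g → PS (suc n) f → PS n (λ v → f (g v ∷ v))
letᵖ {n} {g} {f} G F = record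
  { out = substP (out F) c ; sp = U ⊕ con 4 ⊗ (con 1 ⊕ w)
  ; gen = λ {m} args → gen G args ⨾ gen F (zero ∷ Vec.map suc args) ⨾ assign {suc m} zero
  ; bounded = λ b v s → subst (λ z → f (g v ∷ v) < 2 ^ z) (sym (substP-⟦⟧ (out F) c b)) (bounded F (⟦ c ⟧ b) (g v ∷ v) (small b v s))
  ; exec = exec′ }
  where
  c w U : PE
  c = X ⊕ out G
  w = substP (out F) c ⊕ out G
  U = sp G ⊕ substP (sp F) c ⊕ (con 5 ⊕ w ⊕ con 4 ⊗ (con 1 ⊕ w))
  small : ∀ b v → Small b v → Small (⟦ c ⟧ b) (g v ∷ v)
  small b v s = Small-∷ {b = ⟦ c ⟧ b} (<2^-mono (m≤n+m (⟦ out G ⟧ b) b) (bounded G b v s)) (λ i → <2^-mono (m≤m+n b (⟦ out G ⟧ b)) (s i))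
  exec′ : ∀ {B m} (args : Vec (Fin m) n) (σ : Vec ℕ m) v b → pick σ args ≡ v → Small b v → ⟦ U ⊕ con 4 ⊗ (con 1 ⊕ w) ⟧ b + width σ ≤ B →
          Exec (gen G args ⨾ gen F (zero ∷ Vec.map suc args) ⨾ assign {suc m} zero) B σ (f (g v ∷ v) ∷ σ)
  exec′ {B} args σ v b q s r =
    exec G args σ v b q s (fit 0 (≤-trans (m≤m+n _ _) (m≤m+n _ _)) ≤-refl) ⨾ʳ
    exec F (zero ∷ Vec.map suc args) (g v ∷ σ) (g v ∷ v) (⟦ c ⟧ b) (cong (g v ∷_) (trans (pick-suc (g v) σ args) q)) (small b v s)
      (fit 1 (≤-trans (≤-trans (≤-reflexive (sym (substP-⟦⟧ (sp F) c b))) (m≤n+m _ (⟦ sp G ⟧ b))) (m≤m+n _ _)) gw) ⨾ʳ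
    assign-exec zero (g v ∷ σ) (f (g v ∷ v)) (⟦ w ⟧ b)
      (≤-trans (∣∣₂-≤ {b = ⟦ substP (out F) c ⟧ b} (subst (λ z → f (g v ∷ v) < 2 ^ z) (sym (substP-⟦⟧ (out F) c b)) (bounded F (⟦ c ⟧ b) (g v ∷ v) (small b v s)))) (m≤m+n _ _)) gc
      (fit 1 (m≤n+m _ (⟦ sp G ⊕ substP (sp F) c ⟧ b)) gw)
    where
    open Room (⟦ U ⟧ b) (⟦ w ⟧ b) σ r
    gc : ∣ g v ∣₂ ≤ ⟦ w ⟧ b
    gc = ≤-trans (∣∣₂-≤ {b = ⟦ out G ⟧ b} (bounded G b v s)) (m≤n+m _ _)
    gw : width (g v ∷ σ) ≤ 1 * suc (⟦ w ⟧ b) + width σ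
    gw = grow σ 0 (g v) gc ≤-refl

primrec : ℕ → (ℕ → ℕ → ℕ) → ℕ → ℕ
primrec z s zero    = z
primrec z s (suc i) = s i (primrec z s i)

module _ {n : ℕ} {z : Vec ℕ n → ℕ} {s : Vec ℕ (2 + n) → ℕ} {e : Vec ℕ n → ℕ} where

  private
    stage : Vec ℕ n → ℕ → ℕ
    stage v = primrec (z v) (λ i a → s (i ∷ a ∷ v))

  -- The stack holds a countdown, the index and the current stage. The bound `p` on all stages is a
  -- premise, because iteration can make numbers too long even if each single step is harmless; the
  -- number of iterations may be exponential.
  recᵖ : PS n z → PS (2 + n) s → PS n e → (p : PE) →
         (∀ b v → Small b v → ∀ i → i ≤ e v → stage v i < 2 ^ ⟦ p ⟧ b) → PS n (λ v → stage v (e v))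
  recᵖ Z S E p bd = record
    { out = p ; sp = U ⊕ con 4 ⊗ (con 1 ⊕ c) ; gen = gen′
    ; bounded = λ b v sm → bd b v sm (e v) ≤-refl
    ; exec = exec′ }
    where
    c U : PE
    c = X ⊕ out E ⊕ p
    U = sp Z ⊕ sp E ⊕ substP (sp S) c ⊕ (con 5 ⊕ c ⊕ con 4 ⊗ (con 1 ⊕ c))
    step′ : ∀ {m} → Vec (Fin m) n → Frag
    step′ {m} args = dec {3 + m} zero ⨾ gen S (1F ∷ 2F ∷ Vec.map suc (Vec.map suc (Vec.map suc args))) ⨾ assign {3 + m} 2F ⨾ inc {3 + m} 1F
    -- `delete` frees a register only if it holds 0. The countdown does so after the loop; the index
    -- has reached `e v` and must be cleared first.
    gen′ : ∀ {m} → Vec (Fin m) n → Frag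
    gen′ {m} args = gen Z args ⨾ push (suc m) ⨾ gen E (Vec.map suc (Vec.map suc args)) ⨾ loop {3 + m} zero (step′ args) ⨾
                    delete ⨾ loop {2 + m} zero (dec {2 + m} zero) ⨾ delete
    exec′ : ∀ {B m} (args : Vec (Fin m) n) (σ : Vec ℕ m) v b → pick σ args ≡ v → Small b v → ⟦ U ⊕ con 4 ⊗ (con 1 ⊕ c) ⟧ b + width σ ≤ B →
            Exec (gen′ args) B σ (stage v (e v) ∷ σ)
    exec′ {B} {m} args σ v b q sm r =
      exec Z args σ v b q sm (fit 0 (≤-trans (m≤m+n _ _) (≤-trans (m≤m+n _ _) (m≤m+n _ _))) ≤-refl) ⨾ʳ
      push-exec (z v ∷ σ) (fit 1 4≤U (grow σ 0 (z v) (stage≤ 0 z≤n) ≤-refl)) ⨾ʳ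
      exec E (Vec.map suc (Vec.map suc args)) (0 ∷ z v ∷ σ) v b (trans (pick-suc _ (z v ∷ σ) (Vec.map suc args)) (trans (pick-suc _ σ args) q)) sm
        (fit 2 (≤-trans (m≤n+m _ (⟦ sp Z ⟧ b)) (≤-trans (m≤m+n _ _) (m≤m+n _ _))) (grow (z v ∷ σ) 1 0 z≤n (grow σ 0 (z v) (stage≤ 0 z≤n) ≤-refl))) ⨾ʳ
      subst (λ y → Exec (loop {3 + m} zero (step′ args)) B (N ∷ y ∷ stage v y ∷ σ) (0 ∷ N ∷ stage v N ∷ σ)) (n∸n≡0 N)
        (loop-exec zero τ N (λ _ → refl) (λ k k≤N → fit 3 4≤U (τ-width k (N ∸ k) k≤N (m∸n≤m N k))) iteration) ⨾ʳ
      free-exec (N ∷ stage v N ∷ σ) (fit 2 5≤U (grow (stage v N ∷ σ) 1 N (idx≤ N ≤-refl) (grow σ 0 (stage v N) (stage≤ N ≤-refl) ≤-refl))) ⨾ʳ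
      clear-exec zero (N ∷ stage v N ∷ σ) (fit 2 (≤-trans (+-monoʳ-≤ 5 (idx≤ N ≤-refl)) 5+c≤U) (grow (stage v N ∷ σ) 1 N (idx≤ N ≤-refl) (grow σ 0 (stage v N) (stage≤ N ≤-refl) ≤-refl))) ⨾ʳ
      free-exec (stage v N ∷ σ) (fit 1 5≤U (grow σ 0 (stage v N) (stage≤ N ≤-refl) ≤-refl))
      where
      open Room (⟦ U ⟧ b) (⟦ c ⟧ b) σ r
      N = e v
      τ : ℕ → Vec ℕ (3 + m)
      τ k = k ∷ (N ∸ k) ∷ stage v (N ∸ k) ∷ σ
      5+c≤U : 5 + ⟦ c ⟧ b ≤ ⟦ U ⟧ b
      5+c≤U = ≤-trans (m≤m+n _ _) (m≤n+m _ (⟦ sp Z ⊕ sp E ⊕ substP (sp S) c ⟧ b))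
      5≤U : 5 ≤ ⟦ U ⟧ b
      5≤U = ≤-trans (m≤m+n 5 _) 5+c≤U
      4≤U : 4 ≤ ⟦ U ⟧ b
      4≤U = ≤-trans (n≤1+n 4) 5≤U
      idx< : ∀ i → i ≤ N → i < 2 ^ ⟦ c ⟧ b
      idx< i i≤N = <2^-mono (≤-trans (m≤n+m _ b) (m≤m+n _ (⟦ p ⟧ b))) (≤-<-trans i≤N (bounded E b v sm))
      idx≤ : ∀ i → i ≤ N → ∣ i ∣₂ ≤ ⟦ c ⟧ b
      idx≤ i i≤N = ∣∣₂-≤ (idx< i i≤N)
      stage< : ∀ i → i ≤ N → stage v i < 2 ^ ⟦ c ⟧ b
      stage< i i≤N = <2^-mono (m≤n+m _ (b + ⟦ out E ⟧ b)) (bd b v sm i i≤N)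
      stage≤ : ∀ i → i ≤ N → ∣ stage v i ∣₂ ≤ ⟦ c ⟧ b
      stage≤ i i≤N = ∣∣₂-≤ (stage< i i≤N)
      τ-width : ∀ k i → k ≤ N → i ≤ N → width (k ∷ i ∷ stage v i ∷ σ) ≤ 3 * suc (⟦ c ⟧ b) + width σ
      τ-width k i k≤N i≤N = grow (i ∷ stage v i ∷ σ) 2 k (idx≤ k k≤N) (grow (stage v i ∷ σ) 1 i (idx≤ i i≤N) (grow σ 0 (stage v i) (stage≤ i i≤N) ≤-refl))
      small : ∀ i → i ≤ N → Small (⟦ c ⟧ b) (i ∷ stage v i ∷ v)
      small i i≤N = Small-∷ {b = ⟦ c ⟧ b} (idx< i i≤N) (Small-∷ {b = ⟦ c ⟧ b} (stage< i i≤N)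
        (λ j → <2^-mono (≤-trans (m≤m+n b (⟦ out E ⟧ b)) (m≤m+n _ (⟦ p ⟧ b))) (sm j)))
      iteration : ∀ k → k < N → Exec (step′ args) B (τ (suc k)) (τ k)
      iteration k k<N = subst (λ y → Exec (step′ args) B (suc k ∷ i ∷ stage v i ∷ σ) (k ∷ y ∷ stage v y ∷ σ)) (suc-∸ k<N)
        (dec-runs zero [] (suc k ∷ i ∷ stage v i ∷ σ) k (fit 3 5≤U (τ-width (suc k) i k<N i≤N)) ⨾ʳ
         exec S _ (k ∷ i ∷ stage v i ∷ σ) (i ∷ stage v i ∷ v) (⟦ c ⟧ b)
           (cong (λ w → i ∷ stage v i ∷ w) (trans (pick-suc _ (i ∷ stage v i ∷ σ) _) (trans (pick-suc _ (stage v i ∷ σ) _) (trans (pick-suc _ σ args) q))))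
           (small i i≤N)
           (fit 3 (≤-trans (≤-trans (≤-reflexive (sym (substP-⟦⟧ (sp S) c b))) (m≤n+m _ (⟦ sp Z ⊕ sp E ⟧ b))) (m≤m+n _ _)) (τ-width k i (<⇒≤ k<N) i≤N)) ⨾ʳ
         assign-exec 2F (k ∷ i ∷ stage v i ∷ σ) (stage v (suc i)) (⟦ c ⟧ b) (stage≤ (suc i) si≤N) (stage≤ i i≤N)
           (fit 3 (m≤n+m _ (⟦ sp Z ⊕ sp E ⊕ substP (sp S) c ⟧ b)) (τ-width k i (<⇒≤ k<N) i≤N)) ⨾ʳ
         inc-runs 1F [] (k ∷ i ∷ stage v (suc i) ∷ σ) i
           (fit 3 4≤U (τ-width k (suc i) (<⇒≤ k<N) si≤N)))
        where
        i = N ∸ suc k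
        i≤N = m∸n≤m N (suc k)
        si≤N : suc i ≤ N
        si≤N = ≤-trans (≤-reflexive (suc-∸ k<N)) (m∸n≤m N k)


-- Machines whose output is a fraction

val-< : ∀ w → 2 + val w ≤ 2 ^ suc (length w)
val-< []      = ≤-refl
val-< (b ∷ w) = ≤-trans (s≤s (s≤s (s≤s (+-monoˡ-≤ (2 * val w) (bit≤1 b))))) (≤-trans (≤-reflexive (lemma (val w))) (*-monoʳ-≤ 2 (val-< w)))
  where
  bit≤1 : ∀ b → bit b ≤ 1
  bit≤1 false = z≤n
  bit≤1 true  = ≤-refl
  lemma : ∀ x → 4 + 2 * x ≡ 2 * (2 + x)
  lemma = solve-∀

takeNonBlank-cut : ∀ w v → All NonBlank w → takeNonBlank (w ++ (blank ∷ₙ v)) ≡ w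
takeNonBlank-cut []         []      _        = refl
takeNonBlank-cut []         (_ ∷ _) _        = refl
takeNonBlank-cut (o0 ∷ w)   v       (_ ∷ nb) = cong (o0 ∷_) (takeNonBlank-cut w v nb)
takeNonBlank-cut (o1 ∷ w)   v       (_ ∷ nb) = cong (o1 ∷_) (takeNonBlank-cut w v nb)
takeNonBlank-cut (hash ∷ w) v       (_ ∷ nb) = cong (hash ∷_) (takeNonBlank-cut w v nb)

module Interface {f g : Vec ℕ 1 → ℕ} (P : PS 1 f) (Q : PS 1 g) where

  -- The input word is already the numeral of `val α`, so loading it means adding a separator on
  -- either side. In the end the separator between the two results is the one that `encℚ` demands,
  -- and a blank in place of the next one hides the input from `takeNonBlank`.
  program : Frag
  program = (carry →m →m hash ⨾ doing (λ _ → hash) →m ⨾ rewind 1) ⨾ gen Q {1} (0F ∷ []) ⨾ gen P {2} (1F ∷ []) ⨾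
            delete ⨾ scanR isHash ⨾ doing id →m ⨾ scanR isHash ⨾ doing (λ _ → blank) stay

  U c total : PE
  U = substP (sp P) (con 1 ⊕ X) ⊕ substP (sp Q) (con 1 ⊕ X) ⊕ con 8
  c = substP (out P) (con 1 ⊕ X) ⊕ substP (out Q) (con 1 ⊕ X)
  total = U ⊕ con 4 ⊗ (con 1 ⊕ c) ⊕ (con 1 ⊕ X)

  module _ (α : List Bool) where

    a x y b B : ℕ
    a = val α
    y = f (a ∷ [])
    x = g (a ∷ [])
    b = suc (length α)
    B = ⟦ total ⟧ (length α)

    width-a : width (a ∷ []) ≡ suc (length α)
    width-a = trans (width-∷ a []) (cong suc (trans (+-identityʳ ∣ a ∣₂) (cong length (str-val α))))

    open Room {B} (⟦ U ⟧ (length α)) (⟦ c ⟧ (length α)) (a ∷ []) (≤-reflexive (cong (⟦ U ⊕ con 4 ⊗ (con 1 ⊕ c) ⟧ (length α) +_) width-a))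

    small : Small b (a ∷ [])
    small zero = ≤-trans (n≤1+n _) (val-< α)

    x≤c : ∣ x ∣₂ ≤ ⟦ c ⟧ (length α)
    x≤c = ≤-trans (∣∣₂-≤ {b = ⟦ out Q ⟧ b} (bounded Q b (a ∷ []) small)) (≤-trans (≤-reflexive (sym (substP-⟦⟧ (out Q) (con 1 ⊕ X) (length α)))) (m≤n+m _ _))

    y≤c : ∣ y ∣₂ ≤ ⟦ c ⟧ (length α)
    y≤c = ≤-trans (∣∣₂-≤ {b = ⟦ out P ⟧ b} (bounded P b (a ∷ []) small)) (≤-trans (≤-reflexive (sym (substP-⟦⟧ (out P) (con 1 ⊕ X) (length α)))) (m≤m+n _ _))

    x-width : width (x ∷ a ∷ []) ≤ 1 * suc (⟦ c ⟧ (length α)) + width (a ∷ [])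
    x-width = grow (a ∷ []) 0 x x≤c ≤-refl

    y-width : width (y ∷ x ∷ a ∷ []) ≤ 2 * suc (⟦ c ⟧ (length α)) + width (a ∷ [])
    y-width = grow (x ∷ a ∷ []) 1 y y≤c x-width

    8≤U : 8 ≤ ⟦ U ⟧ (length α)
    8≤U = m≤n+m 8 _

    8+α≤B : 8 + suc (length α) ≤ B
    8+α≤B = ≤-trans (+-monoʳ-≤ 8 (≤-reflexive (sym width-a))) (fit 0 8≤U ≤-refl)

    w = encBits (str y)
    w′ = encBits (str x)
    end = encBits (str a) ++ hash ∷ []

    8+y≤B : 8 + length (w ++ hash ∷ w′ ++ hash ∷ end) ≤ B
    8+y≤B = fit 2 8≤U y-width

    load : Runs (carry →m →m hash ⨾ doing (λ _ → hash) →m ⨾ rewind 1) B ([] , encBits α) ([] , hash ∷ body (a ∷ []))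
    load = carry-right [] (encBits α) (All.map proj₁ (bits-isBit α)) (≤-trans (≤-reflexive (cong (3 +_) (length-map encBit α))) (≤-trans (m≤n+m _ 6) 8+α≤B)) ⨾ʳ
      doing-runs (≤-trans (≤-reflexive (cong (2 +_) (trans (length-ʳ++ (hash ∷ encBits α)) (trans (+-identityʳ _) (cong suc (length-map encBit α)))))) (≤-trans (m≤n+m _ 6) 8+α≤B)) ⨾ʳ
      subst (λ l → Runs (rewind 1) B (l , []) ([] , hash ∷ body (a ∷ []))) eq
        (rewind-runs (a ∷ []) [] (≤-trans (≤-reflexive (cong (3 +_) width-a)) (≤-trans (m≤n+m _ 5) 8+α≤B)))
      where
      eq : (hash ∷ body (a ∷ [])) ʳ++ [] ≡ hash ∷ ((hash ∷ encBits α) ʳ++ [])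
      eq = trans (++-ʳ++ (hash ∷ encBits (str a))) (cong (λ s → hash ∷ ((hash ∷ encBits s) ʳ++ [])) (str-val α))

    unload : Runs (delete ⨾ scanR isHash ⨾ doing id →m ⨾ scanR isHash ⨾ doing (λ _ → blank) stay) B
               ([] , hash ∷ body (y ∷ x ∷ a ∷ [])) (w′ ʳ++ (hash ∷ (w ʳ++ [])) , blank ∷ₙ end)
    unload = del (w ++ hash ∷ body (x ∷ a ∷ [])) (body-nonBlank (y ∷ x ∷ a ∷ [])) (cons w) (≤-trans (m≤n+m _ 2) 8+y≤B) ⨾ʳ
      scanR-runs isHash [] w (hash ∷ body (x ∷ a ∷ [])) (bits-isBit (str y)) refl refl (≤-trans (≤-trans (+-monoʳ-≤ 3 (m≤m+n (length w) _)) (≤-trans (≤-reflexive (cong (3 +_) (sym (length-++ w)))) (m≤n+m _ 5))) 8+y≤B) ⨾ʳ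
      doing-runs (≤-trans (n≤1+n _) lenw) ⨾ʳ
      scanR-runs isHash (hash ∷ (w ʳ++ [])) w′ (hash ∷ end) (bits-isBit (str x)) refl refl lenw′ ⨾ʳ
      doing-runs (≤-trans (≤-reflexive (cong (2 +_) (trans (length-ʳ++ w′) (+-comm (length w′) _)))) (≤-trans (n≤1+n _) lenw′))
      where
      del : ∀ v → All NonBlank v → ∃₂ (λ c s → v ≡ c ∷ s) → 6 + length v ≤ B → Runs delete B ([] , hash ∷ v) ([] , v)
      del .(c ∷ s) nb (c , s , refl) le = delete-runs [] hash c s nb (≤-trans (m≤n+m _ 2) le)
      cons : ∀ w {v} → ∃₂ λ c s → w ++ hash ∷ v ≡ c ∷ s
      cons []      = _ , _ , refl
      cons (c ∷ w) = _ , _ , refl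
      lenw′ : 3 + length (hash ∷ (w ʳ++ [])) + length w′ ≤ B
      lenw′ = ≤-trans (≤-reflexive (cong (λ z → 4 + z + length w′) (trans (length-ʳ++ w) (+-identityʳ (length w)))))
        (≤-trans (+-mono-≤ (n≤1+n (4 + length w)) (m≤m+n (length w′) (length (hash ∷ end))))
          (≤-trans (≤-reflexive eq) (≤-trans (m≤n+m _ 4) 8+y≤B)))
        where
        eq : 5 + length w + (length w′ + length (hash ∷ end)) ≡ 4 + length (w ++ hash ∷ w′ ++ hash ∷ end)
        eq rewrite length-++ w {hash ∷ w′ ++ hash ∷ end} | length-++ w′ {hash ∷ end} = cong (4 +_) (sym (+-suc (length w) _))
      lenw : 3 + length (w ʳ++ []) ≤ B
      lenw = ≤-trans (n≤1+n _) (m+n≤o⇒m≤o (4 + length (w ʳ++ [])) lenw′)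

    program-runs : Runs program B ([] , encBits α) (w′ ʳ++ (hash ∷ (w ʳ++ [])) , blank ∷ₙ end)
    program-runs = load ⨾ʳ exec Q (0F ∷ []) (a ∷ []) (a ∷ []) b refl small (fit 0 spQ ≤-refl) ⨾ʳ
                   exec P (1F ∷ []) (x ∷ a ∷ []) (a ∷ []) b refl small (fit 1 spP x-width) ⨾ʳ unload
      where
      spQ = ≤-trans (≤-reflexive (sym (substP-⟦⟧ (sp Q) (con 1 ⊕ X) (length α)))) (≤-trans (m≤n+m _ (⟦ substP (sp P) (con 1 ⊕ X) ⟧ (length α))) (m≤m+n _ 8))
      spP = ≤-trans (≤-reflexive (sym (substP-⟦⟧ (sp P) (con 1 ⊕ X) (length α)))) (≤-trans (m≤m+n _ _) (m≤m+n _ 8))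

    output-eq : takeNonBlank (reverse (w′ ʳ++ (hash ∷ (w ʳ++ []))) ++ (blank ∷ₙ end)) ≡ w ++ hash ∷ w′
    output-eq = trans (cong (λ z → takeNonBlank (z ++ (blank ∷ₙ end))) eq)
      (takeNonBlank-cut (w ++ hash ∷ w′) end (AllP.++⁺ (All.map proj₁ (bits-isBit (str y))) (refl ∷ All.map proj₁ (bits-isBit (str x)))))
      where
      eq : reverse (w′ ʳ++ (hash ∷ (w ʳ++ []))) ≡ w ++ hash ∷ w′
      eq = trans (cong reverse (sym (++-ʳ++ w {hash ∷ w′} {[]}))) (reverse-involutive (w ++ hash ∷ w′))

  -- `f` and `g` do not return numerator and denominator but the codes of their binary notations:
  -- what appears on the tape is the bijective numeral of the value.
  computable : (F : List Bool → ℚ) → (∀ α → str (f (val α ∷ [])) ≡ bin ∣ ℚ.numerator (F α) ∣) →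
               (∀ α → str (g (val α ∷ [])) ≡ bin (ℚ.denominatorℕ (F α))) → PSpaceComputable encBits length encℚ F
  computable F num den = Machine.machine program , toPoly total , record
    { halts = λ α → let (t , h , o) = Good.halts (good α) in t , h ,
        trans o (trans (output-eq α) (cong₂ (λ p q → encBits p ++ hash ∷ encBits q) (num α) (den α)))
    ; bound = λ α t → subst (space (Machine.machine program) (run (Machine.machine program) t (initial (Machine.machine program) (encBits α))) ≤_) (sym (toPoly-eval total (length α))) (Good.bound (good α) t) }
    where
    good : ∀ α → Good (Machine.machine program) (B α) _ (initial (Machine.machine program) (encBits α))
    good α = Machine.good-initial program (≤-trans (m≤m+n 1 _) (8+α≤B α))
      (≤-trans (≤-reflexive (length-map encBit α)) (≤-trans (m≤n+m _ 9) (8+α≤B α))) (program-runs α)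

-- Arithmetic

pick-all : ∀ {n} (v : Vec ℕ n) → pick v (Vec.allFin n) ≡ v
pick-all v = VecP.map-lookup-allFin v

weakenᵖ : ∀ {n f} → PS n f → PS (suc n) (λ v → f (Vec.tail v))
weakenᵖ {n} {f} P = ext (λ { (x ∷ v) → cong f (trans (pick-suc x v (Vec.allFin n)) (pick-all v)) }) (renᵖ (Vec.map suc (Vec.allFin n)) P)

PS₁ : (ℕ → ℕ) → Set₁
PS₁ f = PS 1 (λ v → f (lookup v 0F))

PS₂ : (ℕ → ℕ → ℕ) → Set₁
PS₂ f = PS 2 (λ v → f (lookup v 0F) (lookup v 1F))

PS₃ : (ℕ → ℕ → ℕ → ℕ) → Set₁
PS₃ f = PS 3 (λ v → f (lookup v 0F) (lookup v 1F) (lookup v 2F))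

app₁ : ∀ f {n e} → PS₁ f → PS n e → PS n (λ v → f (e v))
app₁ f F E = letᵖ E (renᵖ (0F ∷ []) F)

app₂ : ∀ f {n e e′} → PS₂ f → PS n e → PS n e′ → PS n (λ v → f (e v) (e′ v))
app₂ f F E E′ = letᵖ E (letᵖ (weakenᵖ E′) (renᵖ (1F ∷ 0F ∷ []) F))

app₃ : ∀ f {n e e′ e″} → PS₃ f → PS n e → PS n e′ → PS n e″ → PS n (λ v → f (e v) (e′ v) (e″ v))
app₃ f F E E′ E″ = letᵖ E (letᵖ (weakenᵖ E′) (letᵖ (weakenᵖ (weakenᵖ E″)) (renᵖ (2F ∷ 1F ∷ 0F ∷ []) F)))

constᵖ : ∀ {n} k → PS n (λ _ → k)
constᵖ zero    = zeroᵖ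
constᵖ (suc k) = sucᵖ (constᵖ k)

recᵇ : ∀ {n z s e h} → PS n z → PS (2 + n) s → PS n e → PS n h →
       (∀ v i → i ≤ e v → primrec (z v) (λ i a → s (i ∷ a ∷ v)) i ≤ h v) →
       PS n (λ v → primrec (z v) (λ i a → s (i ∷ a ∷ v)) (e v))
recᵇ Z S E H le = recᵖ Z S E (out H) (λ b v sm i i≤ → ≤-<-trans (le v i i≤) (bounded H b v sm))

2^-double : ∀ b → 2 ^ suc b ≡ 2 ^ b + 2 ^ b
2^-double b = cong (2 ^ b +_) (+-identityʳ (2 ^ b))

pred₁ : PS₁ pred
pred₁ = ext (λ v → lemma (lookup v 0F)) (recᵇ zeroᵖ (varᵖ 0F) (varᵖ 0F) (varᵖ 0F) (λ v i i≤ → ≤-trans (≤-reflexive (lemma i)) (≤-trans pred[n]≤n i≤)))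
  where
  lemma : ∀ x → primrec 0 (λ i a → i) x ≡ pred x
  lemma zero    = refl
  lemma (suc x) = refl

+₂ : PS₂ _+_
+₂ = ext (λ v → lemma (lookup v 0F) (lookup v 1F)) (recᵖ (varᵖ 0F) (sucᵖ (varᵖ 1F)) (varᵖ 1F) (con 1 ⊕ X)
  (λ b v sm i i≤ → subst₂ _<_ (sym (lemma (lookup v 0F) i)) (sym (2^-double b)) (+-mono-< (sm 0F) (≤-<-trans i≤ (sm 1F)))))
  where
  lemma : ∀ x y → primrec x (λ i a → suc a) y ≡ x + y
  lemma x zero    = sym (+-identityʳ x)
  lemma x (suc y) = trans (cong suc (lemma x y)) (sym (+-suc x y))

infixl 6 _+ᵖ_ _∸ᵖ_
infixl 7 _*ᵖ_
_+ᵖ_ : ∀ {n e e′} → PS n e → PS n e′ → PS n (λ v → e v + e′ v)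
_+ᵖ_ = app₂ _+_ +₂

∸₂ : PS₂ _∸_
∸₂ = ext (λ v → lemma (lookup v 0F) (lookup v 1F)) (recᵇ (varᵖ 0F) (app₁ pred pred₁ (varᵖ 1F)) (varᵖ 1F) (varᵖ 0F)
  (λ v i i≤ → ≤-trans (≤-reflexive (lemma (lookup v 0F) i)) (m∸n≤m (lookup v 0F) i)))
  where
  lemma : ∀ x y → primrec x (λ i a → pred a) y ≡ x ∸ y
  lemma x zero    = refl
  lemma x (suc y) = trans (cong pred (lemma x y)) (pred[m∸n]≡m∸[1+n] x y)

_∸ᵖ_ : ∀ {n e e′} → PS n e → PS n e′ → PS n (λ v → e v ∸ e′ v)
_∸ᵖ_ = app₂ _∸_ ∸₂

*₂ : PS₂ _*_
*₂ = ext (λ v → lemma (lookup v 0F) (lookup v 1F)) (recᵖ zeroᵖ (varᵖ 1F +ᵖ varᵖ 2F) (varᵖ 1F) (X ⊕ X)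
  (λ b v sm i i≤ → subst₂ _<_ (sym (lemma (lookup v 0F) i)) (sym (^-distribˡ-+-* 2 b b)) (*-mono-< (sm 0F) (≤-<-trans i≤ (sm 1F)))))
  where
  lemma : ∀ x y → primrec 0 (λ i a → a + x) y ≡ x * y
  lemma x zero    = sym (*-zeroʳ x)
  lemma x (suc y) = trans (cong (_+ x) (lemma x y)) (trans (+-comm (x * y) x) (sym (*-suc x y)))

_*ᵖ_ : ∀ {n e e′} → PS n e → PS n e′ → PS n (λ v → e v * e′ v)
_*ᵖ_ = app₂ _*_ *₂

ifz : ℕ → ℕ → ℕ → ℕ
ifz zero    y z = y
ifz (suc _) y z = z

ifz₃ : PS₃ ifz
ifz₃ = ext (λ v → lemma (lookup v 0F) (lookup v 1F) (lookup v 2F)) (recᵖ (varᵖ 1F) (varᵖ 4F) (varᵖ 0F) X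
  (λ b v sm i i≤ → bd b v sm i))
  where
  lemma : ∀ x y z → primrec y (λ i a → z) x ≡ ifz x y z
  lemma zero    y z = refl
  lemma (suc x) y z = refl
  bd : ∀ b v → Small b v → ∀ i → primrec (lookup v 1F) (λ i a → lookup v 2F) i < 2 ^ b
  bd b v sm zero    = sm 1F
  bd b v sm (suc i) = sm 2F

ifᵖ : ∀ {n e e′} {t : Vec ℕ n → Bool} → PS n (λ v → bit (t v)) → PS n e → PS n e′ → PS n (λ v → if t v then e v else e′ v)
ifᵖ {n} {e} {e′} {t} T E E′ = ext (λ v → lemma (t v) (e v) (e′ v)) (app₃ ifz ifz₃ T E′ E)
  where
  lemma : ∀ t x y → ifz (bit t) y x ≡ (if t then x else y)
  lemma false x y = refl
  lemma true  x y = refl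

_<ᵖ_ : ∀ {n e e′} → PS n e → PS n e′ → PS n (λ v → bit (e v <ᵇ e′ v))
_<ᵖ_ {n} {e} {e′} E E′ = ext (λ v → lemma (e v) (e′ v)) (app₃ ifz ifz₃ (E′ ∸ᵖ E) (constᵖ 0) (constᵖ 1))
  where
  lemma : ∀ x y → ifz (y ∸ x) 0 1 ≡ bit (x <ᵇ y)
  lemma x       zero    rewrite 0∸n≡0 x = refl
  lemma zero    (suc y) = refl
  lemma (suc x) (suc y) = lemma x y

_≡ᵖ_ : ∀ {n e e′} → PS n e → PS n e′ → PS n (λ v → bit (e v ≡ᵇ e′ v))
_≡ᵖ_ {n} {e} {e′} E E′ = ext (λ v → lemma (e v) (e′ v)) (app₃ ifz ifz₃ ((E ∸ᵖ E′) +ᵖ (E′ ∸ᵖ E)) (constᵖ 1) (constᵖ 0))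
  where
  lemma : ∀ x y → ifz ((x ∸ y) + (y ∸ x)) 1 0 ≡ bit (x ≡ᵇ y)
  lemma zero    zero    = refl
  lemma zero    (suc y) = refl
  lemma (suc x) zero    = refl
  lemma (suc x) (suc y) = lemma x y

bit-∧ : ∀ s t → bit (s ∧ t) ≡ bit s * bit t
bit-∧ false t = refl
bit-∧ true  t = sym (+-identityʳ (bit t))

<ᵇ-true : ∀ {x y} → x < y → (x <ᵇ y) ≡ true
<ᵇ-true {zero}  {suc y} _       = refl
<ᵇ-true {suc x} {suc y} (s≤s p) = <ᵇ-true p

<ᵇ-false : ∀ {x y} → y ≤ x → (x <ᵇ y) ≡ false
<ᵇ-false {x}     {zero}  _       = refl
<ᵇ-false {suc x} {suc y} (s≤s p) = <ᵇ-false p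

-- The least i < n with t i, and n if there is none.
find : (ℕ → Bool) → ℕ → ℕ
find t = primrec 0 (λ i a → if a <ᵇ i then a else (if t i then i else suc i))

find-≤ : ∀ t n → find t n ≤ n
find-≤ t zero    = z≤n
find-≤ t (suc n) with find t n <ᵇ n | t n
... | true  | _     = m≤n⇒m≤1+n (find-≤ t n)
... | false | true  = n≤1+n n
... | false | false = ≤-refl

find-least : ∀ t {y n} → t y ≡ true → (∀ i → i < y → t i ≡ false) → y < n → find t n ≡ y
find-least t {y} {n} ty ti y<n = found n y<n
  where
  before : ∀ n → n ≤ y → find t n ≡ n
  before zero    _  = refl
  before (suc n) n< rewrite before n (<⇒≤ n<) | <ᵇ-false {n} ≤-refl | ti n n< = refl
  found : ∀ n → y < n → find t n ≡ y
  found (suc n) (s≤s y≤n) with m≤n⇒m<n∨m≡n y≤n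
  ... | inj₁ y<n rewrite found n y<n | <ᵇ-true y<n = refl
  ... | inj₂ refl rewrite before y ≤-refl | <ᵇ-false {y} ≤-refl | ty = refl

dropSecond : ∀ {n f} → PS (suc n) f → PS (2 + n) (λ v → f (Vec.head v ∷ Vec.tail (Vec.tail v)))
dropSecond {n} {f} P = ext (λ { (i ∷ a ∷ v) → cong (λ w → f (i ∷ w)) (trans (pick-suc i (a ∷ v) (Vec.map suc (Vec.allFin n))) (trans (pick-suc a v (Vec.allFin n)) (pick-all v))) })
  (renᵖ (0F ∷ Vec.map suc (Vec.map suc (Vec.allFin n))) P)

findᵖ : ∀ {n e} {t : Vec ℕ (suc n) → Bool} → PS (suc n) (λ v → bit (t v)) → PS n e → PS n (λ v → find (λ i → t (i ∷ v)) (e v))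
findᵖ {n} {e} {t} T E = recᵇ zeroᵖ (ifᵖ (varᵖ 1F <ᵖ varᵖ 0F) (varᵖ 1F) (ifᵖ (dropSecond T) (varᵖ 0F) (sucᵖ (varᵖ 0F)))) E E
  (λ v i i≤ → ≤-trans (find-≤ (λ i → t (i ∷ v)) i) i≤)

opaque
  quot rem : ℕ → ℕ → ℕ
  quot x y = find (λ q → x <ᵇ suc q * y) (suc x)
  rem x y = x ∸ quot x y * y

  rem-∸ : ∀ x y → x ∸ quot x y * y ≡ rem x y
  rem-∸ x y = refl

  quot₂ : PS₂ quot
  quot₂ = findᵖ (varᵖ 1F <ᵖ (sucᵖ (varᵖ 0F) *ᵖ varᵖ 2F)) (sucᵖ (varᵖ 0F))

  rem₂ : PS₂ rem
  rem₂ = varᵖ 0F ∸ᵖ (app₂ quot quot₂ (varᵖ 0F) (varᵖ 1F) *ᵖ varᵖ 1F)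

  quot-unique : ∀ {x y q} → q * y ≤ x → x < suc q * y → quot x y ≡ q
  quot-unique {x} {zero}  {q} p r = contradiction (<-≤-trans r (≤-reflexive (*-zeroʳ q))) λ ()
  quot-unique {x} {suc y} {q} p r = find-least (λ q → x <ᵇ suc q * suc y) (<ᵇ-true r)
    (λ i i<q → <ᵇ-false (≤-trans (*-monoˡ-≤ (suc y) i<q) p)) (s≤s (≤-trans (m≤m*n q (suc y)) p))

  quot-rem : ∀ d l {y} → d < y → quot (d + l * y) y ≡ l × rem (d + l * y) y ≡ d
  quot-rem d l {y} d<y = e , trans (cong (λ z → d + l * y ∸ z * y) e) (m+n∸n≡m d (l * y))
    where
    e : quot (d + l * y) y ≡ l
    e = quot-unique (m≤n+m (l * y) d) (+-monoˡ-< (l * y) d<y)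

  quot-bounds : ∀ x y → 0 < y → quot x y * y ≤ x × x < suc (quot x y) * y
  quot-bounds x y@(suc _) _ = subst (λ z → z * y ≤ x) (sym e) lo , subst (λ z → x < suc z * y) (sym e) hi
    where
    lo : x / y * y ≤ x
    lo = m/n*n≤m x y
    hi : x < suc (x / y) * y
    hi = <-≤-trans (s≤s (≤-reflexive (m≡m%n+[m/n]*n x y))) (+-monoˡ-≤ (x / y * y) (m%n<n x y))
    e : quot x y ≡ x / y
    e = quot-unique lo hi

quotᵖ : ∀ {n e e′} → PS n e → PS n e′ → PS n (λ v → quot (e v) (e′ v))
quotᵖ = app₂ quot quot₂

remᵖ : ∀ {n e e′} → PS n e → PS n e′ → PS n (λ v → rem (e v) (e′ v))
remᵖ = app₂ rem rem₂

sumTo : (ℕ → ℕ) → ℕ → ℕ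
sumTo t = primrec 0 (λ j a → a + t j)

sumTo-≤ : ∀ t M n → (∀ j → j < n → t j ≤ M) → sumTo t n ≤ n * M
sumTo-≤ t M zero    le = z≤n
sumTo-≤ t M (suc n) le = ≤-trans (+-mono-≤ (sumTo-≤ t M n (λ j j< → le j (m<n⇒m<1+n j<))) (le n ≤-refl)) (≤-reflexive (+-comm (n * M) M))

sumᵖ : ∀ {n e t} → PS (suc n) t → PS n e → PS n (λ v → sumTo (λ j → t (j ∷ v)) (e v))
sumᵖ {n} {e} {t} T E = recᵖ zeroᵖ (varᵖ 1F +ᵖ dropSecond T) E (out E ⊕ substP (out T) (X ⊕ out E)) bd
  where
  bd : ∀ b v → Small b v → ∀ i → i ≤ e v → sumTo (λ j → t (j ∷ v)) i < 2 ^ (⟦ out E ⟧ b + ⟦ substP (out T) (X ⊕ out E) ⟧ b)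
  bd b v sm i i≤ rewrite substP-⟦⟧ (out T) (X ⊕ out E) b = ≤-<-trans (sumTo-≤ (λ j → t (j ∷ v)) M i (λ j j< → <⇒≤ (bounded T (b + ⟦ out E ⟧ b) (j ∷ v) (sm′ j j<))))
    (<-≤-trans (*-monoˡ-< M {{>-nonZero (m^n>0 2 (⟦ out T ⟧ (b + ⟦ out E ⟧ b)))}} (≤-<-trans i≤ (bounded E b v sm))) (≤-reflexive (sym (^-distribˡ-+-* 2 (⟦ out E ⟧ b) (⟦ out T ⟧ (b + ⟦ out E ⟧ b))))))
    where
    M = 2 ^ ⟦ out T ⟧ (b + ⟦ out E ⟧ b)
    sm′ : ∀ j → j < i → Small (b + ⟦ out E ⟧ b) (j ∷ v)
    sm′ j j< = Small-∷ {b = b + ⟦ out E ⟧ b} (<2^-mono (m≤n+m (⟦ out E ⟧ b) b) (<-trans (<-≤-trans j< i≤) (bounded E b v sm))) (λ k → <2^-mono (m≤m+n b (⟦ out E ⟧ b)) (sm k))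

-- Polynomially bounded values, which may be used as exponents.
Tiny : ∀ {n} → (Vec ℕ n → ℕ) → Set
Tiny {n} e = Σ PE λ q → ∀ b v → Small b v → e v ≤ ⟦ q ⟧ b

pow2ᵖ : ∀ {n e} → PS n e → Tiny e → PS n (λ v → 2 ^ e v)
pow2ᵖ {n} {e} E (q , le) = ext (λ v → lemma (e v)) (recᵖ (constᵖ 1) (varᵖ 1F +ᵖ varᵖ 1F) E (con 1 ⊕ q)
  (λ b v sm i i≤ → subst (_< 2 ^ (1 + ⟦ q ⟧ b)) (sym (lemma i)) (^-monoʳ-< 2 (s≤s (s≤s z≤n)) (s≤s (≤-trans i≤ (le b v sm))))))
  where
  lemma : ∀ x → primrec 1 (λ i a → a + a) x ≡ 2 ^ x
  lemma zero    = refl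
  lemma (suc x) = trans (cong (λ z → z + z) (lemma x)) (sym (2^-double x))

polyᵖ : ∀ {n e} p → PS n e → PS n (λ v → evalPoly p (e v))
polyᵖ []      E = zeroᵖ
polyᵖ (c ∷ p) E = constᵖ c +ᵖ (E *ᵖ polyᵖ p E)

evalPoly-mono : ∀ p {m n} → m ≤ n → evalPoly p m ≤ evalPoly p n
evalPoly-mono []      le = z≤n
evalPoly-mono (c ∷ p) le = +-monoʳ-≤ c (*-mono-≤ le (evalPoly-mono p le))

fromPoly : Poly → PE
fromPoly []      = con 0
fromPoly (c ∷ p) = con c ⊕ X ⊗ fromPoly p

fromPoly-⟦⟧ : ∀ p b → ⟦ fromPoly p ⟧ b ≡ evalPoly p b
fromPoly-⟦⟧ []      b = refl
fromPoly-⟦⟧ (c ∷ p) b = cong (λ z → c + b * z) (fromPoly-⟦⟧ p b)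

tiny-poly : ∀ {n e} p → Tiny {n} e → Tiny (λ v → evalPoly p (e v))
tiny-poly p (q , le) = substP (fromPoly p) q , λ b v sm → ≤-trans (evalPoly-mono p (le b v sm))
  (≤-reflexive (trans (sym (fromPoly-⟦⟧ p (⟦ q ⟧ b))) (sym (substP-⟦⟧ (fromPoly p) q b))))

tiny-≤ : ∀ {n e e′} → (∀ v → e v ≤ e′ v) → Tiny {n} e′ → Tiny e
tiny-≤ le (q , le′) = q , λ b v sm → ≤-trans (le v) (le′ b v sm)

opaque
  table : ∀ {k} → (Fin k → ℕ) → ℕ → ℕ
  table {zero}  f x = 0
  table {suc k} f x = ifz x (f zero) (table (f ∘ suc) (pred x))

  table-toℕ : ∀ {k} (f : Fin k → ℕ) i → table f (toℕ i) ≡ f i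
  table-toℕ f zero    = refl
  table-toℕ f (suc i) = table-toℕ (f ∘ suc) i

  tableᵖ : ∀ {n k e} {f : Fin k → Vec ℕ n → ℕ} → (∀ i → PS n (f i)) → PS n e → PS n (λ v → table (λ i → f i v) (e v))
  tableᵖ {k = zero}  F E = zeroᵖ
  tableᵖ {k = suc k} F E = app₃ ifz ifz₃ E (F zero) (tableᵖ (F ∘ suc) (app₁ pred pred₁ E))

-- Pairs and lists of numbers as numbers

opaque
  -- As x ≤ x + y, the value lies between the squares of x + y and x + y + 1, so its integer square
  -- root recovers x + y and the remainder is x.
  pair : ℕ → ℕ → ℕ
  pair x y = (x + y) * (x + y) + x

  root fst snd : ℕ → ℕ
  root z = find (λ s → z <ᵇ suc s * suc s) (suc z)
  fst z = z ∸ root z * root z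
  snd z = root z ∸ fst z

  pair₂ : PS₂ pair
  pair₂ = (varᵖ 0F +ᵖ varᵖ 1F) *ᵖ (varᵖ 0F +ᵖ varᵖ 1F) +ᵖ varᵖ 0F

  root₁ : PS₁ root
  root₁ = findᵖ (varᵖ 1F <ᵖ (sucᵖ (varᵖ 0F) *ᵖ sucᵖ (varᵖ 0F))) (sucᵖ (varᵖ 0F))

  fst₁ : PS₁ fst
  fst₁ = varᵖ 0F ∸ᵖ (app₁ root root₁ (varᵖ 0F) *ᵖ app₁ root root₁ (varᵖ 0F))

  snd₁ : PS₁ snd
  snd₁ = app₁ root root₁ (varᵖ 0F) ∸ᵖ app₁ fst fst₁ (varᵖ 0F)

  +-≤-pair : ∀ x y → x + y ≤ pair x y
  +-≤-pair x y = ≤-trans (square (x + y)) (m≤m+n _ x)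
    where
    square : ∀ s → s ≤ s * s
    square zero    = z≤n
    square (suc s) = m≤m+n (suc s) (s * suc s)

  root-pair : ∀ x y → root (pair x y) ≡ x + y
  root-pair x y = find-least (λ s → pair x y <ᵇ suc s * suc s) {x + y}
    (<ᵇ-true (≤-trans (s≤s (+-monoʳ-≤ ((x + y) * (x + y)) (m≤m+n x y))) (≤-trans (m≤m+n _ (x + y)) (≤-reflexive (lemma (x + y))))))
    (λ i i< → <ᵇ-false (≤-trans (*-mono-≤ i< i<) (m≤m+n _ x)))
    (s≤s (+-≤-pair x y))
    where
    lemma : ∀ s → suc (s * s + s) + s ≡ suc s * suc s
    lemma = solve-∀

  fst-pair : ∀ x y → fst (pair x y) ≡ x
  fst-pair x y rewrite root-pair x y = m+n∸m≡n ((x + y) * (x + y)) x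

  snd-pair : ∀ x y → snd (pair x y) ≡ y
  snd-pair x y rewrite fst-pair x y | root-pair x y = m+n∸m≡n x y

  pair-mono : ∀ {x x′ y y′} → x ≤ x′ → y ≤ y′ → pair x y ≤ pair x′ y′
  pair-mono p q = +-mono-≤ (*-mono-≤ (+-mono-≤ p q) (+-mono-≤ p q)) p

≡ᵇ-refl : ∀ x → (x ≡ᵇ x) ≡ true
≡ᵇ-refl zero    = refl
≡ᵇ-refl (suc x) = ≡ᵇ-refl x

≡ᵇ-false : ∀ {x y} → x ≢ y → (x ≡ᵇ y) ≡ false
≡ᵇ-false {zero}  {zero}  ne = contradiction refl ne
≡ᵇ-false {zero}  {suc y} ne = refl
≡ᵇ-false {suc x} {zero}  ne = refl
≡ᵇ-false {suc x} {suc y} ne = ≡ᵇ-false (ne ∘ cong suc)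

-- Shared by the codes of bit strings and of tape contents. Since removing the first letter makes a
-- code strictly smaller, the length is the least number of removals that lead to 0.
module Chain {A : Set} (code : List A → ℕ) (pop : ℕ → ℕ) (pop₁ : PS₁ pop) (pop-≤ : ∀ x → pop x ≤ x)
             (code-[] : code [] ≡ 0) (code-∷ : ∀ a l → code l < code (a ∷ l)) (pop-∷ : ∀ a l → pop (code (a ∷ l)) ≡ code l) where

  dropN : ℕ → ℕ → ℕ
  dropN i x = primrec x (λ _ → pop) i

  dropN-≤ : ∀ i x → dropN i x ≤ x
  dropN-≤ zero    x = ≤-refl
  dropN-≤ (suc i) x = ≤-trans (pop-≤ (dropN i x)) (dropN-≤ i x)

  dropN₂ : PS₂ dropN
  dropN₂ = recᵇ (varᵖ 1F) (app₁ pop pop₁ (varᵖ 1F)) (varᵖ 0F) (varᵖ 1F) (λ v i _ → dropN-≤ i (lookup v 1F))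

  pop-code : ∀ l → pop (code l) ≡ code (drop 1 l)
  pop-code []      = trans (cong pop code-[]) (trans (n≤0⇒n≡0 (pop-≤ 0)) (sym code-[]))
  pop-code (a ∷ l) = pop-∷ a l

  dropN-code : ∀ i l → dropN i (code l) ≡ code (drop i l)
  dropN-code zero    l = refl
  dropN-code (suc i) l = trans (cong pop (dropN-code i l)) (trans (pop-code (drop i l)) (cong code (trans (drop-drop i 1 l) (cong (λ j → drop j l) (+-comm i 1)))))

  lenN : ℕ → ℕ
  lenN x = find (λ i → dropN i x ≡ᵇ 0) (suc x)

  lenN₁ : PS₁ lenN
  lenN₁ = findᵖ (app₂ dropN dropN₂ (varᵖ 0F) (varᵖ 1F) ≡ᵖ constᵖ 0) (sucᵖ (varᵖ 0F))

  length-≤-code : ∀ l → length l ≤ code l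
  length-≤-code []      = z≤n
  length-≤-code (a ∷ l) = ≤-<-trans (length-≤-code l) (code-∷ a l)

  lenN-code : ∀ l → lenN (code l) ≡ length l
  lenN-code l = find-least (λ i → dropN i (code l) ≡ᵇ 0)
    (trans (cong (_≡ᵇ 0) (trans (dropN-code (length l) l) (trans (cong code (drop-all (length l) l ≤-refl)) code-[]))) refl)
    (λ i i< → ≡ᵇ-false (λ e → <⇒≢ (positive i l i<) (sym (trans (sym (dropN-code i l)) e))))
    (s≤s (length-≤-code l))
    where
    positive : ∀ i l → i < length l → 0 < code (drop i l)
    positive zero    (a ∷ l) _       = ≤-<-trans z≤n (code-∷ a l)
    positive (suc i) (a ∷ l) (s≤s p) = positive i l p

tl hd : ℕ → ℕ
tl x = quot (pred x) 2
hd x = rem (pred x) 2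

tl₁ : PS₁ tl
tl₁ = quotᵖ (app₁ pred pred₁ (varᵖ 0F)) (constᵖ 2)

hd₁ : PS₁ hd
hd₁ = remᵖ (app₁ pred pred₁ (varᵖ 0F)) (constᵖ 2)

bit<2 : ∀ b → bit b < 2
bit<2 false = s≤s z≤n
bit<2 true  = ≤-refl

tl-hd-val : ∀ b w → tl (val (b ∷ w)) ≡ val w × hd (val (b ∷ w)) ≡ bit b
tl-hd-val b w = subst (λ z → quot (bit b + z) 2 ≡ val w × rem (bit b + z) 2 ≡ bit b) (*-comm (val w) 2) (quot-rem (bit b) (val w) (bit<2 b))

quot-≤ : ∀ x y → quot x (suc y) ≤ x
quot-≤ x y = ≤-trans (m≤m*n (quot x (suc y)) (suc y)) (proj₁ (quot-bounds x (suc y) (s≤s z≤n)))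

tl-≤ : ∀ x → tl x ≤ x
tl-≤ x = ≤-trans (quot-≤ (pred x) 1) pred[n]≤n

val-∷ : ∀ b w → val w < val (b ∷ w)
val-∷ b w = s≤s (≤-trans (m≤m+n (val w) _) (m≤n+m _ (bit b)))

module Bits = Chain val tl tl₁ tl-≤ refl val-∷ (λ b w → proj₁ (tl-hd-val b w))

len : ℕ → ℕ
len = Bits.lenN

len₁ : PS₁ len
len₁ = Bits.lenN₁

len-str : ∀ x → len x ≡ length (str x)
len-str x = trans (cong len (sym (val-str x))) (Bits.lenN-code (str x))

len-val : ∀ w → len (val w) ≡ length w
len-val = Bits.lenN-code

lenᵖ : ∀ {n e} → PS n e → PS n (λ v → len (e v))
lenᵖ = app₁ len len₁

tiny-len : ∀ {n e} → PS n e → Tiny {n} (λ v → len (e v))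
tiny-len {n} {e} E = out E , λ b v sm → ≤-trans (≤-reflexive (len-str (e v))) (∣∣₂-≤ (bounded E b v sm))

nth : ℕ → ℕ → ℕ
nth i x = hd (Bits.dropN i x)

nth₂ : PS₂ nth
nth₂ = app₁ hd hd₁ (app₂ Bits.dropN Bits.dropN₂ (varᵖ 0F) (varᵖ 1F))

-- The value 0 beyond the end of the list.
index : {A : Set} → (A → ℕ) → List A → ℕ → ℕ
index f []      i       = 0
index f (c ∷ l) zero    = f c
index f (c ∷ l) (suc i) = index f l i

index-++ˡ : ∀ {A : Set} (f : A → ℕ) u {w i} → i < length u → index f (u ++ w) i ≡ index f u i
index-++ˡ f (c ∷ u) {i = zero}  _       = refl
index-++ˡ f (c ∷ u) {i = suc i} (s≤s p) = index-++ˡ f u p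

index-++ʳ : ∀ {A : Set} (f : A → ℕ) u {w} i → index f (u ++ w) (length u + i) ≡ index f w i
index-++ʳ f []      i = refl
index-++ʳ f (c ∷ u) i = index-++ʳ f u i

at : List Bool → ℕ → ℕ
at = index bit

nth-val : ∀ i w → nth i (val w) ≡ at w i
nth-val i w = trans (cong hd (Bits.dropN-code i w)) (lemma i w)
  where
  lemma : ∀ i w → hd (val (drop i w)) ≡ at w i
  lemma zero    []      = proj₂ (quot-rem 0 0 (s≤s z≤n))
  lemma (suc i) []      = proj₂ (quot-rem 0 0 (s≤s z≤n))
  lemma zero    (b ∷ w) = proj₂ (tl-hd-val b w)
  lemma (suc i) (b ∷ w) = lemma i w

listrec : ∀ {n} → (Vec ℕ n → ℕ) → (Vec ℕ (3 + n) → ℕ) → List Bool → Vec ℕ n → ℕ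
listrec z s []      v = z v
listrec z s (b ∷ w) v = s (bit b ∷ val w ∷ listrec z s w v ∷ v)

-- Recursion on a list becomes recursion on a number: stage i is the value at the suffix of length
-- i, which is obtained by dropping `len x ∸ i` bits from the code.
listrecᵖ : ∀ {n z s} → PS n z → PS (3 + n) s → (p : PE) →
           (∀ b w v → Small b (val w ∷ v) → listrec z s w v < 2 ^ ⟦ p ⟧ b) →
           PS (suc n) (λ v → listrec z s (str (Vec.head v)) (Vec.tail v))
listrecᵖ {n} {z} {s} Z S p bd = ext final
  (recᵖ (weakenᵖ Z) step′ (lenᵖ (varᵖ 0F)) p stages)
  where
  suffix : ℕ → ℕ → ℕ
  suffix x i = Bits.dropN (len x ∸ i) x
  suffix₂ : PS₂ suffix
  suffix₂ = app₂ Bits.dropN Bits.dropN₂ (lenᵖ (varᵖ 0F) ∸ᵖ varᵖ 1F) (varᵖ 0F)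
  s′ : Vec ℕ (3 + n) → ℕ
  s′ (i ∷ a ∷ x ∷ v) = s (hd (suffix x (suc i)) ∷ suffix x i ∷ a ∷ v)
  pick₅ : ∀ a b c d e (v : Vec ℕ n) → pick (a ∷ b ∷ c ∷ d ∷ e ∷ v) (Vec.map suc (Vec.map suc (Vec.map suc (Vec.map suc (Vec.map suc (Vec.allFin n)))))) ≡ v
  pick₅ a b c d e v = trans (pick-suc a _ _) (trans (pick-suc b _ _) (trans (pick-suc c _ _) (trans (pick-suc d _ _) (trans (pick-suc e v _) (pick-all v)))))
  step′ : PS (2 + suc n) s′
  step′ = ext (λ { (i ∷ a ∷ x ∷ v) → cong (λ w → s (hd (suffix x (suc i)) ∷ suffix x i ∷ a ∷ w)) (pick₅ _ _ _ _ _ v) })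
    (letᵖ (app₁ hd hd₁ (app₂ suffix suffix₂ (varᵖ 2F) (sucᵖ (varᵖ 0F))))
      (letᵖ (app₂ suffix suffix₂ (varᵖ 3F) (varᵖ 1F))
        (renᵖ (1F ∷ 0F ∷ 3F ∷ Vec.map suc (Vec.map suc (Vec.map suc (Vec.map suc (Vec.map suc (Vec.allFin n)))))) S)))
  stage : ℕ → Vec ℕ n → ℕ → ℕ
  stage x v = primrec (z v) (λ i a → s′ (i ∷ a ∷ x ∷ v))
  drop-∷ : ∀ {i} (w : List Bool) → i < length w → ∃ λ b → drop (length w ∸ suc i) w ≡ b ∷ drop (length w ∸ i) w
  drop-∷ {i} (b ∷ w) (s≤s i≤) with m≤n⇒m<n∨m≡n i≤
  ... | inj₂ refl rewrite n∸n≡0 (length w) | sym (suc-∸ {length w} {suc (length w)} ≤-refl) | n∸n≡0 (length w) = b , refl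
  ... | inj₁ i< rewrite sym (suc-∸ {i} {suc (length w)} (s≤s (<⇒≤ i<))) | sym (suc-∸ i<) = let (b′ , e) = drop-∷ w i< in b′ , trans e (cong (λ j → b′ ∷ drop j w) (sym (suc-∸ i<)))
  suffix-val : ∀ w i → suffix (val w) i ≡ val (drop (length w ∸ i) w)
  suffix-val w i rewrite len-val w = Bits.dropN-code (length w ∸ i) w
  stage-drop : ∀ w v i → i ≤ length w → stage (val w) v i ≡ listrec z s (drop (length w ∸ i) w) v
  stage-drop w v zero    _  = cong (λ l → listrec z s l v) (sym (drop-all (length w) w ≤-refl))
  stage-drop w v (suc i) i< = let (b , e) = drop-∷ w i< in
    trans (cong₂ (λ h t → s (h ∷ t ∷ stage (val w) v i ∷ v)) (trans (cong hd (trans (suffix-val w (suc i)) (cong val e))) (proj₂ (tl-hd-val b (drop (length w ∸ i) w)))) (suffix-val w i))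
      (trans (cong (λ a → s (bit b ∷ val (drop (length w ∸ i) w) ∷ a ∷ v)) (stage-drop w v i (<⇒≤ i<))) (cong (λ l → listrec z s l v) (sym e)))
  stage-str : ∀ x v i → i ≤ len x → stage x v i ≡ listrec z s (drop (length (str x) ∸ i) (str x)) v
  stage-str x v i i≤ = trans (cong (λ y → stage y v i) (sym (val-str x))) (stage-drop (str x) v i (≤-trans i≤ (≤-reflexive (len-str x))))
  val-drop : ∀ i w → val (drop i w) ≤ val w
  val-drop i w = ≤-trans (≤-reflexive (sym (Bits.dropN-code i w))) (Bits.dropN-≤ i (val w))
  stages : ∀ b u → Small b u → ∀ i → i ≤ len (lookup u 0F) →
           primrec (z (Vec.tail u)) (λ i a → s′ (i ∷ a ∷ u)) i < 2 ^ ⟦ p ⟧ b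
  stages b (x ∷ v) sm i i≤ = subst (_< 2 ^ ⟦ p ⟧ b) (sym (stage-str x v i i≤)) (bd b _ v
    (Small-∷ {b = b} (≤-<-trans (val-drop (length (str x) ∸ i) (str x)) (≤-<-trans (≤-reflexive (val-str x)) (sm zero))) (sm ∘ suc)))
  final : ∀ u → primrec (z (Vec.tail u)) (λ i a → s′ (i ∷ a ∷ u)) (len (lookup u 0F)) ≡ listrec z s (str (Vec.head u)) (Vec.tail u)
  final (x ∷ v) = trans (stage-str x v (len x) ≤-refl) (cong (λ j → listrec z s (drop j (str x)) v) (trans (cong (length (str x) ∸_) (len-str x)) (n∸n≡0 (length (str x)))))

-- Simulation of Turing machines


-- The digit 0 is not used, so that the end of a list can be recognised.
code₅ : List Sym → ℕ
code₅ []      = 0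
code₅ (c ∷ l) = toℕ (digit c) + code₅ l * 5

pop top : ℕ → ℕ
pop x = quot x 5
top x = rem x 5

pop₁ : PS₁ pop
pop₁ = quotᵖ (varᵖ 0F) (constᵖ 5)

top₁ : PS₁ top
top₁ = remᵖ (varᵖ 0F) (constᵖ 5)

pop-∷ : ∀ c l → pop (code₅ (c ∷ l)) ≡ code₅ l
pop-∷ c l = proj₁ (quot-rem (toℕ (digit c)) (code₅ l) (toℕ<n (digit c)))

top-∷ : ∀ c l → top (code₅ (c ∷ l)) ≡ toℕ (digit c)
top-∷ c l = proj₂ (quot-rem (toℕ (digit c)) (code₅ l) (toℕ<n (digit c)))

digit>0 : ∀ c → 0 < toℕ (digit c)
digit>0 blank = s≤s z≤n
digit>0 o0    = s≤s z≤n
digit>0 o1    = s≤s z≤n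
digit>0 hash  = s≤s z≤n

code₅-∷ : ∀ c l → code₅ l < code₅ (c ∷ l)
code₅-∷ c l = +-mono-≤ (digit>0 c) (m≤m*n (code₅ l) 5)

module Syms = Chain code₅ pop pop₁ (λ x → quot-≤ x 4) refl code₅-∷ pop-∷

code₅-< : ∀ l → code₅ l < 2 ^ (3 * length l)
code₅-< []      = s≤s z≤n
code₅-< (c ∷ l) = begin-strict
  toℕ (digit c) + code₅ l * 5 <⟨ +-monoˡ-< (code₅ l * 5) (toℕ<n (digit c)) ⟩
  suc (code₅ l) * 5 ≤⟨ *-mono-≤ (code₅-< l) (m≤m+n 5 3) ⟩
  2 ^ (3 * length l) * 2 ^ 3 ≡⟨ ^-distribˡ-+-* 2 (3 * length l) 3 ⟨
  2 ^ (3 * length l + 3) ≡⟨ cong (2 ^_) (lemma (length l)) ⟩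
  2 ^ (3 * suc (length l)) ∎
  where
  open ≤-Reasoning
  lemma : ∀ n → 3 * n + 3 ≡ 3 * suc n
  lemma = solve-∀

dir : Dir → ℕ
dir L = 0
dir R = 1

-- By the pigeonhole principle, an orbit bounded by H that becomes constant is constant from step suc H on.
module _ (f : ℕ → ℕ) where

  iter : ℕ → ℕ → ℕ
  iter t z = primrec z (λ _ → f) t

  iter-+ : ∀ s t z → iter (s + t) z ≡ iter s (iter t z)
  iter-+ zero    t z = refl
  iter-+ (suc s) t z = cong f (iter-+ s t z)

  iter-fixed : ∀ t {z} → f z ≡ z → iter t z ≡ z
  iter-fixed zero    e = refl
  iter-fixed (suc t) e = trans (cong f (iter-fixed t e)) e

  iter-period : ∀ k d {z} → iter d z ≡ z → iter (k * d) z ≡ z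
  iter-period zero    d e = refl
  iter-period (suc k) d {z} e = trans (iter-+ d (k * d) z) (trans (cong (iter d) (iter-period k d e)) e)

  stabilises : ∀ z H → (∀ t → iter t z ≤ H) → ∀ t → f (iter t z) ≡ iter t z → iter (suc H) z ≡ iter t z
  stabilises z H le t fixed with pigeonhole {suc H} {suc (suc H)} ≤-refl (λ i → fromℕ< (s≤s (le (toℕ i))))
  ... | i , j , i<j , e = trans (trans (from-i (suc H) (≤-pred (toℕ<n i))) same) (sym (after (suc t * d + a) (≤-trans (≤-trans (n≤1+n t) (m≤m*n (suc t) d {{>-nonZero d>0}})) (m≤m+n _ a))))
    where
    a = toℕ i
    d = toℕ j ∸ a
    d>0 : 0 < d
    d>0 = m<n⇒0<n∸m i<j
    after : ∀ s → t ≤ s → iter t z ≡ iter s z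
    after s t≤s = sym (trans (cong (λ r → iter r z) (sym (m∸n+n≡m t≤s))) (trans (iter-+ (s ∸ t) t z) (iter-fixed (s ∸ t) fixed)))
    period : iter d (iter a z) ≡ iter a z
    period = trans (sym (iter-+ d a z)) (trans (cong (λ r → iter r z) (m∸n+n≡m (<⇒≤ i<j))) (sym (fromℕ<-injective _ _ (s≤s (le (toℕ i))) (s≤s (le (toℕ j))) e)))
    -- The pigeonhole principle gives a cycle of length d through `iter a z`. After `suc t` rounds
    -- the orbit is past t, where it is constant; so the cycle is that single fixed point.
    same : iter a z ≡ iter (suc t * d + a) z
    same = sym (trans (iter-+ (suc t * d) a z) (iter-period (suc t) d period))
    fixed-a : f (iter a z) ≡ iter a z
    fixed-a = trans (cong f (trans same (sym tt′))) (trans fixed (trans tt′ (sym same)))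
      where tt′ = after (suc t * d + a) (≤-trans (≤-trans (n≤1+n t) (m≤m*n (suc t) d {{>-nonZero d>0}})) (m≤m+n _ a))
    from-i : ∀ s → a ≤ s → iter s z ≡ iter a z
    from-i s a≤s = trans (cong (λ r → iter r z) (sym (m∸n+n≡m a≤s))) (trans (iter-+ (s ∸ a) a z) (iter-fixed (s ∸ a) fixed-a))

module Simulate (M : TM) where
  open TM M

  codeC : Config M → ℕ
  codeC (cfg q l c r) = pair (toℕ q) (pair (code₅ l) (code₅ (c ∷ r)))

  state′ symbol′ move′ : ℕ → ℕ → ℕ
  state′ q d  = table (λ i → table (λ j → toℕ (proj₁ (δ i (symbol j)))) d) q
  symbol′ q d = table (λ i → table (λ j → toℕ (digit (proj₁ (proj₂ (δ i (symbol j)))))) d) q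
  move′ q d   = table (λ i → table (λ j → dir (proj₂ (proj₂ (δ i (symbol j))))) d) q

  table₂ : ∀ (h : Fin nstates → Fin 5 → ℕ) → PS₂ (λ q d → table (λ i → table (h i) d) q)
  table₂ h = tableᵖ (λ i → tableᵖ (λ j → constᵖ (h i j)) (varᵖ 1F)) (varᵖ 0F)

  table₂-at : ∀ (h : Fin nstates → Fin 5 → ℕ) q c → table (λ i → table (h i) (toℕ (digit c))) (toℕ q) ≡ h q (digit c)
  table₂-at h q c = trans (table-toℕ (λ i → table (h i) (toℕ (digit c))) q) (table-toℕ (h q) (digit c))

  -- The 1 is the code of a single blank, the cell that appears when the head leaves the visited
  -- part on the right. The case `l ≡ᵇ 0` is a move left at the left end, where the head stays.
  right left : ℕ → ℕ → ℕ → ℕ → ℕ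
  right q s l w = pair q (pair (s + l * 5) (if pop w ≡ᵇ 0 then 1 else pop w))
  left q s l w = pair q (if l ≡ᵇ 0 then pair 0 (s + pop w * 5) else pair (pop l) (top l + (s + pop w * 5) * 5))

  stepC : ℕ → ℕ → ℕ → ℕ
  stepC q l w = if q ≡ᵇ toℕ halt then pair q (pair l w) else
    (if move′ q (top w) ≡ᵇ 1 then right (state′ q (top w)) (symbol′ q (top w)) l w else left (state′ q (top w)) (symbol′ q (top w)) l w)

  stepN : ℕ → ℕ
  stepN z = stepC (fst z) (fst (snd z)) (snd (snd z))

  right₄ : PS 4 (λ v → right (lookup v 0F) (lookup v 1F) (lookup v 2F) (lookup v 3F))
  right₄ = app₂ pair pair₂ (varᵖ 0F) (app₂ pair pair₂ (varᵖ 1F +ᵖ varᵖ 2F *ᵖ constᵖ 5)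
    (ifᵖ (app₁ pop pop₁ (varᵖ 3F) ≡ᵖ constᵖ 0) (constᵖ 1) (app₁ pop pop₁ (varᵖ 3F))))

  left₄ : PS 4 (λ v → left (lookup v 0F) (lookup v 1F) (lookup v 2F) (lookup v 3F))
  left₄ = app₂ pair pair₂ (varᵖ 0F) (ifᵖ (varᵖ 2F ≡ᵖ constᵖ 0)
    (app₂ pair pair₂ (constᵖ 0) (varᵖ 1F +ᵖ app₁ pop pop₁ (varᵖ 3F) *ᵖ constᵖ 5))
    (app₂ pair pair₂ (app₁ pop pop₁ (varᵖ 2F)) (app₁ top top₁ (varᵖ 2F) +ᵖ (varᵖ 1F +ᵖ app₁ pop pop₁ (varᵖ 3F) *ᵖ constᵖ 5) *ᵖ constᵖ 5)))

  stepC₃ : PS₃ stepC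
  stepC₃ = ifᵖ (varᵖ 0F ≡ᵖ constᵖ (toℕ halt)) (app₂ pair pair₂ (varᵖ 0F) (app₂ pair pair₂ (varᵖ 1F) (varᵖ 2F)))
    (ifᵖ (app₂ move′ (table₂ _) (varᵖ 0F) d ≡ᵖ constᵖ 1)
      (letᵖ S (letᵖ (weakenᵖ Q) (renᵖ (0F ∷ 1F ∷ 3F ∷ 4F ∷ []) right₄)))
      (letᵖ S (letᵖ (weakenᵖ Q) (renᵖ (0F ∷ 1F ∷ 3F ∷ 4F ∷ []) left₄))))
    where
    d : PS 3 (λ v → top (lookup v 2F))
    d = app₁ top top₁ (varᵖ 2F)
    S : PS 3 (λ v → symbol′ (lookup v 0F) (top (lookup v 2F)))
    S = app₂ symbol′ (table₂ _) (varᵖ 0F) d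
    Q : PS 3 (λ v → state′ (lookup v 0F) (top (lookup v 2F)))
    Q = app₂ state′ (table₂ _) (varᵖ 0F) d

  stepN₁ : PS₁ stepN
  stepN₁ = app₃ stepC stepC₃ (app₁ fst fst₁ (varᵖ 0F)) (app₁ fst fst₁ (app₁ snd snd₁ (varᵖ 0F))) (app₁ snd snd₁ (app₁ snd snd₁ (varᵖ 0F)))

  stepC-code : ∀ q l c r → stepC (toℕ q) (code₅ l) (code₅ (c ∷ r)) ≡ codeC (step M (cfg q l c r))
  stepC-code q l c r with q ≟ᶠ halt
  ... | yes refl rewrite ≡ᵇ-refl (toℕ halt) = refl
  ... | no nh rewrite ≡ᵇ-false (nh ∘ toℕ-injective) | top-∷ c r
        | table₂-at (λ i j → dir (proj₂ (proj₂ (δ i (symbol j))))) q c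
        | table₂-at (λ i j → toℕ (proj₁ (δ i (symbol j)))) q c
        | table₂-at (λ i j → toℕ (digit (proj₁ (proj₂ (δ i (symbol j)))))) q c
        | symbol-digit c | pop-∷ c r with δ q c
  stepC-code q l c []       | no _ | (q′ , s , R) = refl
  stepC-code q l c (x ∷ r)  | no _ | (q′ , s , R) rewrite ≡ᵇ-false (λ e → <⇒≢ (≤-<-trans z≤n (code₅-∷ x r)) (sym e)) = refl
  stepC-code q [] c r       | no _ | (q′ , s , L) = refl
  stepC-code q (x ∷ l) c r  | no _ | (q′ , s , L) rewrite ≡ᵇ-false (λ e → <⇒≢ (≤-<-trans z≤n (code₅-∷ x l)) (sym e)) | top-∷ x l | pop-∷ x l = refl

  stepN-code : ∀ C → stepN (codeC C) ≡ codeC (step M C)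
  stepN-code (cfg q l c r) rewrite fst-pair (toℕ q) (pair (code₅ l) (code₅ (c ∷ r))) | snd-pair (toℕ q) (pair (code₅ l) (code₅ (c ∷ r)))
    | fst-pair (code₅ l) (code₅ (c ∷ r)) | snd-pair (code₅ l) (code₅ (c ∷ r)) = stepC-code q l c r

  run-step : ∀ t C → run M t (step M C) ≡ step M (run M t C)
  run-step zero    C = refl
  run-step (suc t) C = run-step t (step M C)

  iter-code : ∀ t C → iter stepN t (codeC C) ≡ codeC (run M t C)
  iter-code zero    C = refl
  iter-code (suc t) C = trans (cong stepN (iter-code t C)) (trans (stepN-code (run M t C)) (cong codeC (sym (run-step t C))))

  -- A digit in base 5 takes at most three bits.
  codeC-≤ : ∀ {S} C → space M C ≤ S → codeC C ≤ pair nstates (pair (2 ^ (3 * S)) (2 ^ (3 * S)))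
  codeC-≤ {S} (cfg q l c r) b = pair-mono (<⇒≤ (toℕ<n q)) (pair-mono (fits l (≤-trans (m≤m+n _ _) b)) (fits (c ∷ r) (≤-trans (m≤n+m _ (length l)) b)))
    where
    fits : ∀ l → length l ≤ S → code₅ l ≤ 2 ^ (3 * S)
    fits l b = ≤-trans (<⇒≤ (code₅-< l)) (^-monoʳ-≤ 2 (*-monoʳ-≤ 3 b))

-- Reading the output of a simulated machine

at₅ : List Sym → ℕ → ℕ
at₅ = index (toℕ ∘ digit)

at₅-reverse : ∀ l {i} → i < length l → at₅ (reverse l) i ≡ at₅ l (length l ∸ suc i)
at₅-reverse (c ∷ l) {i} (s≤s p) rewrite unfold-reverse c l with m≤n⇒m<n∨m≡n p
... | inj₁ i<l = trans (index-++ˡ (toℕ ∘ digit) (reverse l) (subst (i <_) (sym (length-reverse l)) i<l))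
                   (trans (at₅-reverse l i<l) (cong (at₅ (c ∷ l)) (suc-∸ i<l)))
... | inj₂ refl = trans (trans (cong (at₅ (reverse l ++ c ∷ [])) (sym (trans (+-identityʳ _) (length-reverse l)))) (index-++ʳ (toℕ ∘ digit) (reverse l) 0))
                    (cong (at₅ (c ∷ l)) (sym (n∸n≡0 (length l))))

top-drop : ∀ i l → top (Syms.dropN i (code₅ l)) ≡ at₅ l i
top-drop i l = trans (cong top (Syms.dropN-code i l)) (lemma i l)
  where
  lemma : ∀ i l → top (code₅ (drop i l)) ≡ at₅ l i
  lemma zero    []      = proj₂ (quot-rem 0 0 (s≤s z≤n))
  lemma (suc i) []      = proj₂ (quot-rem 0 0 (s≤s z≤n))
  lemma zero    (c ∷ l) = top-∷ c l
  lemma (suc i) (c ∷ l) = lemma i l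

takeNonBlank-at : ∀ t → (∀ i → i < length (takeNonBlank t) → at₅ t i ≡ at₅ (takeNonBlank t) i × 2 ≤ at₅ t i) × at₅ t (length (takeNonBlank t)) < 2
takeNonBlank-at []          = (λ i ()) , s≤s z≤n
takeNonBlank-at (blank ∷ t) = (λ i ()) , ≤-refl
takeNonBlank-at (o0 ∷ t)    = let (p , q) = takeNonBlank-at t in (λ { zero _ → refl , ≤-refl ; (suc i) (s≤s r) → p i r }) , q
takeNonBlank-at (o1 ∷ t)    = let (p , q) = takeNonBlank-at t in (λ { zero _ → refl , n≤1+n 2 ; (suc i) (s≤s r) → p i r }) , q
takeNonBlank-at (hash ∷ t)  = let (p , q) = takeNonBlank-at t in (λ { zero _ → refl , m≤m+n 2 2 ; (suc i) (s≤s r) → p i r }) , q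

takeNonBlank-length : ∀ t → length (takeNonBlank t) ≤ length t
takeNonBlank-length []          = z≤n
takeNonBlank-length (blank ∷ t) = z≤n
takeNonBlank-length (o0 ∷ t)    = s≤s (takeNonBlank-length t)
takeNonBlank-length (o1 ∷ t)    = s≤s (takeNonBlank-length t)
takeNonBlank-length (hash ∷ t)  = s≤s (takeNonBlank-length t)

opaque
  cell : ℕ → ℕ → ℕ
  cell i z = if i <ᵇ Syms.lenN (fst (snd z)) then top (Syms.dropN (Syms.lenN (fst (snd z)) ∸ suc i) (fst (snd z)))
             else top (Syms.dropN (i ∸ Syms.lenN (fst (snd z))) (snd (snd z)))

  cell₂ : PS₂ cell
  cell₂ = ifᵖ (varᵖ 0F <ᵖ n) (app₁ top top₁ (app₂ Syms.dropN Syms.dropN₂ (n ∸ᵖ sucᵖ (varᵖ 0F)) l))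
              (app₁ top top₁ (app₂ Syms.dropN Syms.dropN₂ (varᵖ 0F ∸ᵖ n) (app₁ snd snd₁ (app₁ snd snd₁ (varᵖ 1F)))))
    where
    l : PS 2 (λ v → fst (snd (lookup v 1F)))
    l = app₁ fst fst₁ (app₁ snd snd₁ (varᵖ 1F))
    n : PS 2 (λ v → Syms.lenN (fst (snd (lookup v 1F))))
    n = app₁ Syms.lenN Syms.lenN₁ l

  -- Below 2 are only the digit of `blank` and the value 0 beyond the tape, so the first such cell
  -- ends the output; 4 is the digit of `hash`. The code of a configuration exceeds or equals the
  -- length of its output, whence the search bound.
  endN hashN : ℕ → ℕ
  endN z  = find (λ i → cell i z <ᵇ 2) (suc z)
  hashN z = find (λ i → cell i z ≡ᵇ 4) (suc z)

  endN₁ : PS₁ endN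
  endN₁ = findᵖ (app₂ cell cell₂ (varᵖ 0F) (varᵖ 1F) <ᵖ constᵖ 2) (sucᵖ (varᵖ 0F))

  hashN₁ : PS₁ hashN
  hashN₁ = findᵖ (app₂ cell cell₂ (varᵖ 0F) (varᵖ 1F) ≡ᵖ constᵖ 4) (sucᵖ (varᵖ 0F))

  cell-code : ∀ M C i → cell i (Simulate.codeC M C) ≡ at₅ (tape M C) i
  cell-code M (cfg q l c r) i rewrite snd-pair (toℕ q) (pair (code₅ l) (code₅ (c ∷ r))) | fst-pair (code₅ l) (code₅ (c ∷ r))
    | snd-pair (code₅ l) (code₅ (c ∷ r)) | Syms.lenN-code l with i <? length l
  ... | yes i<l rewrite <ᵇ-true i<l = trans (top-drop (length l ∸ suc i) l)
          (trans (sym (at₅-reverse l i<l)) (sym (index-++ˡ (toℕ ∘ digit) (reverse l) (subst (i <_) (sym (length-reverse l)) i<l))))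
  ... | no ¬p rewrite <ᵇ-false (≮⇒≥ ¬p) = trans (top-drop (i ∸ length l) (c ∷ r))
          (trans (sym (index-++ʳ (toℕ ∘ digit) (reverse l) (i ∸ length l))) (cong (at₅ (reverse l ++ c ∷ r)) (trans (cong (_+ (i ∸ length l)) (length-reverse l)) (m+[n∸m]≡n (≮⇒≥ ¬p)))))

  output<code : ∀ M C → length (output M C) < suc (Simulate.codeC M C)
  output<code M (cfg q l c r) = s≤s (begin
    length (takeNonBlank (reverse l ++ c ∷ r)) ≤⟨ takeNonBlank-length (reverse l ++ c ∷ r) ⟩
    length (reverse l ++ c ∷ r) ≡⟨ trans (length-++ (reverse l)) (cong (_+ suc (length r)) (length-reverse l)) ⟩
    length l + length (c ∷ r) ≤⟨ +-mono-≤ (Syms.length-≤-code l) (Syms.length-≤-code (c ∷ r)) ⟩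
    code₅ l + code₅ (c ∷ r) ≤⟨ +-≤-pair (code₅ l) (code₅ (c ∷ r)) ⟩
    pair (code₅ l) (code₅ (c ∷ r)) ≤⟨ m≤n+m _ (toℕ q) ⟩
    toℕ q + pair (code₅ l) (code₅ (c ∷ r)) ≤⟨ +-≤-pair (toℕ q) _ ⟩
    pair (toℕ q) (pair (code₅ l) (code₅ (c ∷ r))) ∎)
    where open ≤-Reasoning

  endN-code : ∀ M C → endN (Simulate.codeC M C) ≡ length (output M C)
  endN-code M C = find-least (λ i → cell i (Simulate.codeC M C) <ᵇ 2)
    (trans (cong (_<ᵇ 2) (cell-code M C _)) (<ᵇ-true (proj₂ (takeNonBlank-at (tape M C)))))
    (λ i i< → trans (cong (_<ᵇ 2) (cell-code M C i)) (<ᵇ-false (proj₂ (proj₁ (takeNonBlank-at (tape M C)) i i<))))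
    (output<code M C)

  hashN-code : ∀ M C w w′ → output M C ≡ encBits w ++ hash ∷ w′ → hashN (Simulate.codeC M C) ≡ length w
  hashN-code M C w w′ e = find-least (λ i → cell i (Simulate.codeC M C) ≡ᵇ 4)
    (cong (_≡ᵇ 4) (trans (cell-out (length w) w<) (at-hash w)))
    (λ i i<w → trans (cong (_≡ᵇ 4) (cell-out i (<-trans i<w w<))) (at-bit w i i<w))
    (<-trans w< (output<code M C))
    where
    w< : length w < length (output M C)
    w< rewrite e | length-++ (encBits w) {hash ∷ w′} | length-map encBit w = ≤-trans (s≤s (m≤m+n (length w) (length w′))) (≤-reflexive (sym (+-suc (length w) (length w′))))
    cell-out : ∀ i → i < length (output M C) → cell i (Simulate.codeC M C) ≡ at₅ (encBits w ++ hash ∷ w′) i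
    cell-out i i< = trans (cell-code M C i) (trans (proj₁ (proj₁ (takeNonBlank-at (tape M C)) i i<)) (cong (λ o → at₅ o i) e))
    at-hash : ∀ w → at₅ (encBits w ++ hash ∷ w′) (length w) ≡ 4
    at-hash []      = refl
    at-hash (b ∷ w) = at-hash w
    at-bit : ∀ w i → i < length w → (at₅ (encBits w ++ hash ∷ w′) i ≡ᵇ 4) ≡ false
    at-bit (false ∷ w) zero    _       = refl
    at-bit (true ∷ w)  zero    _       = refl
    at-bit (b ∷ w)     (suc i) (s≤s p) = at-bit w i p

module Result {Y : Set} {encY : Y → List Sym} {f : List Bool → Y} {M : TM} {p : Poly} (pc : PSpaceComputes encBits length encY f M p) where
  open Simulate M
  open PSpaceComputes pc

  -- The string in its usual order; its code lists the most recent bit first.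
  word : ℕ → List Bool
  word a = reverse (str a)

  length-word : ∀ a → length (word a) ≡ len a
  length-word a = trans (length-reverse (str a)) (sym (len-str a))

  -- Pushing the digits one by one reverses them, as `word` requires; 2 is the digit of `o0`. An
  -- empty input still has one scanned blank, with code 1. `limit` bounds the code of every
  -- configuration within the space bound and thereby also the useful number of steps.
  inputN startN limit final : ℕ → ℕ
  inputN a = primrec 0 (λ i acc → 2 + nth i a + acc * 5) (len a)
  startN a = pair (toℕ (TM.start M)) (pair 0 (ifz (inputN a) 1 (inputN a)))
  limit a = pair (TM.nstates M) (pair (2 ^ evalPoly (scalePoly 3 p) (len a)) (2 ^ evalPoly (scalePoly 3 p) (len a)))
  final a = iter stepN (suc (limit a)) (startN a)

  input-stage : ∀ w i → i ≤ length w → primrec 0 (λ i acc → 2 + nth i (val w) + acc * 5) i ≡ code₅ (encBits (take i w ʳ++ []))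
  input-stage w zero    _  = refl
  input-stage w (suc i) i< = trans (cong₂ (λ b acc → 2 + b + acc * 5) (nth-val i w) (input-stage w i (<⇒≤ i<))) (lemma w i i< [])
    where
    lemma : ∀ w i → i < length w → ∀ r → 2 + at w i + code₅ (encBits (take i w ʳ++ r)) * 5 ≡ code₅ (encBits (take (suc i) w ʳ++ r))
    lemma (false ∷ w) zero    _       r = refl
    lemma (true ∷ w)  zero    _       r = refl
    lemma (b ∷ w)     (suc i) (s≤s q) r = lemma w i q (b ∷ r)

  input-stage-< : ∀ a i → i ≤ len a → primrec 0 (λ i acc → 2 + nth i a + acc * 5) i < 2 ^ (3 * len a)
  input-stage-< a i i≤ = subst (λ x → primrec 0 (λ i acc → 2 + nth i x + acc * 5) i < 2 ^ (3 * len a)) (val-str a)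
    (≤-<-trans (≤-reflexive (input-stage (str a) i i≤′)) (<-≤-trans (code₅-< (encBits (take i (str a) ʳ++ []))) (^-monoʳ-≤ 2 (*-monoʳ-≤ 3 (≤-trans (≤-reflexive size′) i≤)))))
    where
    i≤′ : i ≤ length (str a)
    i≤′ = ≤-trans i≤ (≤-reflexive (len-str a))
    size′ : length (encBits (take i (str a) ʳ++ [])) ≡ i
    size′ = trans (length-map encBit (take i (str a) ʳ++ [])) (trans (length-ʳ++ (take i (str a))) (trans (+-identityʳ _) (trans (length-take i (str a)) (m≤n⇒m⊓n≡m i≤′))))

  inputN-code : ∀ a → inputN a ≡ code₅ (encBits (word a))
  inputN-code a = trans (cong inputN (sym (val-str a))) (trans (cong (primrec 0 (λ i acc → 2 + nth i (val (str a)) + acc * 5)) (len-val (str a)))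
    (trans (input-stage (str a) (length (str a)) ≤-refl) (cong (λ w → code₅ (encBits (w ʳ++ []))) (take-all (length (str a)) (str a) ≤-refl))))

  startN-code : ∀ a → startN a ≡ codeC (initial M (encBits (word a)))
  startN-code a rewrite inputN-code a = lemma (encBits (word a))
    where
    lemma : ∀ w → pair (toℕ (TM.start M)) (pair 0 (ifz (code₅ w) 1 (code₅ w))) ≡ codeC (initial M w)
    lemma []         = refl
    lemma (blank ∷ w) = refl
    lemma (o0 ∷ w)   = refl
    lemma (o1 ∷ w)   = refl
    lemma (hash ∷ w) = refl

  iter-final : ∀ a t → iter stepN t (startN a) ≡ codeC (run M t (initial M (encBits (word a))))
  iter-final a t = trans (cong (iter stepN t) (startN-code a)) (iter-code t (initial M (encBits (word a))))

  iter-≤ : ∀ a t → iter stepN t (startN a) ≤ limit a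
  iter-≤ a t rewrite scalePoly-eval 3 p (len a) = ≤-trans (≤-reflexive (iter-final a t))
    (codeC-≤ (run M t (initial M (encBits (word a)))) (≤-trans (bound (word a) t) (≤-reflexive (cong (evalPoly p) (length-word a)))))

  finalC : ℕ → Config M
  finalC a = run M (proj₁ (halts (word a))) (initial M (encBits (word a)))

  -- All configurations of the run have codes up to `limit a` and the halting one is fixed, so
  -- `stabilises` shows that it is reached after `suc (limit a)` steps, whatever the actual halting
  -- time.
  final-code : ∀ a → final a ≡ codeC (finalC a)
  final-code a = trans (stabilises stepN (startN a) (limit a) (iter-≤ a) t
      (trans (cong stepN (iter-final a t)) (trans (stepN-code (finalC a)) (trans (cong codeC (step-halted M halted′)) (sym (iter-final a t)))))) (iter-final a t)
    where
    t = proj₁ (halts (word a))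
    halted′ : halted M (finalC a)
    halted′ = proj₁ (proj₂ (halts (word a)))

  final-output : ∀ a → output M (finalC a) ≡ encY (f (word a))
  final-output a = proj₂ (proj₂ (halts (word a)))

  output-short : ∀ a → length (encY (f (word a))) ≤ evalPoly p (len a)
  output-short a = ≤-trans (≤-reflexive (cong length (sym (final-output a)))) (≤-trans (takeNonBlank-length (tape M (finalC a)))
    (≤-trans (≤-reflexive (trans (length-++ (reverse (Config.left (finalC a)))) (cong (_+ suc (length (Config.right (finalC a)))) (length-reverse (Config.left (finalC a))))))
      (≤-trans (bound (word a) (proj₁ (halts (word a)))) (≤-reflexive (cong (evalPoly p) (length-word a))))))

  inputN₁ : PS₁ inputN
  inputN₁ = recᵖ zeroᵖ (constᵖ 2 +ᵖ app₂ nth nth₂ (varᵖ 0F) (varᵖ 2F) +ᵖ varᵖ 1F *ᵖ constᵖ 5) (lenᵖ (varᵖ 0F)) (con 3 ⊗ X)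
    (λ b v sm i i≤ → <-≤-trans (input-stage-< (lookup v 0F) i i≤) (^-monoʳ-≤ 2 (*-monoʳ-≤ 3 (proj₂ (tiny-len (varᵖ 0F)) b v sm))))

  startN₁ : PS₁ startN
  startN₁ = app₂ pair pair₂ (constᵖ (toℕ (TM.start M))) (app₂ pair pair₂ (constᵖ 0) (app₃ ifz ifz₃ inputN₁ (constᵖ 1) inputN₁))

  limit₁ : PS₁ limit
  limit₁ = app₂ pair pair₂ (constᵖ (TM.nstates M)) (app₂ pair pair₂ P P)
    where
    P : PS 1 (λ v → 2 ^ evalPoly (scalePoly 3 p) (len (lookup v 0F)))
    P = pow2ᵖ (polyᵖ (scalePoly 3 p) (lenᵖ (varᵖ 0F))) (tiny-poly (scalePoly 3 p) (tiny-len (varᵖ 0F)))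

  final₁ : PS₁ final
  final₁ = recᵇ startN₁ (app₁ stepN stepN₁ (varᵖ 1F)) (sucᵖ limit₁) limit₁ (λ v i _ → iter-≤ (lookup v 0F) i)

-- The values of computable functions as functions of codes

unary-PS : ∀ {V} → PSpaceComputable encBits length encUnary V → PS₁ (λ a → V (reverse (str a)))
unary-PS {V} (M , p , pc) = ext (λ v → lemma (lookup v 0F)) (app₁ endN endN₁ final₁)
  where
  open Result pc
  lemma : ∀ a → endN (final a) ≡ V (word a)
  lemma a = trans (cong endN (final-code a)) (trans (endN-code M (finalC a)) (trans (cong length (final-output a)) (length-replicate (V (word a)))))

-- The number whose binary digits, most significant first, are t 0, t 1, …, t (n - 1).
binary : (ℕ → ℕ) → ℕ → ℕ
binary t = primrec 0 (λ i a → a + a + t i)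

binary-< : ∀ t n → (∀ i → i < n → t i ≤ 1) → binary t n < 2 ^ n
binary-< t zero    le = s≤s z≤n
binary-< t (suc n) le = begin-strict
  binary t n + binary t n + t n ≤⟨ +-monoʳ-≤ _ (le n ≤-refl) ⟩
  binary t n + binary t n + 1 <⟨ ≤-reflexive (lemma (binary t n)) ⟩
  suc (binary t n) + suc (binary t n) ≤⟨ +-mono-≤ ih ih ⟩
  2 ^ n + 2 ^ n ≡⟨ 2^-double n ⟨
  2 ^ suc n ∎
  where
  open ≤-Reasoning
  ih = binary-< t n (λ i i< → le i (m<n⇒m<1+n i<))
  lemma : ∀ x → suc (x + x + 1) ≡ suc x + suc x
  lemma = solve-∀

binary-cong : ∀ {t t′} n → (∀ i → i < n → t i ≡ t′ i) → binary t n ≡ binary t′ n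
binary-cong zero    e = refl
binary-cong (suc n) e = cong₂ (λ x y → x + x + y) (binary-cong n (λ i i< → e i (m<n⇒m<1+n i<))) (e n ≤-refl)

at-≤1 : ∀ w i → at w i ≤ 1
at-≤1 []          i       = z≤n
at-≤1 (false ∷ w) zero    = z≤n
at-≤1 (true ∷ w)  zero    = ≤-refl
at-≤1 (b ∷ w)     (suc i) = at-≤1 w i

lsb : List Bool → ℕ
lsb []      = 0
lsb (b ∷ l) = bit b + lsb l * 2

binary-reverse : ∀ l → binary (at (reverse l)) (length l) ≡ lsb l
binary-reverse []      = refl
binary-reverse (b ∷ l) rewrite unfold-reverse b l =
  trans (cong₂ (λ x y → x + x + y) (trans (binary-cong (length l) (λ i i< → index-++ˡ bit (reverse l) (subst (i <_) (sym (length-reverse l)) i<))) (binary-reverse l))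
          (trans (cong (at (reverse l ++ b ∷ [])) (sym (trans (+-identityʳ _) (length-reverse l)))) (index-++ʳ bit (reverse l) 0)))
    (lemma (lsb l) (bit b))
  where
  lemma : ∀ x y → x + x + y ≡ y + x * 2
  lemma = solve-∀

odd-bit : ∀ n → bit (if n % 2 ≡ᵇ 1 then true else false) ≡ n % 2
odd-bit n with n % 2 | m%n<n n 2
... | zero        | _ = refl
... | suc zero    | _ = refl
... | suc (suc _) | s≤s (s≤s ())

half-≤ : ∀ {n f} → suc n ≤ suc f → suc n / 2 ≤ f
half-≤ {n} (s≤s le) = ≤-trans (≤-pred (m/n<m (suc n) 2 (s≤s (s≤s z≤n)))) le

lsb-binLSB : ∀ f n → n ≤ f → lsb (binLSB f n) ≡ n
lsb-binLSB zero    zero    le = refl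
lsb-binLSB (suc f) zero    le = refl
lsb-binLSB (suc f) (suc n) le = trans (cong₂ (λ x y → x + y * 2) (odd-bit (suc n)) (lsb-binLSB f (suc n / 2) (half-≤ le))) (sym (m≡m%n+[m/n]*n (suc n) 2))

binary-bin : ∀ n → binary (at (bin n)) (length (bin n)) ≡ n
binary-bin n = trans (cong (binary (at (bin n))) (length-reverse (binLSB n n))) (trans (binary-reverse (binLSB n n)) (lsb-binLSB n n ≤-refl))

at₅-bits : ∀ w i → i < length w → at₅ (encBits w) i ∸ 2 ≡ at w i
at₅-bits (false ∷ w) zero    _       = refl
at₅-bits (true ∷ w)  zero    _       = refl
at₅-bits (b ∷ w)     (suc i) (s≤s p) = at₅-bits w i p

module Rational {N : List Bool → ℚ} {M : TM} {p : Poly} (pc : PSpaceComputes encBits length encℚ N M p) where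
  open Result pc

  num den : ℕ → ℕ
  num a = ∣ ℚ.numerator (N (word a)) ∣
  den a = ℚ.denominatorℕ (N (word a))

  hash-at : ∀ a → hashN (final a) ≡ length (bin (num a))
  hash-at a = trans (cong hashN (final-code a)) (hashN-code M (finalC a) (bin (num a)) (encBits (bin (den a))) (final-output a))

  out-length : ∀ a → length (encℚ (N (word a))) ≡ length (bin (num a)) + suc (length (bin (den a)))
  out-length a = trans (length-++ (encBits (bin (num a)))) (cong₂ (λ x y → x + suc y) (length-map encBit (bin (num a))) (length-map encBit (bin (den a))))

  end-at : ∀ a → endN (final a) ≡ length (bin (num a)) + suc (length (bin (den a)))
  end-at a = trans (cong endN (final-code a)) (trans (endN-code M (finalC a)) (trans (cong length (final-output a)) (out-length a)))

  cell-at : ∀ a i → i < length (encℚ (N (word a))) → cell i (final a) ≡ at₅ (encℚ (N (word a))) i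
  cell-at a i i< = trans (cong (cell i) (final-code a)) (trans (cell-code M (finalC a) i)
    (trans (proj₁ (proj₁ (takeNonBlank-at (tape M (finalC a))) i (subst (λ o → i < length o) (sym (final-output a)) i<))) (cong (λ o → at₅ o i) (final-output a))))

  num-digit : ∀ a i → i < length (bin (num a)) → cell i (final a) ∸ 2 ≡ at (bin (num a)) i
  num-digit a i i< = trans (cong (_∸ 2) (trans (cell-at a i (subst (i <_) (sym (out-length a)) (≤-trans i< (m≤m+n _ _))))
    (index-++ˡ (toℕ ∘ digit) (encBits (bin (num a))) (subst (i <_) (sym (length-map encBit (bin (num a)))) i<)))) (at₅-bits (bin (num a)) i i<)

  den-digit : ∀ a i → i < length (bin (den a)) → cell (suc (hashN (final a)) + i) (final a) ∸ 2 ≡ at (bin (den a)) i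
  den-digit a i i< = trans (cong (λ h → cell (suc h + i) (final a) ∸ 2) (hash-at a)) (trans (cong (_∸ 2)
    (trans (cell-at a (suc n + i) (subst (suc n + i <_) (sym (out-length a)) (≤-trans (≤-reflexive (cong suc (sym (+-suc n i)))) (≤-trans (≤-reflexive (sym (+-suc n (suc i)))) (+-monoʳ-≤ n (s≤s i<))))))
      (trans (cong (at₅ (encℚ (N (word a)))) (trans (sym (+-suc n i)) (cong (_+ suc i) (sym (length-map encBit (bin (num a)))))))
        (index-++ʳ (toℕ ∘ digit) (encBits (bin (num a))) (suc i))))) (at₅-bits (bin (den a)) i i<))
    where n = length (bin (num a))

  size₁ : PE
  size₁ = proj₁ (tiny-poly p (tiny-len {1} (varᵖ 0F)))

  tiny : ∀ b v → Small {1} b v → evalPoly p (len (lookup v 0F)) ≤ ⟦ size₁ ⟧ b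
  tiny = proj₂ (tiny-poly p (tiny-len (varᵖ 0F)))

  -- Reads a binary number from consecutive output cells; 2 is subtracted because `o0` and `o1` have
  -- the digits 2 and 3. Its length is bounded by the space of the machine that has written it.
  field₁ : ∀ {start count} {w : ℕ → List Bool} → PS₁ start → PS₁ count → (∀ a → count a ≡ length (w a)) →
           (∀ a i → i < length (w a) → cell (start a + i) (final a) ∸ 2 ≡ at (w a) i) →
           (∀ a → length (w a) ≤ length (encℚ (N (word a)))) → PS₁ (λ a → binary (at (w a)) (length (w a)))
  field₁ {start} {count} {w} S C eq digit short = ext (λ v → value (lookup v 0F))
    (recᵖ zeroᵖ (varᵖ 1F +ᵖ varᵖ 1F +ᵖ (app₂ cell cell₂ (app₁ start S (varᵖ 2F) +ᵖ varᵖ 0F) (app₁ final final₁ (varᵖ 2F)) ∸ᵖ constᵖ 2)) C size₁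
      (λ b v sm i i≤ → stage-< b v sm i (subst (i ≤_) (eq (lookup v 0F)) i≤)))
    where
    value : ∀ a → binary (λ i → cell (start a + i) (final a) ∸ 2) (count a) ≡ binary (at (w a)) (length (w a))
    value a = trans (cong (binary (λ i → cell (start a + i) (final a) ∸ 2)) (eq a)) (binary-cong (length (w a)) (digit a))
    stage-< : ∀ b v → Small b v → ∀ i → i ≤ length (w (lookup v 0F)) →
              binary (λ i → cell (start (lookup v 0F) + i) (final (lookup v 0F)) ∸ 2) i < 2 ^ ⟦ size₁ ⟧ b
    stage-< b v sm i i≤ = <-≤-trans (binary-< _ i (λ j j< → ≤-trans (≤-reflexive (digit a j (<-≤-trans j< i≤))) (at-≤1 (w a) j)))
      (^-monoʳ-≤ 2 (≤-trans i≤ (≤-trans (short a) (≤-trans (output-short a) (tiny b v sm)))))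
      where a = lookup v 0F

  num₁ : PS₁ num
  num₁ = ext (λ v → binary-bin (num (lookup v 0F))) (field₁ {start = λ _ → 0} {w = bin ∘ num} zeroᵖ (app₁ hashN hashN₁ final₁) hash-at num-digit
    (λ a → ≤-trans (m≤m+n _ _) (≤-reflexive (sym (out-length a)))))

  den₁ : PS₁ den
  den₁ = ext (λ v → binary-bin (den (lookup v 0F))) (field₁ {start = λ a → suc (hashN (final a))} {w = bin ∘ den}
    (sucᵖ (app₁ hashN hashN₁ final₁)) (app₁ endN endN₁ final₁ ∸ᵖ sucᵖ (app₁ hashN hashN₁ final₁)) count den-digit
    (λ a → ≤-trans (≤-trans (n≤1+n _) (m≤n+m _ (length (bin (num a))))) (≤-reflexive (sym (out-length a)))))
    where
    count : ∀ a → endN (final a) ∸ suc (hashN (final a)) ≡ length (bin (den a))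
    count a = trans (cong₂ (λ x y → x ∸ suc y) (end-at a) (hash-at a)) (trans (cong (_∸ suc (length (bin (num a)))) (+-suc (length (bin (num a))) _)) (m+n∸m≡n (suc (length (bin (num a)))) _))

-- Writing numbers in binary

halve : ℕ → ℕ → ℕ
halve i n = primrec n (λ _ a → quot a 2) i

halve-≤ : ∀ i n → halve i n ≤ n
halve-≤ zero    n = ≤-refl
halve-≤ (suc i) n = ≤-trans (quot-≤ (halve i n) 1) (halve-≤ i n)

halve₂ : PS₂ halve
halve₂ = recᵇ (varᵖ 1F) (quotᵖ (varᵖ 1F) (constᵖ 2)) (varᵖ 0F) (varᵖ 1F) (λ v i _ → halve-≤ i (lookup v 1F))

halve-suc : ∀ i n → halve (suc i) n ≡ halve i (quot n 2)
halve-suc zero    n = refl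
halve-suc (suc i) n = cong (λ z → quot z 2) (halve-suc i n)

quot-/ : ∀ n → quot n 2 ≡ n / 2
quot-/ n = quot-unique (m/n*n≤m n 2) (<-≤-trans (s≤s (≤-reflexive (m≡m%n+[m/n]*n n 2))) (+-monoˡ-≤ (n / 2 * 2) (m%n<n n 2)))

digits : ℕ → ℕ
digits n = find (λ i → halve i n ≡ᵇ 0) (suc n)

halve-0 : ∀ i → halve i 0 ≡ 0
halve-0 zero    = refl
halve-0 (suc i) = trans (halve-suc i 0) (trans (cong (halve i) (quot-/ 0)) (halve-0 i))

halve-all : ∀ f n → n ≤ f → halve (length (binLSB f n)) n ≡ 0
halve-all zero    zero    le = refl
halve-all (suc f) zero    le = refl
halve-all (suc f) (suc n) le = trans (halve-suc (length (binLSB f (suc n / 2))) (suc n)) (trans (cong (halve (length (binLSB f (suc n / 2)))) (quot-/ (suc n))) (halve-all f (suc n / 2) (half-≤ le)))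

halve-some : ∀ f n i → n ≤ f → i < length (binLSB f n) → halve i n ≢ 0
halve-some (suc f) (suc n) zero    le p       = λ ()
halve-some (suc f) (suc n) (suc i) le (s≤s p) e = halve-some f (suc n / 2) i (half-≤ le) p (trans (sym (trans (halve-suc i (suc n)) (cong (halve i) (quot-/ (suc n))))) e)

length-binLSB : ∀ f n → n ≤ f → length (binLSB f n) ≤ n
length-binLSB zero    zero    le = z≤n
length-binLSB (suc f) zero    le = z≤n
length-binLSB (suc f) (suc n) le = s≤s (≤-trans (length-binLSB f (suc n / 2) (half-≤ le)) (≤-pred (m/n<m (suc n) 2 (s≤s (s≤s z≤n)))))

digits-bin : ∀ n → digits n ≡ length (binLSB n n)
digits-bin n = find-least (λ i → halve i n ≡ᵇ 0) (cong (_≡ᵇ 0) (halve-all n n ≤-refl)) (λ i i< → ≡ᵇ-false (halve-some n n i ≤-refl i<)) (s≤s (length-binLSB n n ≤-refl))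

binLSB-at : ∀ f n i → n ≤ f → at (binLSB f n) i ≡ rem (halve i n) 2
binLSB-at zero    zero    i       le = sym (trans (cong (λ z → rem z 2) (halve-0 i)) (proj₂ (quot-rem 0 0 (s≤s z≤n))))
binLSB-at (suc f) zero    i       le = sym (trans (cong (λ z → rem z 2) (halve-0 i)) (proj₂ (quot-rem 0 0 (s≤s z≤n))))
binLSB-at (suc f) (suc n) zero    le = trans (odd-bit (suc n)) (sym (trans (cong (λ z → rem z 2) (m≡m%n+[m/n]*n (suc n) 2)) (proj₂ (quot-rem (suc n % 2) (suc n / 2) (m%n<n (suc n) 2)))))
binLSB-at (suc f) (suc n) (suc i) le = trans (binLSB-at f (suc n / 2) i (half-≤ le)) (cong (λ z → rem z 2) (sym (trans (halve-suc i (suc n)) (cong (halve i) (quot-/ (suc n))))))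

length-binLSB-≤ : ∀ b f n → n < 2 ^ b → length (binLSB f n) ≤ b
length-binLSB-≤ b       zero    n       lt = z≤n
length-binLSB-≤ b       (suc f) zero    lt = z≤n
length-binLSB-≤ zero    (suc f) (suc n) (s≤s ())
length-binLSB-≤ (suc b) (suc f) (suc n) lt = s≤s (length-binLSB-≤ b f (suc n / 2) (m<n*o⇒m/o<n (subst (suc n <_) (*-comm 2 (2 ^ b)) lt)))

-- Pushing the digits one by one, least significant first, reverses their order.
binCode : ℕ → ℕ
binCode n = primrec 0 (λ i a → suc (rem (halve i n) 2 + 2 * a)) (digits n)

binCode-stage : ∀ n i → i ≤ length (binLSB n n) → primrec 0 (λ i a → suc (rem (halve i n) 2 + 2 * a)) i ≡ val (take i (binLSB n n) ʳ++ [])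
binCode-stage n zero    _  = refl
binCode-stage n (suc i) i< = trans (cong₂ (λ x a → suc (x + 2 * a)) (sym (binLSB-at n n i ≤-refl)) (binCode-stage n i (<⇒≤ i<))) (lemma (binLSB n n) i i< [])
  where
  lemma : ∀ w i → i < length w → ∀ r → suc (at w i + 2 * val (take i w ʳ++ r)) ≡ val (take (suc i) w ʳ++ r)
  lemma (b ∷ w) zero    _       r = refl
  lemma (b ∷ w) (suc i) (s≤s q) r = lemma w i q (b ∷ r)

binCode-bin : ∀ n → binCode n ≡ val (bin n)
binCode-bin n = trans (cong (primrec 0 (λ i a → suc (rem (halve i n) 2 + 2 * a))) (digits-bin n))
  (trans (binCode-stage n (length (binLSB n n)) ≤-refl) (cong (λ w → val (w ʳ++ [])) (take-all (length (binLSB n n)) (binLSB n n) ≤-refl)))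

binCode₁ : PS₁ binCode
binCode₁ = recᵖ zeroᵖ (sucᵖ (remᵖ (app₂ halve halve₂ (varᵖ 0F) (varᵖ 2F)) (constᵖ 2) +ᵖ constᵖ 2 *ᵖ varᵖ 1F))
  (findᵖ (app₂ halve halve₂ (varᵖ 0F) (varᵖ 1F) ≡ᵖ constᵖ 0) (sucᵖ (varᵖ 0F))) (con 1 ⊕ X)
  (λ b v sm i i≤ → stage-< b (lookup v 0F) (sm 0F) i (subst (i ≤_) (digits-bin (lookup v 0F)) i≤))
  where
  stage-< : ∀ b n → n < 2 ^ b → ∀ i → i ≤ length (binLSB n n) → primrec 0 (λ i a → suc (rem (halve i n) 2 + 2 * a)) i < 2 ^ suc b
  stage-< b n lt i i≤ = ≤-<-trans (≤-reflexive (binCode-stage n i i≤)) (≤-trans (n≤1+n _) (≤-trans (val-< (take i (binLSB n n) ʳ++ []))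
    (^-monoʳ-≤ 2 (s≤s (≤-trans (≤-reflexive (trans (length-ʳ++ (take i (binLSB n n))) (+-identityʳ _))) (≤-trans (≤-trans (≤-reflexive (length-take i (binLSB n n))) (m⊓n≤n i _)) (length-binLSB-≤ b n n lt)))))))

-- The savings martingale

-- A martingale is given by numerators P and denominators Q; strings are
-- written with the most recent bit first.
module Savings (P Q : List Bool → ℕ) (Q>0 : ∀ a → 0 < Q a)
  (fair : ∀ a → 2 * P a * (Q (false ∷ a) * Q (true ∷ a)) ≡ (P (false ∷ a) * Q (true ∷ a) + P (true ∷ a) * Q (false ∷ a)) * Q a) where

  floor : List Bool → ℕ → ℕ
  floor a s = quot (2 ^ s * P a) (Q a)

  floor-lower : ∀ a s → floor a s * Q a ≤ 2 ^ s * P a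
  floor-lower a s = proj₁ (quot-bounds (2 ^ s * P a) (Q a) (Q>0 a))

  floor-upper : ∀ a s → 2 ^ s * P a < suc (floor a s) * Q a
  floor-upper a s = proj₂ (quot-bounds (2 ^ s * P a) (Q a) (Q>0 a))

  -- This is ⌊2r⌋ ≤ 2⌊r⌋ + 1. It measures both rounding errors that occur: one unit for doubling the
  -- scale, one for adding the floors at the two successors.
  double-floor : ∀ a s {y} → y * Q a ≤ 2 * (2 ^ s * P a) → y ≤ suc (2 * floor a s)
  double-floor a s {y} le = ≤-pred (*-cancelʳ-< (Q a) y (2 + 2 * floor a s)
    (≤-<-trans le (<-≤-trans (*-monoʳ-< 2 (floor-upper a s)) (≤-reflexive (lemma (floor a s) (Q a))))))
    where
    lemma : ∀ f q → 2 * (suc f * q) ≡ (2 + 2 * f) * q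
    lemma = solve-∀

  floor-suc : ∀ a s → floor a (suc s) ≤ suc (2 * floor a s)
  floor-suc a s = double-floor a s (≤-trans (floor-lower a (suc s)) (≤-reflexive (*-assoc 2 (2 ^ s) (P a))))

  floor-fair : ∀ a s → floor (false ∷ a) s + floor (true ∷ a) s ≤ suc (2 * floor a s)
  floor-fair a s = double-floor a s (*-cancelʳ-≤ ((y₀ + y₁) * Q a) (2 * (e * P a)) (q₀ * q₁) {{>-nonZero (*-mono-≤ (Q>0 (false ∷ a)) (Q>0 (true ∷ a)))}} (begin
    (y₀ + y₁) * Q a * (q₀ * q₁) ≡⟨ lemma₁ y₀ y₁ q₀ q₁ (Q a) ⟩
    (y₀ * q₀ * q₁ + y₁ * q₁ * q₀) * Q a ≤⟨ *-monoˡ-≤ (Q a) (+-mono-≤ (*-monoˡ-≤ q₁ (floor-lower (false ∷ a) s)) (*-monoˡ-≤ q₀ (floor-lower (true ∷ a) s))) ⟩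
    (e * p₀ * q₁ + e * p₁ * q₀) * Q a ≡⟨ lemma₂ e p₀ p₁ q₀ q₁ (Q a) ⟩
    e * ((p₀ * q₁ + p₁ * q₀) * Q a) ≡⟨ cong (e *_) (fair a) ⟨
    e * (2 * P a * (q₀ * q₁)) ≡⟨ lemma₃ e (P a) (q₀ * q₁) ⟩
    2 * (e * P a) * (q₀ * q₁) ∎))
    where
    open ≤-Reasoning
    e = 2 ^ s
    p₀ = P (false ∷ a)
    p₁ = P (true ∷ a)
    q₀ = Q (false ∷ a)
    q₁ = Q (true ∷ a)
    y₀ = floor (false ∷ a) s
    y₁ = floor (true ∷ a) s
    lemma₁ : ∀ y₀ y₁ q₀ q₁ q → (y₀ + y₁) * q * (q₀ * q₁) ≡ (y₀ * q₀ * q₁ + y₁ * q₁ * q₀) * q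
    lemma₁ = solve-∀
    lemma₂ : ∀ e p₀ p₁ q₀ q₁ q → (e * p₀ * q₁ + e * p₁ * q₀) * q ≡ e * ((p₀ * q₁ + p₁ * q₀) * q)
    lemma₂ = solve-∀
    lemma₃ : ∀ e p q → e * (2 * p * q) ≡ 2 * (e * p) * q
    lemma₃ = solve-∀

  floor-≥ : ∀ a s m → m * Q a ≤ P a → m * 2 ^ s ≤ floor a s
  floor-≥ a s m le = ≤-pred (*-cancelʳ-< (Q a) (m * 2 ^ s) (suc (floor a s)) (≤-<-trans (≤-trans (≤-reflexive (lemma m (2 ^ s) (Q a))) (*-monoʳ-≤ (2 ^ s) le)) (floor-upper a s)))
    where
    lemma : ∀ m e q → m * e * q ≡ e * (m * q)
    lemma = solve-∀

  floor-fair′ : ∀ b a s → floor (b ∷ a) s + floor (not b ∷ a) s ≤ suc (2 * floor a s)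
  floor-fair′ false a s = floor-fair a s
  floor-fair′ true  a s = ≤-trans (≤-reflexive (+-comm (floor (true ∷ a) s) _)) (floor-fair a s)

  -- The successor puts the initial capital below the threshold 2 ^ `c₀`, and makes `c₀` positive,
  -- so that each half put aside is worth at least 1.
  c₀ : ℕ
  c₀ = suc (floor [] 0)

  -- Whenever the capital, weighted by 2 ^ - saved, reaches 2 ^ c₀, half of it is put aside.
  saved : List Bool → ℕ
  saved []      = 0
  saved (b ∷ a) = if floor (b ∷ a) (length a ∸ saved a) <ᵇ 2 ^ (length a + c₀) then saved a else suc (saved a)

  scale : List Bool → ℕ
  scale a = length a ∸ saved a

  -- The martingale with savings, rounded to a multiple of 2 ^ - length and scaled by 2 ^ length.
  capital : List Bool → ℕ
  capital []      = floor [] 0 + 2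
  capital (b ∷ a) = 2 * capital a + floor (b ∷ a) (scale a) ∸ floor (not b ∷ a) (scale a)

  saved-mono : ∀ b a → saved a ≤ saved (b ∷ a)
  saved-mono b a with floor (b ∷ a) (length a ∸ saved a) <ᵇ 2 ^ (length a + c₀)
  ... | true  = ≤-refl
  ... | false = n≤1+n _

  saved-≤ : ∀ a → saved a ≤ length a
  saved-≤ []      = z≤n
  saved-≤ (b ∷ a) with floor (b ∷ a) (length a ∸ saved a) <ᵇ 2 ^ (length a + c₀)
  ... | true  = m≤n⇒m≤1+n (saved-≤ a)
  ... | false = s≤s (saved-≤ a)

  n<2^n : ∀ n → n < 2 ^ n
  n<2^n zero    = s≤s z≤n
  n<2^n (suc n) = ≤-trans (+-mono-≤ (m^n>0 2 n) (n<2^n n)) (≤-reflexive (sym (2^-double n)))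

  double-< : ∀ {x y} → x < y → suc (2 * x) < 2 * y
  double-< {x} {y} p = ≤-trans (≤-reflexive (lemma x)) (*-monoʳ-≤ 2 p)
    where
    lemma : ∀ x → 2 + 2 * x ≡ 2 * suc x
    lemma = solve-∀

  -- The capital at stake at most doubles in one step, so a single halving brings it back below the
  -- threshold.
  floor-< : ∀ a → floor a (scale a) < 2 ^ (length a + c₀)
  floor-< []      = <-trans (n<1+n _) (n<2^n c₀)
  floor-< (b ∷ a) with floor (b ∷ a) (length a ∸ saved a) <? 2 ^ (length a + c₀)
  ... | yes p rewrite <ᵇ-true p | sym (suc-∸ {saved a} {suc (length a)} (s≤s (saved-≤ a))) = ≤-<-trans (floor-suc (b ∷ a) (length a ∸ saved a)) (double-< p)
  ... | no ¬p rewrite <ᵇ-false (≮⇒≥ ¬p) = ≤-<-trans (≤-trans (m≤m+n _ _) (floor-fair′ b a (scale a))) (double-< (floor-< a))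

  -- Savings, plus the amount at stake, plus a reserve of 2. The change of scale turns the reserve
  -- into 4 at each step; if nothing is saved, `floor-fair′` and `floor-suc` cost one unit each, and
  -- 2 remain.
  capital-≥ : ∀ a → 2 ^ length a * saved a + floor a (scale a) + 2 ≤ capital a
  fair-≤ : ∀ b a → floor (not b ∷ a) (scale a) ≤ 2 * capital a

  capital-≥ []      = ≤-refl
  capital-≥ (b ∷ a) with floor (b ∷ a) (length a ∸ saved a) <? 2 ^ (length a + c₀)
  ... | yes p rewrite <ᵇ-true p | sym (suc-∸ {saved a} {suc (length a)} (s≤s (saved-≤ a))) =
        m+n≤o⇒m≤o∸n _ (begin
          2 ^ suc (length a) * saved a + floor (b ∷ a) (suc (scale a)) + 2 + y ≤⟨ +-monoˡ-≤ y (+-monoˡ-≤ 2 (+-monoʳ-≤ (2 ^ suc (length a) * saved a) (floor-suc (b ∷ a) (scale a)))) ⟩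
          2 ^ suc (length a) * saved a + suc (2 * x) + 2 + y ≡⟨ lemma₁ (2 ^ length a) (saved a) x y ⟩
          2 * (2 ^ length a * saved a) + (x + y) + 3 + x ≤⟨ +-monoˡ-≤ x (+-monoˡ-≤ 3 (+-monoʳ-≤ (2 * (2 ^ length a * saved a)) (floor-fair′ b a (scale a)))) ⟩
          2 * (2 ^ length a * saved a) + suc (2 * f) + 3 + x ≡⟨ lemma₂ (2 ^ length a * saved a) f x ⟩
          2 * (2 ^ length a * saved a + f + 2) + x ≤⟨ +-monoˡ-≤ x (*-monoʳ-≤ 2 (capital-≥ a)) ⟩
          2 * capital a + x ∎)
    where
    open ≤-Reasoning
    x = floor (b ∷ a) (scale a)
    y = floor (not b ∷ a) (scale a)
    f = floor a (scale a)
    lemma₁ : ∀ e k x y → 2 * e * k + suc (2 * x) + 2 + y ≡ 2 * (e * k) + (x + y) + 3 + x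
    lemma₁ = solve-∀
    lemma₂ : ∀ e f x → 2 * e + suc (2 * f) + 3 + x ≡ 2 * (e + f + 2) + x
    lemma₂ = solve-∀
  ... | no ¬p rewrite <ᵇ-false (≮⇒≥ ¬p) =
        m+n≤o⇒m≤o∸n _ (begin
          2 ^ suc (length a) * suc (saved a) + x + 2 + y ≡⟨ lemma₁ (2 ^ length a) (saved a) x y ⟩
          2 * (2 ^ length a * saved a) + (x + y) + 2 + 2 ^ suc (length a) ≤⟨ +-mono-≤ (+-monoˡ-≤ 2 (+-monoʳ-≤ (2 * (2 ^ length a * saved a)) (floor-fair′ b a (scale a)))) (≤-trans big (n≤1+n x)) ⟩
          2 * (2 ^ length a * saved a) + suc (2 * f) + 2 + suc x ≡⟨ lemma₂ (2 ^ length a * saved a) f x ⟩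
          2 * (2 ^ length a * saved a + f + 2) + x ≤⟨ +-monoˡ-≤ x (*-monoʳ-≤ 2 (capital-≥ a)) ⟩
          2 * capital a + x ∎)
    where
    open ≤-Reasoning
    x = floor (b ∷ a) (scale a)
    y = floor (not b ∷ a) (scale a)
    f = floor a (scale a)
    -- In the new scale one unit of savings is 2 ^ `suc (length a)`; it is paid by halving the
    -- stake, as `c₀` is positive.
    big : 2 ^ suc (length a) ≤ x
    big = ≤-trans (^-monoʳ-≤ 2 (≤-trans (≤-reflexive (+-comm 1 (length a))) (+-monoʳ-≤ (length a) (s≤s z≤n)))) (≮⇒≥ ¬p)
    lemma₁ : ∀ e k x y → 2 * e * suc k + x + 2 + y ≡ 2 * (e * k) + (x + y) + 2 + 2 * e
    lemma₁ = solve-∀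
    lemma₂ : ∀ e f x → 2 * e + suc (2 * f) + 2 + suc x ≡ 2 * (e + f + 2) + x
    lemma₂ = solve-∀

  fair-≤ b a = begin
    floor (not b ∷ a) (scale a) ≤⟨ m≤n+m _ (floor (b ∷ a) (scale a)) ⟩
    floor (b ∷ a) (scale a) + floor (not b ∷ a) (scale a) ≤⟨ floor-fair′ b a (scale a) ⟩
    suc (2 * floor a (scale a)) ≤⟨ n≤1+n _ ⟩
    2 + 2 * floor a (scale a) ≡⟨ lemma (floor a (scale a)) ⟩
    2 * (floor a (scale a) + 1) ≤⟨ *-monoʳ-≤ 2 (≤-trans (+-mono-≤ (m≤n+m _ (2 ^ length a * saved a)) (n≤1+n 1)) (capital-≥ a)) ⟩
    2 * capital a ∎
    where
    open ≤-Reasoning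
    lemma : ∀ f → 2 + 2 * f ≡ 2 * (f + 1)
    lemma = solve-∀

  -- The corrections at the two successors are opposite and cancel, however coarse the floors are;
  -- `fair-≤` makes sure that the subtractions are not truncated.
  capital-fair : ∀ a → capital (false ∷ a) + capital (true ∷ a) ≡ 4 * capital a
  capital-fair a = +-cancelʳ-≡ (y + x) _ _ (begin
    (2 * T + x ∸ y) + (2 * T + y ∸ x) + (y + x) ≡⟨ lemma₁ (2 * T + x ∸ y) (2 * T + y ∸ x) x y ⟩
    (2 * T + x ∸ y + y) + (2 * T + y ∸ x + x) ≡⟨ cong₂ _+_ (m∸n+n≡m (≤-trans (fair-≤ false a) (m≤m+n _ x))) (m∸n+n≡m (≤-trans (fair-≤ true a) (m≤m+n _ y))) ⟩
    2 * T + x + (2 * T + y) ≡⟨ lemma₂ T x y ⟩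
    4 * T + (y + x) ∎)
    where
    open ≡-Reasoning
    T = capital a
    x = floor (false ∷ a) (scale a)
    y = floor (true ∷ a) (scale a)
    lemma₁ : ∀ a b x y → a + b + (y + x) ≡ (a + y) + (b + x)
    lemma₁ = solve-∀
    lemma₂ : ∀ T x y → 2 * T + x + (2 * T + y) ≡ 4 * T + (y + x)
    lemma₂ = solve-∀

  -- Neither successor can exceed the sum of both, which is four times the capital. This gives the
  -- length bound for the recursion that computes `capital`.
  capital-≤ : ∀ a → capital a ≤ 4 ^ length a * capital []
  capital-≤ []      = ≤-reflexive (sym (*-identityˡ _))
  capital-≤ (b ∷ a) = ≤-trans (one b) (≤-trans (≤-reflexive (capital-fair a)) (≤-trans (*-monoʳ-≤ 4 (capital-≤ a)) (≤-reflexive (sym (*-assoc 4 (4 ^ length a) (capital []))))))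
    where
    one : ∀ b → capital (b ∷ a) ≤ capital (false ∷ a) + capital (true ∷ a)
    one false = m≤m+n _ _
    one true  = m≤n+m _ _

  capital-saved : ∀ a → 2 ^ length a * saved a ≤ capital a
  capital-saved a = ≤-trans (≤-trans (m≤m+n _ _) (m≤m+n _ 2)) (capital-≥ a)

  capital-pos : ∀ a → 1 ≤ capital a
  capital-pos a = ≤-trans (≤-trans (n≤1+n 1) (m≤n+m 2 _)) (capital-≥ a)

  -- The amount at stake is the value of the original martingale times 2 ^ - `saved a` and stays
  -- below 2 ^ `c₀`; a large value thus needs many halvings.
  saved-large : ∀ a K → 2 ^ (suc K + c₀) * Q a ≤ P a → K ≤ saved a
  saved-large a K le with K ≤? saved a
  ... | yes p = p
  ... | no ¬p = contradiction (<-≤-trans (floor-< a) (≤-trans (^-monoʳ-≤ 2 exponent) (≤-trans (≤-reflexive (^-distribˡ-+-* 2 (suc K + c₀) (scale a))) (floor-≥ a (scale a) (2 ^ (suc K + c₀)) le)))) (<-irrefl refl)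
    where
    exponent : length a + c₀ ≤ suc K + c₀ + scale a
    exponent = ≤-trans (+-monoˡ-≤ c₀ (≤-trans (≤-reflexive (sym (m∸n+n≡m (saved-≤ a)))) (+-monoʳ-≤ (scale a) (≤-trans (<⇒≤ (≰⇒> ¬p)) (n≤1+n K)))))
      (≤-reflexive (lemma (scale a) (suc K) c₀))
      where
      lemma : ∀ s k c → s + k + c ≡ k + c + s
      lemma = solve-∀

-- Averaging over the answers to the queries

sumStr : ℕ → (List Bool → ℕ) → ℕ
sumStr zero    f = f []
sumStr (suc m) f = sumStr m (λ a → f (false ∷ a) + f (true ∷ a))

sumStr-cong : ∀ m {f g} → (∀ a → length a ≡ m → f a ≡ g a) → sumStr m f ≡ sumStr m g
sumStr-cong zero    e = e [] refl
sumStr-cong (suc m) e = sumStr-cong m (λ a l → cong₂ _+_ (e (false ∷ a) (cong suc l)) (e (true ∷ a) (cong suc l)))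

sumStr-mono : ∀ m {f g} → (∀ a → length a ≡ m → f a ≤ g a) → sumStr m f ≤ sumStr m g
sumStr-mono zero    e = e [] refl
sumStr-mono (suc m) e = sumStr-mono m (λ a l → +-mono-≤ (e (false ∷ a) (cong suc l)) (e (true ∷ a) (cong suc l)))

sumStr-+ : ∀ m f g → sumStr m (λ a → f a + g a) ≡ sumStr m f + sumStr m g
sumStr-+ zero    f g = refl
sumStr-+ (suc m) f g = trans (sumStr-cong m (λ a _ → lemma (f (false ∷ a)) (g (false ∷ a)) (f (true ∷ a)) (g (true ∷ a))))
                             (sumStr-+ m (λ a → f (false ∷ a) + f (true ∷ a)) (λ a → g (false ∷ a) + g (true ∷ a)))
  where
  lemma : ∀ a b c d → a + b + (c + d) ≡ (a + c) + (b + d)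
  lemma = solve-∀

sumStr-* : ∀ m k f → sumStr m (λ a → k * f a) ≡ k * sumStr m f
sumStr-* zero    k f = refl
sumStr-* (suc m) k f = trans (sumStr-cong m (λ a _ → sym (*-distribˡ-+ k (f (false ∷ a)) (f (true ∷ a))))) (sumStr-* m k (λ a → f (false ∷ a) + f (true ∷ a)))

take-++ˡ : ∀ {A : Set} i (u w : List A) → i ≤ length u → take i (u ++ w) ≡ take i u
take-++ˡ zero    u       w _       = refl
take-++ˡ (suc i) (c ∷ u) w (s≤s p) = cong (c ∷_) (take-++ˡ i u w p)

module Scan (V : List Bool → ℕ) (scanning : IsScanning V) where

  query : List Bool → ℕ
  query a = V (reverse a)

  data Queried (r : ℕ) : List Bool → Set where
    here  : ∀ {b a} → query a ≡ r → Queried r (b ∷ a)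
    there : ∀ {b a} → Queried r a → Queried r (b ∷ a)

  queried : ∀ a i → i < length a → Queried (V (take i (reverse a))) a
  queried (b ∷ a) i (s≤s i≤) rewrite unfold-reverse b a with m≤n⇒m<n∨m≡n i≤
  ... | inj₁ i<   = there (subst (λ w → Queried (V w) a) (sym (take-++ˡ i (reverse a) (b ∷ []) (subst (i ≤_) (sym (length-reverse a)) i≤))) (queried a i i<))
  ... | inj₂ refl = here (cong V (sym (trans (take-++ˡ (length a) (reverse a) (b ∷ []) (≤-reflexive (sym (length-reverse a)))) (trans (cong (λ n → take n (reverse a)) (sym (length-reverse a))) (take-all (length (reverse a)) (reverse a) ≤-refl)))))

  unqueried : ∀ {r a} → Queried r a → ∃ λ i → i < length a × V (take i (reverse a)) ≡ r
  unqueried {r} {b ∷ a} (here e) = length a , ≤-refl ,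
    trans (cong V (trans (cong (take (length a)) (unfold-reverse b a)) (trans (take-++ˡ (length a) (reverse a) (b ∷ []) (≤-reflexive (sym (length-reverse a)))) (trans (cong (λ n → take n (reverse a)) (sym (length-reverse a))) (take-all (length (reverse a)) (reverse a) ≤-refl))))) e
  unqueried {r} {b ∷ a} (there q) = let (i , i< , e) = unqueried q in i , m<n⇒m<1+n i< ,
    trans (cong V (trans (cong (take i) (unfold-reverse b a)) (take-++ˡ i (reverse a) (b ∷ []) (subst (i ≤_) (sym (length-reverse a)) (<⇒≤ i<))))) e

  fresh : ∀ {r a} → Queried r a → query a ≢ r
  fresh {r} {a} q e = let (i , i< , e′) = unqueried q in
    scanning (reverse a) i (subst (i <_) (sym (length-reverse a)) i<) (trans e (sym e′))

  answers : List Bool → Bool → List Bool → Bool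
  answers x b a = if query a <ᵇ length x then bit b ≡ᵇ at x (query a) else true

  compatible : List Bool → List Bool → Bool
  compatible x []      = true
  compatible x (b ∷ a) = answers x b a ∧ compatible x a

  ind : List Bool → List Bool → ℕ
  ind x a = bit (compatible x a)

  free-answer : ∀ x b a → length x ≤ query a → answers x b a ≡ true
  free-answer x b a le rewrite <ᵇ-false le = refl

  forced-answer : ∀ x b a → query a < length x → answers x b a ≡ (bit b ≡ᵇ at x (query a))
  forced-answer x b a lt rewrite <ᵇ-true lt = refl

  length-snoc : ∀ x (c : Bool) → length (x ++ c ∷ []) ≡ suc (length x)
  length-snoc x c = trans (length-++ x) (+-comm (length x) 1)

  answers-snoc : ∀ x c b a → query a ≢ length x → answers (x ++ c ∷ []) b a ≡ answers x b a
  answers-snoc x c b a ne with query a <? length x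
  ... | yes lt = trans (forced-answer (x ++ c ∷ []) b a (≤-trans (m≤n⇒m≤1+n lt) (≤-reflexive (sym (length-snoc x c)))))
                   (trans (cong (bit b ≡ᵇ_) (index-++ˡ bit x lt)) (sym (forced-answer x b a lt)))
  ... | no ¬lt = trans (free-answer (x ++ c ∷ []) b a (≤-trans (≤-reflexive (length-snoc x c)) (≤∧≢⇒< (≮⇒≥ ¬lt) (ne ∘ sym)))) (sym (free-answer x b a (≮⇒≥ ¬lt)))

  ind-unqueried : ∀ x c a → ¬ Queried (length x) a → ind (x ++ c ∷ []) a ≡ ind x a
  ind-unqueried x c a nq = cong bit (lemma a nq)
    where
    lemma : ∀ a → ¬ Queried (length x) a → compatible (x ++ c ∷ []) a ≡ compatible x a
    lemma []      nq = refl
    lemma (b ∷ a) nq = cong₂ _∧_ (answers-snoc x c b a (nq ∘ here)) (lemma a (nq ∘ there))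

  -- The one step that asks for `length x` decides between the two extensions. By `fresh` no other
  -- step asks for it, so all other answers are judged by `x` alone.
  ind-split : ∀ x a → Queried (length x) a → ind x a ≡ ind (x ++ false ∷ []) a + ind (x ++ true ∷ []) a
  ind-split x (b ∷ a) (here e) = begin
    bit (answers x b a ∧ compatible x a) ≡⟨ cong (λ t → bit (t ∧ compatible x a)) (free-answer x b a (≤-reflexive (sym e))) ⟩
    ind x a ≡⟨ lemma b (compatible x a) ⟩
    bit ((bit b ≡ᵇ 0) ∧ compatible x a) + bit ((bit b ≡ᵇ 1) ∧ compatible x a)
      ≡⟨ cong₂ (λ s t → bit s + bit t) (sym (one false)) (sym (one true)) ⟩
    ind (x ++ false ∷ []) (b ∷ a) + ind (x ++ true ∷ []) (b ∷ a) ∎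
    where
    open ≡-Reasoning
    lemma : ∀ b t → bit t ≡ bit ((bit b ≡ᵇ 0) ∧ t) + bit ((bit b ≡ᵇ 1) ∧ t)
    lemma false t = sym (+-identityʳ (bit t))
    lemma true  t = refl
    bit-injective : ∀ {s t} → bit s ≡ bit t → s ≡ t
    bit-injective {false} {false} _ = refl
    bit-injective {true}  {true}  _ = refl
    one : ∀ c → compatible (x ++ c ∷ []) (b ∷ a) ≡ (bit b ≡ᵇ bit c) ∧ compatible x a
    one c = cong₂ _∧_
      (trans (forced-answer (x ++ c ∷ []) b a (≤-reflexive (trans (cong suc e) (sym (length-snoc x c)))))
        (cong (bit b ≡ᵇ_) (trans (cong (at (x ++ c ∷ [])) (trans e (sym (+-identityʳ (length x))))) (index-++ʳ bit x 0))))
      (bit-injective (ind-unqueried x c a (λ q → fresh q e)))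
  ind-split x (b ∷ a) (there q) = begin
    bit (answers x b a ∧ compatible x a) ≡⟨ bit-∧ (answers x b a) _ ⟩
    bit (answers x b a) * ind x a ≡⟨ cong (bit (answers x b a) *_) (ind-split x a q) ⟩
    bit (answers x b a) * (ind (x ++ false ∷ []) a + ind (x ++ true ∷ []) a) ≡⟨ *-distribˡ-+ (bit (answers x b a)) _ _ ⟩
    bit (answers x b a) * ind (x ++ false ∷ []) a + bit (answers x b a) * ind (x ++ true ∷ []) a
      ≡⟨ cong₂ _+_ (one false) (one true) ⟩
    ind (x ++ false ∷ []) (b ∷ a) + ind (x ++ true ∷ []) (b ∷ a) ∎
    where
    open ≡-Reasoning
    one : ∀ c → bit (answers x b a) * ind (x ++ c ∷ []) a ≡ ind (x ++ c ∷ []) (b ∷ a)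
    one c = trans (cong (λ t → bit t * ind (x ++ c ∷ []) a) (sym (answers-snoc x c b a (fresh q)))) (sym (bit-∧ (answers (x ++ c ∷ []) b a) (compatible (x ++ c ∷ []) a)))

  asked : ℕ → List Bool → ℕ
  asked n []      = 0
  asked n (b ∷ a) = bit (query a <ᵇ n) + asked n a

  times : ℕ → List Bool → ℕ
  times n []      = 0
  times n (b ∷ a) = bit (query a ≡ᵇ n) + times n a

  asked-suc : ∀ n a → asked (suc n) a ≡ asked n a + times n a
  asked-suc n []      = refl
  asked-suc n (b ∷ a) = trans (cong₂ _+_ (lemma (query a) n) (asked-suc n a)) (rearrange (bit (query a <ᵇ n)) (bit (query a ≡ᵇ n)) (asked n a) (times n a))
    where
    lemma : ∀ q n → bit (q <ᵇ suc n) ≡ bit (q <ᵇ n) + bit (q ≡ᵇ n)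
    lemma zero    zero    = refl
    lemma zero    (suc n) = refl
    lemma (suc q) zero    = refl
    lemma (suc q) (suc n) = lemma q n
    rearrange : ∀ a b c d → a + b + (c + d) ≡ (a + c) + (b + d)
    rearrange = solve-∀

  times-≤1 : ∀ n a → times n a ≤ 1
  times-≤1 n []      = z≤n
  times-≤1 n (b ∷ a) with query a ≟ n
  ... | no ne rewrite ≡ᵇ-false ne = times-≤1 n a
  ... | yes e rewrite e | ≡ᵇ-refl n = s≤s (≤-reflexive (none a (λ q → fresh q e)))
    where
    none : ∀ a → ¬ Queried n a → times n a ≡ 0
    none []      nq = refl
    none (b ∷ a) nq rewrite ≡ᵇ-false {query a} {n} (λ e → nq (here e)) = none a (nq ∘ there)

  asked-≤ : ∀ n a → asked n a ≤ n
  asked-≤ zero    a = ≤-reflexive (lemma a)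
    where
    lemma : ∀ a → asked 0 a ≡ 0
    lemma []      = refl
    lemma (b ∷ a) = lemma a
  asked-≤ (suc n) a = ≤-trans (≤-reflexive (asked-suc n a)) (≤-trans (+-mono-≤ (asked-≤ n a) (times-≤1 n a)) (≤-reflexive (+-comm n 1)))

  -- A query below `length x` admits only one of the two bits, and the doubled weight makes up for
  -- it; any other query admits both. As no query is repeated, weights are at most 2 ^ `length x`,
  -- which bounds the number of compatible strings from below.
  weighted : ∀ x m → sumStr m (λ a → ind x a * 2 ^ asked (length x) a) ≡ 2 ^ m
  weighted x zero    = refl
  weighted x (suc m) = trans (sumStr-cong m (λ a _ → step′ a)) (trans (sumStr-* m 2 (λ a → ind x a * 2 ^ asked (length x) a)) (cong (2 *_) (weighted x m)))
    where
    one : ∀ c → c ≤ 1 → bit (0 ≡ᵇ c) + bit (1 ≡ᵇ c) ≡ 1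
    one zero       _ = refl
    one (suc zero) _ = refl
    one (suc (suc _)) (s≤s ())
    rearrange : ∀ s s′ t u → s * t * u + s′ * t * u ≡ (s + s′) * (t * u)
    rearrange = solve-∀
    step′ : ∀ a → ind x (false ∷ a) * 2 ^ asked (length x) (false ∷ a) + ind x (true ∷ a) * 2 ^ asked (length x) (true ∷ a) ≡ 2 * (ind x a * 2 ^ asked (length x) a)
    step′ a with query a <? length x
    ... | yes lt rewrite forced-answer x false a lt | forced-answer x true a lt | <ᵇ-true lt
                       | bit-∧ (0 ≡ᵇ at x (query a)) (compatible x a) | bit-∧ (1 ≡ᵇ at x (query a)) (compatible x a)
          = trans (rearrange (bit (0 ≡ᵇ at x (query a))) (bit (1 ≡ᵇ at x (query a))) (ind x a) (2 ^ suc (asked (length x) a)))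
              (trans (cong (_* (ind x a * 2 ^ suc (asked (length x) a))) (one (at x (query a)) (at-≤1 x (query a)))) (lemma (ind x a) (2 ^ asked (length x) a)))
      where
      lemma : ∀ t u → 1 * (t * (2 * u)) ≡ 2 * (t * u)
      lemma = solve-∀
    ... | no ¬lt rewrite free-answer x false a (≮⇒≥ ¬lt) | free-answer x true a (≮⇒≥ ¬lt) | <ᵇ-false (≮⇒≥ ¬lt)
          = lemma (ind x a * 2 ^ asked (length x) a)
      where
      lemma : ∀ t → t + t ≡ 2 * t
      lemma = solve-∀

  count : ∀ x m → 2 ^ m ≤ sumStr m (ind x) * 2 ^ length x
  count x m = begin
    2 ^ m ≡⟨ weighted x m ⟨
    sumStr m (λ a → ind x a * 2 ^ asked (length x) a) ≤⟨ sumStr-mono m (λ a _ → *-monoʳ-≤ (ind x a) (^-monoʳ-≤ 2 (asked-≤ (length x) a))) ⟩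
    sumStr m (λ a → ind x a * 2 ^ length x) ≡⟨ sumStr-cong m (λ a _ → *-comm (ind x a) (2 ^ length x)) ⟩
    sumStr m (λ a → 2 ^ length x * ind x a) ≡⟨ sumStr-* m (2 ^ length x) (ind x) ⟩
    2 ^ length x * sumStr m (ind x) ≡⟨ *-comm (2 ^ length x) _ ⟩
    sumStr m (ind x) * 2 ^ length x ∎
    where open ≤-Reasoning

  module Average (g : ℕ → ℕ) (g-mono : ∀ {m n} → m ≤ n → g m ≤ g n) (filling : Filling g V)
                 (T : List Bool → ℕ) (T-fair : ∀ a → T (false ∷ a) + T (true ∷ a) ≡ 4 * T a) where

    -- `Filling` speaks of strings of length exactly `g n`; it is applied to the first `g n` bits of
    -- the run.
    filled : ∀ n a → g n ≤ length a → ∀ r → r < n → Queried r a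
    filled n a le r r<n = subst (λ s → Queried s a) e′ (queried a i (<-≤-trans i< (≤-trans (≤-reflexive len-α) le)))
      where
      len-α : length (take (g n) (reverse a)) ≡ g n
      len-α = trans (length-take (g n) (reverse a)) (m≤n⇒m⊓n≡m (subst (g n ≤_) (sym (length-reverse a)) le))
      found = filling n (take (g n) (reverse a)) len-α r r<n
      i = proj₁ found
      i< : i < length (take (g n) (reverse a))
      i< = proj₁ (proj₂ found)
      e′ : V (take i (reverse a)) ≡ r
      e′ = trans (cong V (sym (trans (take-take i (g n) (reverse a)) (cong (λ j → take j (reverse a)) (m≤n⇒m⊓n≡m (≤-trans (<⇒≤ i<) (≤-reflexive len-α))))))) (proj₂ (proj₂ found))

    total : List Bool → ℕ → ℕ
    total x m = sumStr m (λ a → ind x a * T a)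

    total-suc : ∀ x m → g (length x) ≤ m → total x (suc m) ≡ 4 * total x m
    total-suc x m le = trans (sumStr-cong m (λ a l → step′ a (≤-trans le (≤-reflexive (sym l))))) (sumStr-* m 4 (λ a → ind x a * T a))
      where
      late : ∀ a → g (length x) ≤ length a → length x ≤ query a
      late a le′ with query a <? length x
      ... | yes lt = contradiction refl (fresh (filled (length x) a le′ (query a) lt))
      ... | no ¬lt = ≮⇒≥ ¬lt
      lemma : ∀ t u → t * (4 * u) ≡ 4 * (t * u)
      lemma = solve-∀
      step′ : ∀ a → g (length x) ≤ length a → ind x (false ∷ a) * T (false ∷ a) + ind x (true ∷ a) * T (true ∷ a) ≡ 4 * (ind x a * T a)
      step′ a le′ rewrite free-answer x false a (late a le′) | free-answer x true a (late a le′) =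
        trans (sym (*-distribˡ-+ (ind x a) _ _)) (trans (cong (ind x a *_) (T-fair a)) (lemma (ind x a) (T a)))

    total-+ : ∀ x d → total x (d + g (length x)) ≡ 4 ^ d * total x (g (length x))
    total-+ x zero    = sym (*-identityˡ _)
    total-+ x (suc d) = trans (total-suc x (d + g (length x)) (m≤n+m _ d)) (trans (cong (4 *_) (total-+ x d)) (sym (*-assoc 4 (4 ^ d) _)))

    -- The quotient of `total x m` and 4 ^ m does not change from `g (length x)` on; stated without
    -- division.
    total-late : ∀ x m → g (length x) ≤ m → total x m * 4 ^ g (length x) ≡ 4 ^ m * total x (g (length x))
    total-late x m le = begin
      total x m * 4 ^ G ≡⟨ cong (λ k → total x k * 4 ^ G) (m∸n+n≡m le) ⟨
      total x (m ∸ G + G) * 4 ^ G ≡⟨ cong (_* 4 ^ G) (total-+ x (m ∸ G)) ⟩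
      4 ^ (m ∸ G) * total x G * 4 ^ G ≡⟨ lemma (4 ^ (m ∸ G)) (total x G) (4 ^ G) ⟩
      4 ^ (m ∸ G) * 4 ^ G * total x G ≡⟨ cong (_* total x G) (^-distribˡ-+-* 4 (m ∸ G) G) ⟨
      4 ^ (m ∸ G + G) * total x G ≡⟨ cong (λ k → 4 ^ k * total x G) (m∸n+n≡m le) ⟩
      4 ^ m * total x G ∎
      where
      open ≡-Reasoning
      G = g (length x)
      lemma : ∀ a b c → a * b * c ≡ a * c * b
      lemma = solve-∀

    total-split : ∀ x m → g (suc (length x)) ≤ m → total x m ≡ total (x ++ false ∷ []) m + total (x ++ true ∷ []) m
    total-split x m le = trans (sumStr-cong m (λ a l → trans (cong (_* T a) (ind-split x a (filled (suc (length x)) a (≤-trans le (≤-reflexive (sym l))) (length x) ≤-refl)))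
                                                            (*-distribʳ-+ (T a) (ind (x ++ false ∷ []) a) (ind (x ++ true ∷ []) a))))
                               (sumStr-+ m (λ a → ind (x ++ false ∷ []) a * T a) (λ a → ind (x ++ true ∷ []) a * T a))

    total-≥ : ∀ x m c → (∀ a → length a ≡ m → compatible x a ≡ true → c ≤ T a) → 2 ^ m * c ≤ total x m * 2 ^ length x
    total-≥ x m c le = begin
      2 ^ m * c ≤⟨ *-monoˡ-≤ c (count x m) ⟩
      sumStr m (ind x) * 2 ^ length x * c ≡⟨ lemma (sumStr m (ind x)) (2 ^ length x) c ⟩
      c * sumStr m (ind x) * 2 ^ length x ≡⟨ cong (_* 2 ^ length x) (sumStr-* m c (ind x)) ⟨
      sumStr m (λ a → c * ind x a) * 2 ^ length x ≤⟨ *-monoˡ-≤ (2 ^ length x) (sumStr-mono m pointwise) ⟩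
      total x m * 2 ^ length x ∎
      where
      open ≤-Reasoning
      lemma : ∀ a b c → a * b * c ≡ c * a * b
      lemma = solve-∀
      pointwise : ∀ a → length a ≡ m → c * ind x a ≤ ind x a * T a
      pointwise a l with compatible x a in eq
      ... | false = ≤-reflexive (*-zeroʳ c)
      ... | true  = ≤-trans (≤-reflexive (*-identityʳ c)) (≤-trans (le a l eq) (≤-reflexive (sym (+-identityʳ (T a)))))

-- Fractions

open ℤ using (+_)
open ℚᵘ using (mkℚᵘ; *≡*; *<*)

opaque
  frac : ℕ → ℕ → ℚ
  frac A B = ℚ′.fromℚᵘ (mkℚᵘ (+ A) (pred B))

  toℚᵘ-frac : ∀ A B → 0 < B → ∃ λ d → B ≡ suc d × ℚ′.toℚᵘ (frac A B) ℚᵘ.≃ mkℚᵘ (+ A) d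
  toℚᵘ-frac A (suc d) _ = d , refl , ℚP.toℚᵘ-fromℚᵘ (mkℚᵘ (+ A) d)

pos-numerator : ∀ {q} → ℚ′.0ℚ ℚ′.< q → ℚ.numerator q ≡ + ∣ ℚ.numerator q ∣
pos-numerator {ℚ′.mkℚ (+ n) d c}        _ = refl
pos-numerator {ℚ′.mkℚ (ℤ.-[1+ n ]) d c} (ℚ′.*<* ())

average-ℕ : ∀ {p q r} → ℚ′.0ℚ ℚ′.< p → ℚ′.0ℚ ℚ′.< q → ℚ′.0ℚ ℚ′.< r → p ≡ (q ℚ′.+ r) ℚ′.* ℚ′.½ →
  2 * ∣ ℚ.numerator p ∣ * (ℚ.denominatorℕ q * ℚ.denominatorℕ r) ≡
  (∣ ℚ.numerator q ∣ * ℚ.denominatorℕ r + ∣ ℚ.numerator r ∣ * ℚ.denominatorℕ q) * ℚ.denominatorℕ p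
average-ℕ {p@(ℚ′.mkℚ _ _ _)} {q@(ℚ′.mkℚ _ _ _)} {r@(ℚ′.mkℚ _ _ _)} p>0 q>0 r>0 e = ℤP.+-injective (begin
  + (2 * P * (Q * W)) ≡⟨ cong +_ (lemma P Q W) ⟩
  + (P * (Q * W * 2)) ≡⟨ ℤP.pos-* P (Q * W * 2) ⟩
  + P ℤ.* + (Q * W * 2) ≡⟨ cong (ℤ._* + (Q * W * 2)) (sym (pos-numerator p>0)) ⟩
  ℚ.numerator p ℤ.* + (Q * W * 2) ≡⟨ unwrap eq ⟩
  (ℚ.numerator q ℤ.* + W ℤ.+ ℚ.numerator r ℤ.* + Q) ℤ.* + 1 ℤ.* + D
      ≡⟨ cong (ℤ._* + D) (ℤP.*-identityʳ (ℚ.numerator q ℤ.* + W ℤ.+ ℚ.numerator r ℤ.* + Q)) ⟩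
  (ℚ.numerator q ℤ.* + W ℤ.+ ℚ.numerator r ℤ.* + Q) ℤ.* + D
      ≡⟨ cong₂ (λ x y → (x ℤ.* + W ℤ.+ y ℤ.* + Q) ℤ.* + D) (pos-numerator q>0) (pos-numerator r>0) ⟩
  (+ S ℤ.* + W ℤ.+ + U ℤ.* + Q) ℤ.* + D ≡⟨ cong₂ (λ x y → (x ℤ.+ y) ℤ.* + D) (ℤP.pos-* S W) (ℤP.pos-* U Q) ⟨
  + (S * W + U * Q) ℤ.* + D ≡⟨ ℤP.pos-* (S * W + U * Q) D ⟨
  + ((S * W + U * Q) * D) ∎)
  where
  open ≡-Reasoning
  P = ∣ ℚ.numerator p ∣
  S = ∣ ℚ.numerator q ∣
  U = ∣ ℚ.numerator r ∣
  D = ℚ.denominatorℕ p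
  Q = ℚ.denominatorℕ q
  W = ℚ.denominatorℕ r
  lemma : ∀ p q r → 2 * p * (q * r) ≡ p * (q * r * 2)
  lemma = solve-∀
  eq : ℚ′.toℚᵘ p ℚᵘ.≃ (ℚ′.toℚᵘ q ℚᵘ.+ ℚ′.toℚᵘ r) ℚᵘ.* ℚ′.toℚᵘ ℚ′.½
  eq = ℚᵘP.≃-trans (ℚP.toℚᵘ-cong e) (ℚᵘP.≃-trans (ℚP.toℚᵘ-homo-* (q ℚ′.+ r) ℚ′.½) (ℚᵘP.*-cong (ℚP.toℚᵘ-homo-+ q r) ℚᵘP.≃-refl))
  unwrap : ℚ′.toℚᵘ p ℚᵘ.≃ (ℚ′.toℚᵘ q ℚᵘ.+ ℚ′.toℚᵘ r) ℚᵘ.* ℚ′.toℚᵘ ℚ′.½ →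
           ℚ.numerator p ℤ.* + (Q * W * 2) ≡ (ℚ.numerator q ℤ.* + W ℤ.+ ℚ.numerator r ℤ.* + Q) ℤ.* + 1 ℤ.* + D
  unwrap (*≡* x) = x

frac-average : ∀ {A B A′ A″ B′} → 0 < B → 0 < B′ → A * (B′ * 2) ≡ (A′ + A″) * B →
               frac A B ≡ (frac A′ B′ ℚ′.+ frac A″ B′) ℚ′.* ℚ′.½
frac-average {A} {B} {A′} {A″} {B′} B>0 B′>0 e with toℚᵘ-frac A B B>0 | toℚᵘ-frac A′ B′ B′>0 | toℚᵘ-frac A″ B′ B′>0
... | d , refl , p | d′ , refl , q | .d′ , refl , r = ℚP.toℚᵘ-injective (ℚᵘP.≃-trans p (ℚᵘP.≃-sym
  (ℚᵘP.≃-trans (ℚP.toℚᵘ-homo-* (frac A′ B′ ℚ′.+ frac A″ B′) ℚ′.½)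
    (ℚᵘP.≃-trans (ℚᵘP.*-cong (ℚᵘP.≃-trans (ℚP.toℚᵘ-homo-+ (frac A′ B′) (frac A″ B′)) (ℚᵘP.+-cong q r)) ℚᵘP.≃-refl) (*≡* eq)))))
  where
  open ≡-Reasoning
  lemma₁ : ∀ x y b c → (x * c + y * c) * 1 * b ≡ (x + y) * b * c
  lemma₁ = solve-∀
  lemma₂ : ∀ a c → a * (c * 2) * c ≡ a * (c * c * 2)
  lemma₂ = solve-∀
  eq : (+ A′ ℤ.* + suc d′ ℤ.+ + A″ ℤ.* + suc d′) ℤ.* + 1 ℤ.* + suc d ≡ + A ℤ.* + (suc d′ * suc d′ * 2)
  eq = begin
    (+ A′ ℤ.* + suc d′ ℤ.+ + A″ ℤ.* + suc d′) ℤ.* + 1 ℤ.* + suc d ≡⟨ cong₂ (λ x y → (x ℤ.+ y) ℤ.* + 1 ℤ.* + suc d) (ℤP.pos-* A′ (suc d′)) (ℤP.pos-* A″ (suc d′)) ⟨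
    + (A′ * suc d′ + A″ * suc d′) ℤ.* + 1 ℤ.* + suc d ≡⟨ cong (ℤ._* + suc d) (ℤP.pos-* (A′ * suc d′ + A″ * suc d′) 1) ⟨
    + ((A′ * suc d′ + A″ * suc d′) * 1) ℤ.* + suc d ≡⟨ ℤP.pos-* ((A′ * suc d′ + A″ * suc d′) * 1) (suc d) ⟨
    + ((A′ * suc d′ + A″ * suc d′) * 1 * suc d) ≡⟨ cong +_ (trans (lemma₁ A′ A″ (suc d) (suc d′)) (trans (cong (_* suc d′) (sym e)) (lemma₂ A (suc d′)))) ⟩
    + (A * (suc d′ * suc d′ * 2)) ≡⟨ ℤP.pos-* A (suc d′ * suc d′ * 2) ⟩
    + A ℤ.* + (suc d′ * suc d′ * 2) ∎

-- A rational is at most the absolute value of its numerator.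
frac-> : ∀ c {A B K} → 0 < B → ∣ ℚ.numerator c ∣ < K → K * B ≤ A → c ℚ′.< frac A B
frac-> c {A} {B} {K} B>0 lt le with toℚᵘ-frac A B B>0
frac-> c@(ℚ′.mkℚ n m _) {A} {B} {K} B>0 lt le | d , refl , p = ℚP.toℚᵘ-cancel-< (ℚᵘP.<-respʳ-≃ (ℚᵘP.≃-sym p) (*<* (ℤP.≤-<-trans
  (ℤP.*-monoʳ-≤-nonNeg (+ suc d) (below n))
  (subst₂ ℤ._<_ (ℤP.pos-* ∣ n ∣ (suc d)) (ℤP.pos-* A (suc m)) (ℤ.+<+ (<-≤-trans (*-monoˡ-< (suc d) lt) (≤-trans le (m≤m*n A (suc m)))))))))
  where
  below : ∀ n → n ℤ.≤ + ∣ n ∣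
  below (+ n)        = ℤP.≤-refl
  below (ℤ.-[1+ n ]) = ℤ.-≤+

frac-positive : ∀ {A B} → 0 < B → 0 < A → ℚ′.0ℚ ℚ′.< frac A B
frac-positive {A} {B} B>0 A>0 with toℚᵘ-frac A B B>0
... | d , refl , p = ℚP.toℚᵘ-cancel-< (ℚᵘP.<-respʳ-≃ (ℚᵘP.≃-sym p) (*<* (subst (ℤ._< + A ℤ.* + 1) (sym (ℤP.*-zeroˡ (+ suc d))) (subst (+ 0 ℤ.<_) (ℤP.pos-* A 1) (ℤ.+<+ (≤-trans A>0 (≤-reflexive (sym (*-identityʳ A)))))))))

frac-<⁻¹ : ∀ {K q} → ℚ′.0ℚ ℚ′.< q → frac K 1 ℚ′.< q → K * ℚ.denominatorℕ q ≤ ∣ ℚ.numerator q ∣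
frac-<⁻¹ {K} {q@(ℚ′.mkℚ n d _)} q>0 lt with toℚᵘ-frac K 1 (s≤s z≤n)
... | .0 , refl , p with ℚᵘP.<-respˡ-≃ p (ℚP.toℚᵘ-mono-< lt)
...   | *<* lt′ = <⇒≤ (ℤP.drop‿+<+ (subst₂ ℤ._<_ (sym (ℤP.pos-* K (suc d))) (trans (ℤP.*-identityʳ n) (pos-numerator q>0)) lt′))

frac-lowest : ∀ A B → 0 < B → ∣ ℚ.numerator (frac A B) ∣ * B ≡ A * ℚ.denominatorℕ (frac A B)
frac-lowest A B B>0 with toℚᵘ-frac A B B>0
... | d , refl , p = unwrap (frac A (suc d)) p
  where
  unwrap : ∀ q → ℚ′.toℚᵘ q ℚᵘ.≃ mkℚᵘ (+ A) d → ∣ ℚ.numerator q ∣ * suc d ≡ A * ℚ.denominatorℕ q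
  unwrap q@(ℚ′.mkℚ n m _) (*≡* e) = trans (sym (ℤP.abs-* n (+ suc d))) (trans (cong ∣_∣ e) (ℤP.abs-* (+ A) (+ suc m)))

ℚ-coprime : ∀ q → Coprime ∣ ℚ.numerator q ∣ (ℚ.denominatorℕ q)
ℚ-coprime (ℚ′.mkℚ n d c) = recompute-coprime c

-- The denominator in lowest terms is the least z > 0 with B ∣ A * z.
lowDen lowNum : ℕ → ℕ → ℕ
lowDen A B = suc (find (λ z → rem (A * suc z) B ≡ᵇ 0) B)
lowNum A B = quot (A * lowDen A B) B

lowDen₂ : PS₂ lowDen
lowDen₂ = sucᵖ (findᵖ (remᵖ (varᵖ 1F *ᵖ sucᵖ (varᵖ 0F)) (varᵖ 2F) ≡ᵖ constᵖ 0) (varᵖ 1F))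

lowNum₂ : PS₂ lowNum
lowNum₂ = quotᵖ (varᵖ 0F *ᵖ app₂ lowDen lowDen₂ (varᵖ 0F) (varᵖ 1F)) (varᵖ 1F)

-- With num / den the lowest terms of A / B, A * den = num * B, so den passes the test. Conversely,
-- if B divides A * z, then den divides num * z, hence z by coprimality; with z = B the same
-- argument shows that den is within the search bound.
lowDen-frac : ∀ A B → 0 < B → lowDen A B ≡ ℚ.denominatorℕ (frac A B)
lowDen-frac A B B>0 = cong suc (find-least (λ z → rem (A * suc z) B ≡ᵇ 0) {ℚ.denominator-1 q}
  (cong (_≡ᵇ 0) (trans (cong (λ z → rem z B) (sym e)) (proj₂ (quot-rem 0 ∣ ℚ.numerator q ∣ B>0))))
  (λ i i< → ≡ᵇ-false (λ r → <⇒≱ (s≤s i<) (∣⇒≤ (coprime-divisor (coprime-sym (ℚ-coprime q)) (divisor i r)))))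
  (∣⇒≤ {{>-nonZero B>0}} (coprime-divisor (coprime-sym (ℚ-coprime q)) (divides A e))))
  where
  open ≡-Reasoning
  q = frac A B
  e = frac-lowest A B B>0
  lemma : ∀ a b c → a * b * c ≡ a * c * b
  lemma = solve-∀
  divisor : ∀ i → rem (A * suc i) B ≡ 0 → ℚ.denominatorℕ q ∣ ∣ ℚ.numerator q ∣ * suc i
  divisor i r = divides t (*-cancelʳ-≡ _ _ B {{>-nonZero B>0}} (begin
    ∣ ℚ.numerator q ∣ * suc i * B ≡⟨ lemma ∣ ℚ.numerator q ∣ (suc i) B ⟩
    ∣ ℚ.numerator q ∣ * B * suc i ≡⟨ cong (_* suc i) e ⟩
    A * ℚ.denominatorℕ q * suc i ≡⟨ lemma A (ℚ.denominatorℕ q) (suc i) ⟩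
    A * suc i * ℚ.denominatorℕ q ≡⟨ cong (_* ℚ.denominatorℕ q) exact ⟩
    t * B * ℚ.denominatorℕ q ≡⟨ lemma t B (ℚ.denominatorℕ q) ⟩
    t * ℚ.denominatorℕ q * B ∎))
    where
    t = quot (A * suc i) B
    rem-def : A * suc i ∸ t * B ≡ rem (A * suc i) B
    rem-def = rem-∸ (A * suc i) B
    exact : A * suc i ≡ t * B
    exact = trans (sym (m∸n+n≡m (proj₁ (quot-bounds (A * suc i) B B>0)))) (cong (_+ t * B) (trans rem-def r))

lowNum-frac : ∀ A B → 0 < B → lowNum A B ≡ ∣ ℚ.numerator (frac A B) ∣
lowNum-frac A B B>0 = trans (cong (λ z → quot (A * z) B) (lowDen-frac A B B>0))
  (trans (cong (λ z → quot z B) (sym (frac-lowest A B B>0))) (proj₁ (quot-rem 0 ∣ ℚ.numerator (frac A B) ∣ B>0)))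

-- The transformed martingale

4^-square : ∀ n → 4 ^ n ≡ 2 ^ n * 2 ^ n
4^-square zero    = refl
4^-square (suc n) = trans (cong (4 *_) (4^-square n)) (lemma (2 ^ n))
  where
  lemma : ∀ e → 4 * (e * e) ≡ 2 * e * (2 * e)
  lemma = solve-∀

sumTo-double : ∀ h n → sumTo h (n + n) ≡ sumTo (λ j → h (j + j) + h (suc (j + j))) n
sumTo-double h zero    = refl
sumTo-double h (suc n) rewrite +-suc n n | sumTo-double h n = +-assoc (sumTo (λ j → h (j + j) + h (suc (j + j))) n) (h (n + n)) (h (suc (n + n)))

sumTo-cong : ∀ {h h′} n → (∀ j → h j ≡ h′ j) → sumTo h n ≡ sumTo h′ n
sumTo-cong zero    e = refl
sumTo-cong (suc n) e = cong₂ _+_ (sumTo-cong n e) (e n)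

-- The strings of length m are the numerals of 2 ^ m - 1, …, 2 ^ suc m - 2.
sumStr-sumTo : ∀ m f → sumStr m f ≡ sumTo (λ j → f (str (2 ^ m ∸ 1 + j))) (2 ^ m)
sumStr-sumTo zero    f = refl
sumStr-sumTo (suc m) f = begin
  sumStr m (λ a → f (false ∷ a) + f (true ∷ a)) ≡⟨ sumStr-sumTo m _ ⟩
  sumTo (λ j → f (false ∷ str (c + j)) + f (true ∷ str (c + j))) (2 ^ m) ≡⟨ sumTo-cong (2 ^ m) (λ j → sym (cong₂ _+_ (cong f (odd j)) (cong f (even j)))) ⟩
  sumTo (λ j → f (str (2 ^ suc m ∸ 1 + (j + j))) + f (str (2 ^ suc m ∸ 1 + suc (j + j)))) (2 ^ m) ≡⟨ sumTo-double (λ j → f (str (2 ^ suc m ∸ 1 + j))) (2 ^ m) ⟨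
  sumTo (λ j → f (str (2 ^ suc m ∸ 1 + j))) (2 ^ m + 2 ^ m) ≡⟨ cong (sumTo (λ j → f (str (2 ^ suc m ∸ 1 + j)))) (sym (2^-double m)) ⟩
  sumTo (λ j → f (str (2 ^ suc m ∸ 1 + j))) (2 ^ suc m) ∎
  where
  open ≡-Reasoning
  c = 2 ^ m ∸ 1
  suc-c : 2 ^ m ≡ suc c
  suc-c = sym (m+[n∸m]≡n (m^n>0 2 m))
  lemma : ∀ c j → c + suc c + (j + j) ≡ suc ((c + j) + (c + j))
  lemma = solve-∀
  start-odd : ∀ j → 2 ^ suc m ∸ 1 + (j + j) ≡ suc ((c + j) + (c + j))
  start-odd j = trans (cong (λ z → z ∸ 1 + (j + j)) (trans (2^-double m) (cong₂ _+_ suc-c suc-c))) (lemma c j)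
  odd : ∀ j → str (2 ^ suc m ∸ 1 + (j + j)) ≡ false ∷ str (c + j)
  odd j = trans (cong str (start-odd j)) (str-odd (c + j))
  even : ∀ j → str (2 ^ suc m ∸ 1 + suc (j + j)) ≡ true ∷ str (c + j)
  even j = trans (cong str (+-suc (2 ^ suc m ∸ 1) (j + j))) (cong incS (odd j))

at-applyUpTo : ∀ Z {n r} → r < n → at (applyUpTo Z n) r ≡ bit (Z r)
at-applyUpTo Z {suc n} {zero}  _       = refl
at-applyUpTo Z {suc n} {suc r} (s≤s p) = at-applyUpTo (Z ∘ suc) p

at-↾ : ∀ Z {n r} → r < n → at (Z ↾ n) r ≡ bit (Z r)
at-↾ Z {n} {r} p = trans (cong (λ w → at w r) (map-upTo Z n)) (at-applyUpTo Z p)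

length-↾ : ∀ Z n → length (Z ↾ n) ≡ n
length-↾ Z n = trans (length-map Z (upTo n)) (length-upTo n)

↾-∘ˢ : ∀ Z V n → (Z ∘ˢ V) ↾ n ≡ prefixY Z V n
↾-∘ˢ Z V zero    = refl
↾-∘ˢ Z V (suc n) = trans (cong (map (Z ∘ˢ V)) (sym (upTo-∷ʳ n))) (trans (map-++ (Z ∘ˢ V) (upTo n) (n ∷ [])) (cong (_++ (Z ∘ˢ V) n ∷ []) (↾-∘ˢ Z V n)))

module Transform (V : List Bool → ℕ) (scanning : IsScanning V) (V-computable : PSpaceComputable encBits length encUnary V)
  (g : Poly) (filling : Filling (evalPoly g) V)
  (N : List Bool → ℚ) (N-martingale : IsMartingale N) (N-computable : PSpaceComputable encBits length encℚ N) where

  open Scan V scanning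

  P Q : List Bool → ℕ
  P a = ∣ ℚ.numerator (N (reverse a)) ∣
  Q a = ℚ.denominatorℕ (N (reverse a))

  fair : ∀ a → 2 * P a * (Q (false ∷ a) * Q (true ∷ a)) ≡ (P (false ∷ a) * Q (true ∷ a) + P (true ∷ a) * Q (false ∷ a)) * Q a
  fair a = average-ℕ (proj₁ N-martingale (reverse a)) (proj₁ N-martingale (reverse (false ∷ a))) (proj₁ N-martingale (reverse (true ∷ a)))
    (trans (proj₂ N-martingale (reverse a)) (cong₂ (λ x y → (N x ℚ′.+ N y) ℚ′.* ℚ′.½) (sym (unfold-reverse false a)) (sym (unfold-reverse true a))))

  open Savings P Q (λ a → s≤s z≤n) fair
  open Average (evalPoly g) (evalPoly-mono g) filling capital capital-fair

  -- For n = `length x` and G = g(n) there are 2 ^ (G - n) compatible strings of length G, and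
  -- `capital` carries the factor 2 ^ G. The average is therefore the total times 2 ^ n over 4 ^ G.
  upper lower : List Bool → ℕ
  upper x = total x (evalPoly g (length x)) * 2 ^ length x
  lower x = 4 ^ evalPoly g (length x)

  D : List Bool → ℚ
  D x = frac (upper x) (lower x)

  lower>0 : ∀ x → 0 < lower x
  lower>0 x = m^n>0 4 (evalPoly g (length x))

  upper>0 : ∀ x → 0 < upper x
  upper>0 x = ≤-trans (m^n>0 2 G) (≤-trans (≤-reflexive (sym (*-identityʳ (2 ^ G)))) (total-≥ x G 1 (λ a _ _ → capital-pos a)))
    where G = evalPoly g (length x)

  D-average : ∀ x → D x ≡ (D (x ++ false ∷ []) ℚ′.+ D (x ++ true ∷ [])) ℚ′.* ℚ′.½
  D-average x = trans (frac-average {upper x} {lower x} {total (x ++ false ∷ []) G′ * 2 ^ suc n} {total (x ++ true ∷ []) G′ * 2 ^ suc n} {4 ^ G′} (lower>0 x) (m^n>0 4 G′) eq)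
    (cong₂ (λ p q → (p ℚ′.+ q) ℚ′.* ℚ′.½) (sym (same false)) (sym (same true)))
    where
    open ≡-Reasoning
    n = length x
    G = evalPoly g n
    G′ = evalPoly g (suc n)
    same : ∀ c → D (x ++ c ∷ []) ≡ frac (total (x ++ c ∷ []) G′ * 2 ^ suc n) (4 ^ G′)
    same c = cong (λ l → frac (total (x ++ c ∷ []) (evalPoly g l) * 2 ^ l) (4 ^ evalPoly g l)) (length-snoc x c)
    lemma₁ : ∀ t e f → t * e * (f * 2) ≡ f * t * (2 * e)
    lemma₁ = solve-∀
    lemma₂ : ∀ s t e f → (s + t) * f * e ≡ (s * e + t * e) * f
    lemma₂ = solve-∀
    eq : upper x * (4 ^ G′ * 2) ≡ (total (x ++ false ∷ []) G′ * 2 ^ suc n + total (x ++ true ∷ []) G′ * 2 ^ suc n) * lower x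
    eq = begin
      total x G * 2 ^ n * (4 ^ G′ * 2) ≡⟨ lemma₁ (total x G) (2 ^ n) (4 ^ G′) ⟩
      4 ^ G′ * total x G * 2 ^ suc n ≡⟨ cong (_* 2 ^ suc n) (total-late x G′ (evalPoly-mono g (n≤1+n n))) ⟨
      total x G′ * 4 ^ G * 2 ^ suc n ≡⟨ cong (λ t → t * 4 ^ G * 2 ^ suc n) (total-split x G′ ≤-refl) ⟩
      (total (x ++ false ∷ []) G′ + total (x ++ true ∷ []) G′) * 4 ^ G * 2 ^ suc n
      ≡⟨ lemma₂ (total (x ++ false ∷ []) G′) (total (x ++ true ∷ []) G′) (2 ^ suc n) (4 ^ G) ⟩
      (total (x ++ false ∷ []) G′ * 2 ^ suc n + total (x ++ true ∷ []) G′ * 2 ^ suc n) * 4 ^ G ∎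

  D-martingale : IsMartingale D
  D-martingale = (λ x → frac-positive {upper x} {lower x} (lower>0 x) (upper>0 x)) , D-average

  -- Space complexity of the new martingale

  floorᵖ : ∀ {n c e} → PS n c → PS n e → Tiny e → PS n (λ v → floor (str (c v)) (e v))
  floorᵖ C E small = quotᵖ (pow2ᵖ E small *ᵖ app₁ num num₁ C) (app₁ den den₁ C)
    where open Rational (proj₂ (proj₂ N-computable))

  saved₁ : PS₁ (λ a → saved (str a))
  saved₁ = ext (λ { (a ∷ []) → correct (str a) }) (listrecᵖ zeroᵖ S X (λ b w v sm → bd b w v (sm 0F)))
    where
    s : Vec ℕ 3 → ℕ
    -- The arguments are the new bit, the code of the tail and the value at the tail; the successor
    -- of bit plus twice the code is the code of the whole string.
    s v = if floor (str (suc (lookup v 0F + 2 * lookup v 1F))) (len (lookup v 1F) ∸ lookup v 2F) <ᵇ 2 ^ len (lookup v 1F) * 2 ^ c₀ then lookup v 2F else suc (lookup v 2F)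
    S : PS 3 s
    S = ifᵖ (floorᵖ (sucᵖ (varᵖ 0F +ᵖ constᵖ 2 *ᵖ varᵖ 1F)) (lenᵖ (varᵖ 1F) ∸ᵖ varᵖ 2F) (tiny-≤ (λ v → m∸n≤m (len (lookup v 1F)) (lookup v 2F)) (tiny-len (varᵖ 1F)))
              <ᵖ (pow2ᵖ (lenᵖ (varᵖ 1F)) (tiny-len (varᵖ 1F)) *ᵖ constᵖ (2 ^ c₀)))
            (varᵖ 2F) (sucᵖ (varᵖ 2F))
    correct : ∀ w {v} → listrec (λ _ → 0) s w v ≡ saved w
    correct []      = refl
    correct (b ∷ w) {v} rewrite correct w {v} | len-val w | str-val (b ∷ w) | sym (^-distribˡ-+-* 2 (length w) c₀) = refl
    bd : ∀ b w v → val w < 2 ^ b → listrec (λ _ → 0) s w v < 2 ^ b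
    bd b w v lt = ≤-<-trans (≤-reflexive (correct w)) (≤-<-trans (saved-≤ w) (≤-<-trans (subst (λ l → length l ≤ b) (str-val w) (∣∣₂-≤ lt)) (n<2^n b)))

  capital₁ : PS₁ (λ a → capital (str a))
  capital₁ = ext (λ { (a ∷ []) → correct (str a) }) (listrecᵖ (constᵖ (capital [])) S (con 2 ⊗ X ⊕ con (capital [])) (λ b w v sm → bd b w v (sm 0F)))
    where
    s : Vec ℕ 3 → ℕ
    s v = 2 * lookup v 2F + floor (str (suc (lookup v 0F + 2 * lookup v 1F))) (len (lookup v 1F) ∸ saved (str (lookup v 1F)))
          ∸ floor (str (suc (1 ∸ lookup v 0F + 2 * lookup v 1F))) (len (lookup v 1F) ∸ saved (str (lookup v 1F)))
    E : PS 3 (λ v → len (lookup v 1F) ∸ saved (str (lookup v 1F)))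
    E = lenᵖ (varᵖ 1F) ∸ᵖ app₁ (λ a → saved (str a)) saved₁ (varᵖ 1F)
    E-tiny : Tiny {3} (λ v → len (lookup v 1F) ∸ saved (str (lookup v 1F)))
    E-tiny = tiny-≤ (λ v → m∸n≤m (len (lookup v 1F)) (saved (str (lookup v 1F)))) (tiny-len (varᵖ 1F))
    S : PS 3 s
    S = constᵖ 2 *ᵖ varᵖ 2F +ᵖ floorᵖ (sucᵖ (varᵖ 0F +ᵖ constᵖ 2 *ᵖ varᵖ 1F)) E E-tiny
        ∸ᵖ floorᵖ (sucᵖ (constᵖ 1 ∸ᵖ varᵖ 0F +ᵖ constᵖ 2 *ᵖ varᵖ 1F)) E E-tiny
    bit-not : ∀ b → 1 ∸ bit b ≡ bit (not b)
    bit-not false = refl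
    bit-not true  = refl
    correct : ∀ w {v} → listrec (λ _ → capital []) s w v ≡ capital w
    correct []      = refl
    correct (b ∷ w) {v} rewrite correct w {v} | len-val w | str-val (b ∷ w) | bit-not b | str-val (not b ∷ w) | str-val w = refl
    bd : ∀ b w v → val w < 2 ^ b → listrec (λ _ → capital []) s w v < 2 ^ (2 * b + capital [])
    bd b w v lt = begin-strict
      listrec (λ _ → capital []) s w v ≡⟨ correct w ⟩
      capital w ≤⟨ capital-≤ w ⟩
      4 ^ length w * capital [] ≤⟨ *-monoˡ-≤ (capital []) (^-monoʳ-≤ 4 (subst (λ l → length l ≤ b) (str-val w) (∣∣₂-≤ lt))) ⟩
      4 ^ b * capital [] <⟨ *-monoʳ-< (4 ^ b) {{>-nonZero (m^n>0 4 b)}} (n<2^n (capital [])) ⟩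
      4 ^ b * 2 ^ capital [] ≡⟨ cong (_* 2 ^ capital []) (^-*-assoc 2 2 b) ⟩
      2 ^ (2 * b) * 2 ^ capital [] ≡⟨ ^-distribˡ-+-* 2 (2 * b) (capital []) ⟨
      2 ^ (2 * b + capital []) ∎
      where open ≤-Reasoning

  ind₂ : PS₂ (λ a x → ind (str x) (str a))
  ind₂ = ext (λ { (a ∷ x ∷ []) → correct (str a) x }) (listrecᵖ (constᵖ 1) S (con 1) (λ { b w (x ∷ []) sm → bd w x }))
    where
    s : Vec ℕ 4 → ℕ
    s v = (if query (str (lookup v 1F)) <ᵇ len (lookup v 3F) then bit (lookup v 0F ≡ᵇ nth (query (str (lookup v 1F))) (lookup v 3F)) else 1) * lookup v 2F
    q : PS 4 (λ v → query (str (lookup v 1F)))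
    q = app₁ (λ a → query (str a)) (unary-PS V-computable) (varᵖ 1F)
    S : PS 4 s
    S = ifᵖ (q <ᵖ lenᵖ (varᵖ 3F)) (varᵖ 0F ≡ᵖ app₂ nth nth₂ q (varᵖ 3F)) (constᵖ 1) *ᵖ varᵖ 2F
    nth-str : ∀ i x → nth i x ≡ at (str x) i
    nth-str i x = trans (cong (nth i) (sym (val-str x))) (nth-val i (str x))
    correct : ∀ w x → listrec (λ _ → 1) s w (x ∷ []) ≡ ind (str x) w
    correct []      x = refl
    correct (b ∷ w) x rewrite correct w x | str-val w | len-str x | nth-str (query w) x
      | bit-∧ (answers (str x) b w) (compatible (str x) w) = cong (_* ind (str x) w) (bit-if (query w <ᵇ length (str x)) (bit b ≡ᵇ at (str x) (query w)))
      where
      bit-if : ∀ t u → (if t then bit u else 1) ≡ bit (if t then u else true)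
      bit-if false u = refl
      bit-if true  u = refl
    bd : ∀ w x → listrec (λ _ → 1) s w (x ∷ []) < 2
    bd w x = ≤-<-trans (≤-reflexive (correct w x)) (bit<2 (compatible (str x) w))

  -- The number of summands in `upper`; its square is `lower`.
  side₁ : PS₁ (λ x → 2 ^ evalPoly g (len x))
  side₁ = pow2ᵖ (polyᵖ g (lenᵖ (varᵖ 0F))) (tiny-poly g (tiny-len (varᵖ 0F)))

  lower₁ : PS₁ (λ x → lower (str x))
  lower₁ = ext (λ v → trans (sym (4^-square (evalPoly g (len (lookup v 0F))))) (cong (λ l → 4 ^ evalPoly g l) (len-str (lookup v 0F)))) (side₁ *ᵖ side₁)

  upper₁ : PS₁ (λ x → upper (str x))
  upper₁ = ext (λ v → correct (lookup v 0F))
    (sumᵖ (app₂ (λ a x → ind (str x) (str a)) ind₂ A (varᵖ 1F) *ᵖ app₁ (λ a → capital (str a)) capital₁ A) side₁ *ᵖ pow2ᵖ (lenᵖ (varᵖ 0F)) (tiny-len (varᵖ 0F)))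
    where
    A : PS 2 (λ v → 2 ^ evalPoly g (len (lookup v 1F)) ∸ 1 + lookup v 0F)
    A = app₁ (λ x → 2 ^ evalPoly g (len x)) side₁ (varᵖ 1F) ∸ᵖ constᵖ 1 +ᵖ varᵖ 0F
    correct : ∀ x → sumTo (λ j → ind (str x) (str (2 ^ evalPoly g (len x) ∸ 1 + j)) * capital (str (2 ^ evalPoly g (len x) ∸ 1 + j))) (2 ^ evalPoly g (len x)) * 2 ^ len x ≡ upper (str x)
    correct x rewrite len-str x = cong (_* 2 ^ length (str x)) (sym (sumStr-sumTo (evalPoly g (length (str x))) (λ a → ind (str x) a * capital a)))

  D-computable : PSpaceComputable encBits length encℚ D
  D-computable = Interface.computable
    (app₁ binCode binCode₁ (app₂ lowNum lowNum₂ upper₁ lower₁)) (app₁ binCode binCode₁ (app₂ lowDen lowDen₂ upper₁ lower₁)) D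
    (λ α → trans (cong (λ w → str (binCode (lowNum (upper w) (lower w)))) (str-val α)) (trans (str-binCode (lowNum (upper α) (lower α))) (cong bin (lowNum-frac (upper α) (lower α) (lower>0 α)))))
    (λ α → trans (cong (λ w → str (binCode (lowDen (upper w) (lower w)))) (str-val α)) (trans (str-binCode (lowDen (upper α) (lower α))) (cong bin (lowDen-frac (upper α) (lower α) (lower>0 α)))))
    where
    str-binCode : ∀ n → str (binCode n) ≡ bin n
    str-binCode n = trans (cong str (binCode-bin n)) (str-val (bin n))

  -- Success of the new martingale

  module _ (Z : Subset) where

    Y : ℕ → List Bool
    Y i = reverse (prefixY Z V i)

    Y-suc : ∀ i → Y (suc i) ≡ Z (query (Y i)) ∷ Y i
    Y-suc i = trans (reverse-++ (prefixY Z V i) (Z (V (prefixY Z V i)) ∷ [])) (cong (λ w → Z (V w) ∷ Y i) (sym (reverse-involutive (prefixY Z V i))))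

    -- The successor makes the bound strict: `Z` cut off here answers every query made along `Y i`.
    queryBound : ℕ → ℕ
    queryBound zero    = 0
    queryBound (suc i) = suc (query (Y i)) ⊔ queryBound i

    module _ {n : ℕ} where

      ∧-true : ∀ {s t} → s ∧ t ≡ true → s ≡ true × t ≡ true
      ∧-true {true} {true} _ = refl , refl

      -- By induction the run has followed `Y` so far. It then asks the same next question, which
      -- lies below n, and compatibility imposes the answer of `Z`.
      follows : ∀ i a → queryBound i ≤ n → length a ≡ i → compatible (Z ↾ n) a ≡ true → a ≡ Y i
      follows zero    []      le l c = refl
      follows (suc i) (b ∷ a) le l c = trans (cong₂ _∷_ (trans b≡ (cong (λ w → Z (query w)) ih)) ih) (sym (Y-suc i))
        where
        ih : a ≡ Y i
        ih = follows i a (≤-trans (m≤n⊔m (suc (query (Y i))) (queryBound i)) le) (suc-injective l) (proj₂ (∧-true {answers (Z ↾ n) b a} c))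
        q< : query a < n
        q< = ≤-trans (≤-reflexive (cong (λ w → suc (query w)) ih)) (≤-trans (m≤m⊔n (suc (query (Y i))) (queryBound i)) le)
        bit-≡ᵇ : ∀ b c → (bit b ≡ᵇ bit c) ≡ true → b ≡ c
        bit-≡ᵇ false false _ = refl
        bit-≡ᵇ true  true  _ = refl
        b≡ : b ≡ Z (query a)
        b≡ = bit-≡ᵇ b (Z (query a)) (trans (cong (bit b ≡ᵇ_) (sym (at-↾ Z q<))) (trans (sym (forced-answer (Z ↾ n) b a (subst (query a <_) (sym (length-↾ Z n)) q<))) (proj₁ (∧-true c))))

      -- A longer compatible string extends `Y i`, and savings never decrease.
      saved-follows : ∀ i a → queryBound i ≤ n → i ≤ length a → compatible (Z ↾ n) a ≡ true → saved (Y i) ≤ saved a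
      saved-follows i a le l c with m≤n⇒m<n∨m≡n l
      ... | inj₂ refl = ≤-reflexive (cong saved (sym (follows i a le refl c)))
      saved-follows i (b ∷ a) le l c | inj₁ (s≤s l′) = ≤-trans (saved-follows i a le l′ (proj₂ (∧-true {answers (Z ↾ n) b a} c))) (saved-mono b a)

    upper-large : ∀ i K → K ≤ saved (Y i) → K * lower (Z ↾ queryBound i) ≤ upper (Z ↾ queryBound i)
    upper-large i K le = *-cancelˡ-≤ (4 ^ m) {{>-nonZero (m^n>0 4 m)}} (begin
      4 ^ m * (K * 4 ^ G) ≡⟨ cong (_* (K * 4 ^ G)) (4^-square m) ⟩
      2 ^ m * 2 ^ m * (K * 4 ^ G) ≡⟨ lemma₁ (2 ^ m) K (4 ^ G) ⟩
      2 ^ m * (2 ^ m * K) * 4 ^ G ≤⟨ *-monoˡ-≤ (4 ^ G) (total-≥ x m (2 ^ m * K) large) ⟩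
      total x m * 2 ^ length x * 4 ^ G ≡⟨ lemma₂ (total x m) (2 ^ length x) (4 ^ G) ⟩
      total x m * 4 ^ G * 2 ^ length x ≡⟨ cong (_* 2 ^ length x) (total-late x m (m≤m+n G i)) ⟩
      4 ^ m * total x G * 2 ^ length x ≡⟨ *-assoc (4 ^ m) (total x G) (2 ^ length x) ⟩
      4 ^ m * (total x G * 2 ^ length x) ∎)
      where
      open ≤-Reasoning
      x = Z ↾ queryBound i
      G = evalPoly g (length x)
      -- Long enough for `total-late`, which needs G, and for every compatible string to extend
      -- `Y i`, which needs i.
      m = G + i
      lemma₁ : ∀ e k f → e * e * (k * f) ≡ e * (e * k) * f
      lemma₁ = solve-∀
      lemma₂ : ∀ a b c → a * b * c ≡ a * c * b
      lemma₂ = solve-∀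
      large : ∀ a → length a ≡ m → compatible x a ≡ true → 2 ^ m * K ≤ capital a
      large a l c = ≤-trans (*-mono-≤ (≤-reflexive (cong (2 ^_) (sym l))) (≤-trans le (saved-follows i a ≤-refl (≤-trans (m≤n+m i G) (≤-reflexive (sym l))) c))) (capital-saved a)

    -- The successor of the absolute value of the numerator of c exceeds c. When `N` passes 2 ^
    -- (`suc K + c₀`), at least `K` has been put aside along `Y i`, and `D` attains `K` once the
    -- prefix of `Z` answers all these queries.
    D-succeeds : Succeeds N (Z ∘ˢ V) → Succeeds D Z
    D-succeeds succ c with succ (frac (2 ^ (suc K + c₀)) 1)
      where K = suc ∣ ℚ.numerator c ∣
    ... | i , lt = queryBound i , frac-> c {upper (Z ↾ queryBound i)} {lower (Z ↾ queryBound i)} {K} (lower>0 (Z ↾ queryBound i)) ≤-refl (upper-large i K (saved-large (Y i) K big))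
      where
      K = suc ∣ ℚ.numerator c ∣
      back-Y : (Z ∘ˢ V) ↾ i ≡ reverse (Y i)
      back-Y = trans (↾-∘ˢ Z V i) (sym (reverse-involutive (prefixY Z V i)))
      big : 2 ^ (suc K + c₀) * Q (Y i) ≤ P (Y i)
      big = frac-<⁻¹ {2 ^ (suc K + c₀)} {N (reverse (Y i))} (proj₁ N-martingale (reverse (Y i))) (subst (λ w → frac (2 ^ (suc K + c₀)) 1 ℚ′.< N w) back-Y lt)

theorem4p5 : (V : List Bool → ℕ) → IsScanning V →
    PSpaceComputable encBits length encUnary V →
    (Σ Poly λ g → Filling (evalPoly g) V) →
    (Z : Subset) → PSpaceRandom Z → PSpaceRandom (Z ∘ˢ V)
theorem4p5 V scanning V-computable (g , filling) Z random N (N-martingale , N-computable) succeeds =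
  random D (D-martingale , D-computable) (D-succeeds Z succeeds)
  where open Transform V scanning V-computable g filling N N-martingale N-computable
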